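{- Let $n\ge3$. Then (a) $P_n(0,0)=0$; (b) $P_n(\pm1,0)=1$; (c) $3\mid P_n(0,\pm1)$ if and only if $n=2\cdot3^m$ for some $m\ge1$; (d) $3\mid P_n(\pm1,1)$ if and only if $n=4\cdot3^m$ for some $m\ge0$; (e) $3\mid P_n(\pm1,-1)$ if and only if $n=3\cdot3^m$ for some $m\ge0$.
   Context: Let $\Phi_n(q)$ be the $n$th cyclotomic polynomial and $\phi$ the Euler totient function. For $n\ge 2$, $\Phi_n(q)$ is palindromic of degree $\phi(n)$ with constant term $1$, so there are unique complex numbers $\gamma_j$ with $\Phi_n(q)=\sum_{0\le j\le \phi(n)/2}\gamma_j q^j(1+q)^{\phi(n)-2j}$; the $n$th Lucas atom is $P_n(s,t)=\sum_j \gamma_j s^{\phi(n)-2j}(-t)^j$ (a polynomial with integer coefficients). -}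

module Defs where

open import Data.Nat as ℕ using (ℕ; zero; suc)
open import Data.Nat.GCD using (gcd)
open import Data.Nat.Divisibility using (_∣?_)
open import Data.Nat.Combinatorics using (_C_)
open import Data.Integer as ℤ using (ℤ; +_; -_)
open import Data.List using (List; []; _∷_; _++_; map; reverse; length; foldr; replicate; filter; upTo; zip; applyUpTo)
open import Data.Product using (_×_; _,_; proj₁; proj₂)
open import Relation.Nullary.Decidable using (does)
open import Data.Bool using (if_then_else_)

totient : ℕ → ℕ
totient n = length (filter (λ k → gcd k n ℕ.≟ 1) (applyUpTo suc n))

-- Integer polynomials as coefficient lists, lowest degree first.

Poly : Set
Poly = List ℤ

sumℤ : List ℤ → ℤ
sumℤ = foldr ℤ._+_ (+ 0)

coeff : Poly → ℕ → ℤ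
coeff []       _       = + 0
coeff (a ∷ _)  zero    = a
coeff (_ ∷ as) (suc i) = coeff as i

infixl 6 _+ₚ_
infixl 7 _*ₚ_

_+ₚ_ : Poly → Poly → Poly
[]       +ₚ q        = q
(a ∷ p)  +ₚ []       = a ∷ p
(a ∷ p)  +ₚ (b ∷ q)  = (a ℤ.+ b) ∷ (p +ₚ q)

_*ₚ_ : Poly → Poly → Poly
[]      *ₚ q = []
(a ∷ p) *ₚ q = map (a ℤ.*_) q +ₚ (+ 0 ∷ (p *ₚ q))

productₚ : List Poly → Poly
productₚ = foldr _*ₚ_ (+ 1 ∷ [])

Xⁿ-1 : ℕ → Poly
Xⁿ-1 zero    = []
Xⁿ-1 (suc n) = - (+ 1) ∷ (replicate n (+ 0) ++ (+ 1 ∷ []))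

-- Long division by a monic polynomial, on highest-degree-first lists.
-- subFront xs ys subtracts ys from the leading part of xs.
private
  subFront : List ℤ → List ℤ → List ℤ
  subFront xs       []       = xs
  subFront []       (y ∷ ys) = (- y) ∷ subFront [] ys
  subFront (x ∷ xs) (y ∷ ys) = (x ℤ.- y) ∷ subFront xs ys

  divHF : ℕ → List ℤ → List ℤ → List ℤ
  divHF zero    _        _        = []
  divHF (suc f) []       _        = []
  divHF (suc f) (c ∷ ds) []       = []
  divHF (suc f) (c ∷ ds) (_ ∷ bs) =
    if does (suc (length bs) ℕ.≤? suc (length ds))
    then c ∷ divHF f (subFront ds (map (c ℤ.*_) bs)) (+ 1 ∷ bs)
    else []

divMonic : Poly → Poly → Poly
divMonic a b = reverse (divHF (length a) (reverse a) (reverse b))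

-- Cyclotomic polynomials, via  q^n - 1 = ∏_{d ∣ n} Φ_d(q):
--   Φ_n = (q^n - 1) / ∏_{d ∣ n, d < n} Φ_d .
-- cycTable k = [(1 , Φ_1) , … , (k , Φ_k)]

cycStep : ℕ → List (ℕ × Poly) → Poly
cycStep n t =
  divMonic (Xⁿ-1 n)
    (productₚ (map proj₂ (filter (λ e → proj₁ e ∣? n) t)))

cycTable : ℕ → List (ℕ × Poly)
cycTable zero    = []
cycTable (suc k) = let t = cycTable k in t ++ ((suc k , cycStep (suc k) t) ∷ [])

-- Φ n  (meaningful for n ≥ 1)
Φ : ℕ → Poly
Φ n = cycStep n (cycTable (n ℕ.∸ 1))

-- Lucas atoms.
-- For D = φ(n), the γ_j (0 ≤ j ≤ ⌊D/2⌋) are the unique solution of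
--   Φ_n(q) = Σ_j γ_j q^j (1+q)^(D-2j).
-- Comparing coefficients of q^i (i ≤ ⌊D/2⌋) gives the triangular system
--   coeff Φ_n i = Σ_{j ≤ i} γ_j · C(D-2j, i-j),
-- which determines γ_0, …, γ_⌊D/2⌋ recursively.

private
  indexed : List ℤ → List (ℕ × ℤ)
  indexed xs = zip (upTo (length xs)) xs

  gammasUpTo : Poly → ℕ → ℕ → List ℤ
  gammasUpTo c D zero    = coeff c 0 ∷ []
  gammasUpTo c D (suc i) =
    let gs = gammasUpTo c D i in
    gs ++ ((coeff c (suc i) ℤ.-
             sumℤ (map (λ e → proj₂ e ℤ.* (+ ((D ℕ.∸ (2 ℕ.* proj₁ e)) C (suc i ℕ.∸ proj₁ e))))
                      (indexed gs))) ∷ [])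

lucasγ : ℕ → List ℤ
lucasγ n = gammasUpTo (Φ n) (totient n) (totient n ℕ./ 2)

-- P_n(s,t) = Σ_j γ_j s^(φ(n)-2j) (-t)^j   (with 0^0 = 1)
P : ℕ → ℤ → ℤ → ℤ
P n s t =
  sumℤ (map (λ e → proj₂ e ℤ.* ((s ℤ.^ (totient n ℕ.∸ (2 ℕ.* proj₁ e))) ℤ.* ((- t) ℤ.^ proj₁ e)))
           (indexed (lucasγ n)))

{-# OPTIONS --safe #-}
module Submission where

open import Defs
open import Algebra.Bundles using (CommutativeRing)
import Algebra.Properties.CommutativeSemiring.Exp as Exp
import Algebra.Properties.Semiring.Divisibility as Divisibility
open import Data.Bool using (if_then_else_; true; false)
open import Data.Integer as ℤ using (ℤ; +_; -_)
import Data.Integer.DivMod as ℤ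
import Data.Integer.Divisibility as ℤ
import Data.Integer.Divisibility.Signed as ℤ∣
import Data.Integer.Properties as ℤ
import Data.Integer.Tactic.RingSolver as ℤ-Solver
open import Data.List using (List; []; _∷_; _∷ʳ_; _++_; map; length; reverse; replicate; foldl; filter; upTo; applyUpTo; zip)
import Data.List.Properties as List
open import Data.List.Relation.Unary.All using (All; []; _∷_)
import Data.List.Relation.Unary.All.Properties as All
open import Data.Maybe using (Maybe; just; nothing)
open import Data.Nat as ℕ using (ℕ; zero; suc)
open import Data.Nat.Combinatorics using (_C_; nCk+nC[k+1]≡[n+1]C[k+1]; k>n⇒nCk≡0)
import Data.Nat.DivMod as ℕ
import Data.Nat.Divisibility as ℕ
open import Data.Nat.GCD using (gcd; gcd-GCD; gcd[m,n]∣m; gcd[m,n]∣n; gcd[m,n]≡0⇒n≡0; c*gcd[m,n]≡gcd[cm,cn]; module Bézout)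
open import Data.Nat.Primality using (prime?; euclidsLemma)
import Data.Nat.Properties as ℕ
import Data.Nat.Tactic.RingSolver as ℕ-Solver
open import Data.Product using (_×_; _,_; proj₁; proj₂; ∃-syntax)
open import Data.Sum using (_⊎_; inj₁; inj₂; [_,_]′)
open import Function using (id; _∘_)
open import Function.Bundles using (_⇔_; mk⇔; module Equivalence)
import Function.Properties.Equivalence as ⇔
open import Level using (0ℓ)
open import Relation.Binary.Definitions using (tri<; tri≈; tri>)
open import Relation.Binary.PropositionalEquality
import Relation.Binary.Reasoning.Setoid as SetoidReasoning
open import Relation.Nullary using (Dec; yes; no; ¬_; contradiction)
open import Relation.Nullary.Decidable using (does; dec-true; dec-false; from-yes; from-no; _×-dec_; ¬?)
import Tactic.RingSolver.Core.AlmostCommutativeRing as ACR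
open import Tactic.RingSolver.Core.Expression using (_⊕_; _⊗_; ⊝_; Κ)
import Tactic.RingSolver.NonReflective as Solver

-- Setting q = α in the γ-expansion of Φₙ gives Φₙ(α) = Pₙ(1 + α , -α), and Pₙ is
-- homogeneous (s of weight 1, t of weight 2).  Modulo 3 in ℤ[i], the values of Pₙ in (c),
-- (d) and (e) are therefore unit multiples of Φₙ(α) at α = -1, i and 1, roots of unity of
-- order e = 2, 4 and 1.  There 3 ∣ Φₙ(α) exactly when n = e·3ᵃ: if e ∤ n then
-- Φₙ(α) divides αⁿ - 1, which is prime to 3; if n = m·e·3ᵃ with 3 ∤ m > 1 then, with
-- k = e·3ᵃ, Φₙ(α) divides the value m of (qⁿ - 1)/(qᵏ - 1) at α; and for n = e·3ᵃ
-- with a > 0 the value 3 of (qⁿ - 1)/(q^(n/3) - 1) is a product of values Φ_d(α), whose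
-- only factor that can be divisible by the prime 3 of ℤ[i] is Φₙ(α).
--
-- That the long divisions defining Φₙ are exact rests on the Φ_d being pairwise coprime,
-- which follows by the Euclidean algorithm on exponents.

-- Gauss' identity Σ_{d ∣ n} φ(d) = n

-- The three points α come from solving l s = 1 + α, l² (-t) = α modulo 3. For s = 0 this forces α =
-- -1. For s = ±1, eliminating l leaves -t (1 + α)² = α: when t = 1 this is α² + 1 = 0, and when t =
-- -1 it is α² + α + 1 = (α - 1)² = 0, whence α = i and α = 1. All three lie in ℤ[i], so one ring
-- serves every case. The definitions shape the rest. `Φ n` is a long division that discards its
-- remainder, while `P` takes its exponents from `totient n` and sees only the lower half of the
-- coefficients of `Φ n`. Monicity, exactness and the degree `totient n` are therefore proved
-- together by strong induction, the degree coming from Gauss' identity, and palindromicity supplies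
-- the upper half of the γ-expansion.

sumTo : ℕ → (ℕ → ℕ) → ℕ
sumTo zero    f = 0
sumTo (suc n) f = sumTo n f ℕ.+ f (suc n)

sumTo-cong : ∀ n {f g} → (∀ i → 1 ℕ.≤ i → i ℕ.≤ n → f i ≡ g i) → sumTo n f ≡ sumTo n g
sumTo-cong zero    e = refl
sumTo-cong (suc n) e =
  cong₂ ℕ._+_ (sumTo-cong n λ i 1≤i i≤n → e i 1≤i (ℕ.m≤n⇒m≤1+n i≤n)) (e (suc n) (ℕ.s≤s ℕ.z≤n) ℕ.≤-refl)

sumTo-zero : ∀ n {f} → (∀ i → 1 ℕ.≤ i → i ℕ.≤ n → f i ≡ 0) → sumTo n f ≡ 0
sumTo-zero n e = trans (sumTo-cong n e) (const-zero n)
  where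
  const-zero : ∀ n → sumTo n (λ _ → 0) ≡ 0
  const-zero zero    = refl
  const-zero (suc n) = trans (ℕ.+-identityʳ _) (const-zero n)

sumTo-one : ∀ n → sumTo n (λ _ → 1) ≡ n
sumTo-one zero    = refl
sumTo-one (suc n) = trans (ℕ.+-comm _ 1) (cong suc (sumTo-one n))

sumTo-+ : ∀ n f g → sumTo n (λ i → f i ℕ.+ g i) ≡ sumTo n f ℕ.+ sumTo n g
sumTo-+ zero    f g = refl
sumTo-+ (suc n) f g = trans (cong (ℕ._+ (f (suc n) ℕ.+ g (suc n))) (sumTo-+ n f g)) (lemma (sumTo n f) (sumTo n g) _ _)
  where
  lemma : ∀ a b c d → a ℕ.+ b ℕ.+ (c ℕ.+ d) ≡ a ℕ.+ c ℕ.+ (b ℕ.+ d)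
  lemma = ℕ-Solver.solve-∀

sumTo-swap : ∀ m n (f : ℕ → ℕ → ℕ) → sumTo m (λ i → sumTo n (f i)) ≡ sumTo n (λ j → sumTo m (λ i → f i j))
sumTo-swap zero    n f = sym (sumTo-zero n λ _ _ _ → refl)
sumTo-swap (suc m) n f =
  trans (cong (ℕ._+ sumTo n (f (suc m))) (sumTo-swap m n f)) (sym (sumTo-+ n (λ j → sumTo m (λ i → f i j)) (f (suc m))))

sumTo-append : ∀ m n f → sumTo (m ℕ.+ n) f ≡ sumTo m f ℕ.+ sumTo n (λ i → f (m ℕ.+ i))
sumTo-append m zero    f rewrite ℕ.+-identityʳ m = sym (ℕ.+-identityʳ _)
sumTo-append m (suc n) f rewrite ℕ.+-suc m n =
  trans (cong (ℕ._+ f (suc (m ℕ.+ n))) (sumTo-append m n f)) (ℕ.+-assoc (sumTo m f) _ _)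

sumTo-single : ∀ n k {f} → 1 ℕ.≤ k → k ℕ.≤ n → (∀ i → i ≢ k → f i ≡ 0) → sumTo n f ≡ f k
sumTo-single zero    (suc k) 1≤k ()  e
sumTo-single (suc n) k {f} 1≤k k≤1+n e with ℕ.m≤n⇒m<n∨m≡n k≤1+n
... | inj₁ (ℕ.s≤s k≤n) = trans (cong₂ ℕ._+_ (sumTo-single n k 1≤k k≤n e) (e (suc n) λ { refl → ℕ.1+n≰n k≤n })) (ℕ.+-identityʳ _)
... | inj₂ refl = cong (ℕ._+ f (suc n)) (sumTo-zero n λ i _ i≤n → e i λ { refl → ℕ.1+n≰n i≤n })

𝟙 : {A : Set} → Dec A → ℕ
𝟙 a? = if does a? then 1 else 0

𝟙-yes : {A : Set} (a? : Dec A) → A → 𝟙 a? ≡ 1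
𝟙-yes a? a rewrite dec-true a? a = refl

𝟙-no : {A : Set} (a? : Dec A) → ¬ A → 𝟙 a? ≡ 0
𝟙-no a? ¬a rewrite dec-false a? ¬a = refl

𝟙-cong : {A B : Set} (a? : Dec A) (b? : Dec B) → (A → B) → (B → A) → 𝟙 a? ≡ 𝟙 b?
𝟙-cong a? (yes b) f g = 𝟙-yes a? (g b)
𝟙-cong a? (no ¬b) f g = 𝟙-no a? λ a → ¬b (f a)

-- Each block of `suc g` consecutive indices contains exactly one multiple of `suc g`, namely its
-- last element.
sumTo-multiples : ∀ d g {f} → (∀ i → ¬ (suc g ℕ.∣ i) → f i ≡ 0) →
                  sumTo (d ℕ.* suc g) f ≡ sumTo d (λ j → f (j ℕ.* suc g))
sumTo-multiples zero    g     e = refl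
sumTo-multiples (suc d) g {f} e = begin
  sumTo (suc g ℕ.+ d ℕ.* suc g) f
    ≡⟨ cong (λ n → sumTo n f) (ℕ.+-comm (suc g) (d ℕ.* suc g)) ⟩
  sumTo (d ℕ.* suc g ℕ.+ suc g) f
    ≡⟨ sumTo-append (d ℕ.* suc g) (suc g) f ⟩
  sumTo (d ℕ.* suc g) f ℕ.+ (sumTo g (λ i → f (d ℕ.* suc g ℕ.+ i)) ℕ.+ f (d ℕ.* suc g ℕ.+ suc g))
    ≡⟨ cong₂ ℕ._+_ (sumTo-multiples d g e) (cong₂ ℕ._+_ (sumTo-zero g λ i 1≤i i≤g → e _ (off-multiple i 1≤i i≤g)) (cong f (ℕ.+-comm (d ℕ.* suc g) (suc g)))) ⟩
  sumTo (suc d) (λ j → f (j ℕ.* suc g)) ∎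
  where
  open ≡-Reasoning
  off-multiple : ∀ i → 1 ℕ.≤ i → i ℕ.≤ g → ¬ (suc g ℕ.∣ d ℕ.* suc g ℕ.+ i)
  off-multiple (suc i) _ i≤g g∣ =
    ℕ.<⇒≱ (ℕ.s≤s i≤g) (ℕ.∣⇒≤ (ℕ.∣m+n∣m⇒∣n g∣ (ℕ.n∣m*n d)))

totient≡sumTo : ∀ n → totient n ≡ sumTo n (λ k → 𝟙 (gcd k n ℕ.≟ 1))
totient≡sumTo n = go n
  where
  go : ∀ m → length (filter (λ k → gcd k n ℕ.≟ 1) (applyUpTo suc m)) ≡ sumTo m (λ k → 𝟙 (gcd k n ℕ.≟ 1))
  go zero = refl
  go (suc m) = begin
    length (filter P? (applyUpTo suc (suc m)))
      ≡⟨ cong (λ xs → length (filter P? xs)) (List.applyUpTo-∷ʳ suc m) ⟨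
    length (filter P? (applyUpTo suc m ∷ʳ suc m))
      ≡⟨ cong length (List.filter-++ P? (applyUpTo suc m) _) ⟩
    length (filter P? (applyUpTo suc m) ++ filter P? (suc m ∷ []))
      ≡⟨ List.length-++ (filter P? (applyUpTo suc m)) ⟩
    length (filter P? (applyUpTo suc m)) ℕ.+ length (filter P? (suc m ∷ [])) ≡⟨ cong₂ ℕ._+_ (go m) last ⟩
    sumTo (suc m) (λ k → 𝟙 (P? k))                                        ∎
    where
    open ≡-Reasoning
    P? = λ k → gcd k n ℕ.≟ 1
    last : length (filter P? (suc m ∷ [])) ≡ 𝟙 (P? (suc m))
    last with does (P? (suc m))
    ... | true  = refl
    ... | false = refl

-- The k ≤ n with gcd (k , n) = n / d are the multiples j n / d with j ≤ d coprime to d.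
count-gcd : ∀ d n .{{_ : ℕ.NonZero n}} → (d∣?n : Dec (d ℕ.∣ n)) →
            (if does d∣?n then totient d else 0) ≡ sumTo n (λ k → 𝟙 (gcd k n ℕ.* d ℕ.≟ n))
count-gcd d n (no d∤n) = sym (sumTo-zero n λ k _ _ → 𝟙-no (_ ℕ.≟ n) λ e → d∤n (ℕ.divides (gcd k n) (sym e)))
count-gcd d n@(suc _) (yes (ℕ.divides g@(suc g-1) n≡gd)) = begin
  totient d                                                          ≡⟨ totient≡sumTo d ⟩
  sumTo d (λ j → 𝟙 (gcd j d ℕ.≟ 1))
    ≡⟨ sumTo-cong d (λ j _ _ → 𝟙-cong (gcd j d ℕ.≟ 1) (gcd (j ℕ.* g) n ℕ.* d ℕ.≟ n) (to j) (from j)) ⟩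
  sumTo d (λ j → 𝟙 (gcd (j ℕ.* g) n ℕ.* d ℕ.≟ n))                    ≡⟨ sumTo-multiples d g-1 off ⟨
  sumTo (d ℕ.* g) (λ k → 𝟙 (gcd k n ℕ.* d ℕ.≟ n))
    ≡⟨ cong (λ m → sumTo m (λ k → 𝟙 (gcd k n ℕ.* d ℕ.≟ n))) (trans (ℕ.*-comm d g) (sym n≡gd)) ⟩
  sumTo n (λ k → 𝟙 (gcd k n ℕ.* d ℕ.≟ n))                            ∎
  where
  open ≡-Reasoning
  d≢0 : d ≢ 0
  d≢0 refl = contradiction (trans n≡gd (ℕ.*-zeroʳ g)) λ ()
  instance
    d-nonZero : ℕ.NonZero d
    d-nonZero = ℕ.≢-nonZero d≢0
  gcd≡ : ∀ j → gcd (j ℕ.* g) n ≡ g ℕ.* gcd j d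
  gcd≡ j = trans (cong₂ gcd (ℕ.*-comm j g) n≡gd) (sym (c*gcd[m,n]≡gcd[cm,cn] g j d))
  to : ∀ j → gcd j d ≡ 1 → gcd (j ℕ.* g) n ℕ.* d ≡ n
  to j e = trans (cong (ℕ._* d) (trans (gcd≡ j) (trans (cong (g ℕ.*_) e) (ℕ.*-identityʳ g)))) (sym n≡gd)
  from : ∀ j → gcd (j ℕ.* g) n ℕ.* d ≡ n → gcd j d ≡ 1
  from j e = ℕ.*-cancelˡ-≡ _ _ g (ℕ.*-cancelʳ-≡ _ _ d
    (trans (cong (ℕ._* d) (sym (gcd≡ j))) (trans e (trans n≡gd (cong (ℕ._* d) (sym (ℕ.*-identityʳ g)))))))
  off : ∀ k → ¬ (g ℕ.∣ k) → 𝟙 (gcd k n ℕ.* d ℕ.≟ n) ≡ 0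
  off k g∤k = 𝟙-no (_ ℕ.≟ n) λ e → g∤k (subst (ℕ._∣ k) (ℕ.*-cancelʳ-≡ _ _ d (trans e n≡gd)) (gcd[m,n]∣m k n))

-- Double counting of pairs: each k ≤ n is counted for exactly one d, the cofactor n / gcd (k , n).
Σ-totient : ∀ n .{{_ : ℕ.NonZero n}} → sumTo n (λ d → if does (d ℕ.∣? n) then totient d else 0) ≡ n
Σ-totient n = begin
  sumTo n (λ d → if does (d ℕ.∣? n) then totient d else 0)
    ≡⟨ sumTo-cong n (λ d _ _ → count-gcd d n (d ℕ.∣? n)) ⟩
  sumTo n (λ d → sumTo n (λ k → 𝟙 (gcd k n ℕ.* d ℕ.≟ n)))        ≡⟨ sumTo-swap n n _ ⟩
  sumTo n (λ k → sumTo n (λ d → 𝟙 (gcd k n ℕ.* d ℕ.≟ n)))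
    ≡⟨ sumTo-cong n (λ k _ _ → unique k (gcd[m,n]∣n k n)) ⟩
  sumTo n (λ _ → 1)                                              ≡⟨ sumTo-one n ⟩
  n                                                              ∎
  where
  open ≡-Reasoning
  unique : ∀ k → gcd k n ℕ.∣ n → sumTo n (λ d → 𝟙 (gcd k n ℕ.* d ℕ.≟ n)) ≡ 1
  unique k (ℕ.divides q n≡qg) = trans
    (sumTo-single n q (ℕ.n≢0⇒n>0 q≢0) (ℕ.∣⇒≤ (ℕ.divides (gcd k n) (sym gq≡n))) λ i i≢q → 𝟙-no (_ ℕ.≟ n) λ e →
      i≢q (ℕ.*-cancelˡ-≡ i q (gcd k n) (trans e (sym gq≡n))))
    (𝟙-yes (_ ℕ.≟ n) gq≡n)
    where
    gq≡n : gcd k n ℕ.* q ≡ n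
    gq≡n = trans (ℕ.*-comm (gcd k n) q) (sym n≡qg)
    q≢0 : q ≢ 0
    q≢0 refl = ℕ.≢-nonZero⁻¹ n n≡qg
    instance
      gcd-nonZero : ℕ.NonZero (gcd k n)
      gcd-nonZero = ℕ.≢-nonZero λ e → ℕ.≢-nonZero⁻¹ n (trans n≡qg (trans (cong (q ℕ.*_) e) (ℕ.*-zeroʳ q)))

-- The polynomial ring

infix 4 _≈_

-- Lists differing by trailing zeros are the same polynomial, so equality is coefficientwise. The
-- record keeps `p` and `q` visible in the type, where the bare family of equations would unfold
-- through `coeff`.
record _≈_ (p q : Poly) : Set where
  constructor mk≈
  field at : ∀ i → coeff p i ≡ coeff q i

open _≈_

-ₚ_ : Poly → Poly
-ₚ_ = map -_

scale : ℤ → Poly → Poly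
scale a = map (a ℤ.*_)

1ₚ : Poly
1ₚ = + 1 ∷ []

≈-refl : ∀ {p} → p ≈ p
≈-refl = mk≈ λ _ → refl

≈-sym : ∀ {p q} → p ≈ q → q ≈ p
≈-sym e = mk≈ λ i → sym (at e i)

≈-trans : ∀ {p q r} → p ≈ q → q ≈ r → p ≈ r
≈-trans e f = mk≈ λ i → trans (at e i) (at f i)

∷-cong : ∀ {a b p q} → a ≡ b → p ≈ q → a ∷ p ≈ b ∷ q
∷-cong a≡b p≈q = mk≈ λ { zero → a≡b ; (suc i) → at p≈q i }

∷-≈[] : ∀ {a p} → a ≡ + 0 → p ≈ [] → a ∷ p ≈ []
∷-≈[] a≡0 p≈[] = mk≈ λ { zero → a≡0 ; (suc i) → at p≈[] i }

coeff-+ : ∀ p q i → coeff (p +ₚ q) i ≡ coeff p i ℤ.+ coeff q i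
coeff-+ []      q       i       = sym (ℤ.+-identityˡ _)
coeff-+ (a ∷ p) []      i       = sym (ℤ.+-identityʳ _)
coeff-+ (a ∷ p) (b ∷ q) zero    = refl
coeff-+ (a ∷ p) (b ∷ q) (suc i) = coeff-+ p q i

coeff-scale : ∀ a p i → coeff (scale a p) i ≡ a ℤ.* coeff p i
coeff-scale a []      i       = sym (ℤ.*-zeroʳ a)
coeff-scale a (b ∷ p) zero    = refl
coeff-scale a (b ∷ p) (suc i) = coeff-scale a p i

coeff-neg : ∀ p i → coeff (-ₚ p) i ≡ - coeff p i
coeff-neg []      i       = refl
coeff-neg (a ∷ p) zero    = refl
coeff-neg (a ∷ p) (suc i) = coeff-neg p i

+-cong : ∀ {p p′ q q′} → p ≈ p′ → q ≈ q′ → p +ₚ q ≈ p′ +ₚ q′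
+-cong {p} {p′} {q} {q′} e f = mk≈ λ i →
  trans (coeff-+ p q i) (trans (cong₂ ℤ._+_ (at e i) (at f i)) (sym (coeff-+ p′ q′ i)))

+-assoc : ∀ p q r → (p +ₚ q) +ₚ r ≈ p +ₚ (q +ₚ r)
+-assoc p q r = mk≈ λ i → begin
  coeff (p +ₚ q +ₚ r) i                        ≡⟨ coeff-+ (p +ₚ q) r i ⟩
  coeff (p +ₚ q) i ℤ.+ coeff r i               ≡⟨ cong (ℤ._+ coeff r i) (coeff-+ p q i) ⟩
  coeff p i ℤ.+ coeff q i ℤ.+ coeff r i        ≡⟨ ℤ.+-assoc (coeff p i) _ _ ⟩
  coeff p i ℤ.+ (coeff q i ℤ.+ coeff r i)      ≡⟨ cong (ℤ._+_ (coeff p i)) (coeff-+ q r i) ⟨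
  coeff p i ℤ.+ coeff (q +ₚ r) i               ≡⟨ coeff-+ p (q +ₚ r) i ⟨
  coeff (p +ₚ (q +ₚ r)) i                      ∎
  where open ≡-Reasoning

+-comm : ∀ p q → p +ₚ q ≈ q +ₚ p
+-comm p q = mk≈ λ i →
  trans (coeff-+ p q i) (trans (ℤ.+-comm (coeff p i) _) (sym (coeff-+ q p i)))

+-identityʳ : ∀ p → p +ₚ [] ≈ p
+-identityʳ []      = ≈-refl
+-identityʳ (_ ∷ _) = ≈-refl

+-interchange : ∀ p q r s → (p +ₚ q) +ₚ (r +ₚ s) ≈ (p +ₚ r) +ₚ (q +ₚ s)
+-interchange p q r s = ≈-trans (+-assoc p q (r +ₚ s)) (≈-trans (+-cong (≈-refl {p})
  (≈-trans (≈-sym (+-assoc q r s)) (≈-trans (+-cong (+-comm q r) (≈-refl {s})) (+-assoc r q s))))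
  (≈-sym (+-assoc p r (q +ₚ s))))

-‿inverseʳ : ∀ p → p +ₚ (-ₚ p) ≈ []
-‿inverseʳ p = mk≈ λ i →
  trans (coeff-+ p (-ₚ p) i) (trans (cong (λ z → coeff p i ℤ.+ z) (coeff-neg p i)) (ℤ.+-inverseʳ (coeff p i)))

-‿cong : ∀ {p q} → p ≈ q → -ₚ p ≈ -ₚ q
-‿cong {p} {q} e = mk≈ λ i → trans (coeff-neg p i) (trans (cong -_ (at e i)) (sym (coeff-neg q i)))

scale-cong : ∀ a {p q} → p ≈ q → scale a p ≈ scale a q
scale-cong a {p} {q} e = mk≈ λ i →
  trans (coeff-scale a p i) (trans (cong (a ℤ.*_) (at e i)) (sym (coeff-scale a q i)))

scale-distribˡ : ∀ a p q → scale a (p +ₚ q) ≈ scale a p +ₚ scale a q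
scale-distribˡ a []      q       = ≈-refl
scale-distribˡ a (b ∷ p) []      = ≈-refl
scale-distribˡ a (b ∷ p) (c ∷ q) = ∷-cong (ℤ.*-distribˡ-+ a b c) (scale-distribˡ a p q)

scale-distribʳ : ∀ a b p → scale (a ℤ.+ b) p ≈ scale a p +ₚ scale b p
scale-distribʳ a b []      = ≈-refl
scale-distribʳ a b (c ∷ p) = ∷-cong (ℤ.*-distribʳ-+ c a b) (scale-distribʳ a b p)

scale-assoc : ∀ a b p → scale (a ℤ.* b) p ≈ scale a (scale b p)
scale-assoc a b []      = ≈-refl
scale-assoc a b (c ∷ p) = ∷-cong (ℤ.*-assoc a b c) (scale-assoc a b p)

scale-zero : ∀ p → scale (+ 0) p ≈ []
scale-zero p = mk≈ λ i → trans (coeff-scale (+ 0) p i) (ℤ.*-zeroˡ (coeff p i))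

scale-one : ∀ p → scale (+ 1) p ≈ p
scale-one p = mk≈ λ i → trans (coeff-scale (+ 1) p i) (ℤ.*-identityˡ _)

*-congˡ : ∀ p {q q′} → q ≈ q′ → p *ₚ q ≈ p *ₚ q′
*-congˡ []      e = ≈-refl
*-congˡ (a ∷ p) e = +-cong (scale-cong a e) (∷-cong refl (*-congˡ p e))

*-zeroʳ : ∀ p → p *ₚ [] ≈ []
*-zeroʳ []      = ≈-refl
*-zeroʳ (a ∷ p) = ∷-≈[] refl (*-zeroʳ p)

-- `_*ₚ_` recurses on its left factor; this is the mirror recursion on the right one, from which
-- commutativity follows by induction.
*-∷ : ∀ p b q → p *ₚ (b ∷ q) ≈ scale b p +ₚ (+ 0 ∷ p *ₚ q)
*-∷ []      b q = ≈-sym (∷-≈[] refl ≈-refl)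
*-∷ (a ∷ p) b q = ∷-cong (cong (ℤ._+ + 0) (ℤ.*-comm a b))
  (≈-trans (+-cong (≈-refl {scale a q}) (*-∷ p b q))
  (≈-trans (≈-sym (+-assoc (scale a q) (scale b p) _))
  (≈-trans (+-cong (+-comm (scale a q) (scale b p)) ≈-refl)
           (+-assoc (scale b p) (scale a q) _))))

*-comm : ∀ p q → p *ₚ q ≈ q *ₚ p
*-comm []      q = ≈-sym (*-zeroʳ q)
*-comm (a ∷ p) q = ≈-trans (+-cong (≈-refl {scale a q}) (∷-cong refl (*-comm p q))) (≈-sym (*-∷ q a p))

*-cong : ∀ {p p′ q q′} → p ≈ p′ → q ≈ q′ → p *ₚ q ≈ p′ *ₚ q′
*-cong {p} {p′} {q} {q′} e f =
  ≈-trans (*-congˡ p f) (≈-trans (*-comm p q′) (≈-trans (*-congˡ q′ e) (*-comm q′ p′)))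

*-distribˡ : ∀ p q r → p *ₚ (q +ₚ r) ≈ p *ₚ q +ₚ p *ₚ r
*-distribˡ []      q r = ≈-refl
*-distribˡ (a ∷ p) q r =
  ≈-trans (+-cong (scale-distribˡ a q r) (∷-cong refl (*-distribˡ p q r)))
          (+-interchange (scale a q) (scale a r) (+ 0 ∷ p *ₚ q) (+ 0 ∷ p *ₚ r))

*-distribʳ : ∀ p q r → (q +ₚ r) *ₚ p ≈ q *ₚ p +ₚ r *ₚ p
*-distribʳ p q r = ≈-trans (*-comm (q +ₚ r) p)
  (≈-trans (*-distribˡ p q r) (+-cong (*-comm p q) (*-comm p r)))

scale-* : ∀ a p q → scale a (p *ₚ q) ≈ scale a p *ₚ q
scale-* a []      q = ≈-refl
scale-* a (b ∷ p) q = ≈-trans (scale-distribˡ a (scale b q) _)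
  (+-cong (≈-sym (scale-assoc a b q)) (∷-cong (ℤ.*-zeroʳ a) (scale-* a p q)))

shift-* : ∀ p q → (+ 0 ∷ p) *ₚ q ≈ + 0 ∷ p *ₚ q
shift-* p q = +-cong (scale-zero q) ≈-refl

*-assoc : ∀ p q r → (p *ₚ q) *ₚ r ≈ p *ₚ (q *ₚ r)
*-assoc []      q r = ≈-refl
*-assoc (a ∷ p) q r = ≈-trans (*-distribʳ r (scale a q) (+ 0 ∷ p *ₚ q))
  (+-cong (≈-sym (scale-* a q r)) (≈-trans (shift-* (p *ₚ q) r) (∷-cong refl (*-assoc p q r))))

*-identityˡ : ∀ p → 1ₚ *ₚ p ≈ p
*-identityˡ p = ≈-trans (+-cong (scale-one p) (∷-≈[] refl ≈-refl)) (+-identityʳ p)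

polyRing : CommutativeRing 0ℓ 0ℓ
polyRing = record
  { Carrier = Poly ; _≈_ = _≈_ ; _+_ = _+ₚ_ ; _*_ = _*ₚ_ ; -_ = -ₚ_ ; 0# = [] ; 1# = 1ₚ
  ; isCommutativeRing = record
    { isRing = record
      { +-isAbelianGroup = record
        { isGroup = record
          { isMonoid = record
            { isSemigroup = record
              { isMagma = record
                { isEquivalence = record { refl = ≈-refl ; sym = ≈-sym ; trans = ≈-trans }
                ; ∙-cong = +-cong }
              ; assoc = +-assoc }
            ; identity = (λ _ → ≈-refl) , +-identityʳ }
          ; inverse = (λ p → ≈-trans (+-comm (-ₚ p) p) (-‿inverseʳ p)) , -‿inverseʳ
          ; ⁻¹-cong = -‿cong }
        ; comm = +-comm }
      ; *-cong = *-cong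
      ; *-assoc = *-assoc
      ; *-identity = *-identityˡ , (λ p → ≈-trans (*-comm p 1ₚ) (*-identityˡ p))
      ; distrib = *-distribˡ , *-distribʳ }
    ; *-comm = *-comm } }

-- Recognising zero lets the solver cancel terms.
[]≟ : ∀ p → Maybe ([] ≈ p)
[]≟ []      = just ≈-refl
[]≟ (a ∷ p) with a ℤ.≟ + 0 | []≟ p
... | yes a≡0 | just e = just (≈-sym (∷-≈[] a≡0 (≈-sym e)))
... | _       | _      = nothing

open Solver (ACR.fromCommutativeRing polyRing []≟) using (solve)
open Exp (CommutativeRing.commutativeSemiring polyRing) using (^-homo-*; ^-assocʳ) renaming (_^_ to _^ₚ_)
open Divisibility (CommutativeRing.semiring polyRing)
  using (∣ʳ-trans; ∣ʳ-respʳ-≈; ∣ʳ-respˡ-≈; x∣ʳyx; x∣ʳy⇒x∣ʳzy; 1∣_) renaming (_∣_ to _∣ₚ_; _,_ to _,∣_)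
open SetoidReasoning (CommutativeRing.setoid polyRing)

κ : ℤ → Poly
κ a = a ∷ []

X : Poly
X = + 0 ∷ + 1 ∷ []

κ-* : ∀ a p → κ a *ₚ p ≈ scale a p
κ-* a p = ≈-trans (+-cong ≈-refl (∷-≈[] refl ≈-refl)) (+-identityʳ _)

X-* : ∀ p → X *ₚ p ≈ + 0 ∷ p
X-* p = ≈-trans (shift-* 1ₚ p) (∷-cong refl (*-identityˡ p))

-- Degrees and monic polynomials

Deg< : ℕ → Poly → Set
Deg< m p = ∀ i → m ℕ.≤ i → coeff p i ≡ + 0

-- Exact list length matters: long division reads off the last list entry.
record Monic (m : ℕ) (p : Poly) : Set where
  constructor monic
  field
    length≡ : length p ≡ suc m
    leading : coeff p m ≡ + 1

open Monic

deg<-length : ∀ p → Deg< (length p) p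
deg<-length []      i       _           = refl
deg<-length (a ∷ p) (suc i) (ℕ.s≤s l≤i) = deg<-length p i l≤i

Monic⇒Deg< : ∀ {m p} → Monic m p → Deg< (suc m) p
Monic⇒Deg< {p = p} (monic l _) i m<i = deg<-length p i (subst (ℕ._≤ i) (sym l) m<i)

Deg<-cong : ∀ {m p q} → p ≈ q → Deg< m p → Deg< m q
Deg<-cong p≈q d i m≤i = trans (sym (at p≈q i)) (d i m≤i)

coeff-*-top : ∀ m l p q → Deg< (suc m) p → Deg< (suc l) q →
              coeff (p *ₚ q) (m ℕ.+ l) ≡ coeff p m ℤ.* coeff q l
coeff-*-top m l [] q dp dq = sym (ℤ.*-zeroˡ (coeff q l))
coeff-*-top zero l (a ∷ p) q dp dq =
  trans (coeff-+ (scale a q) _ l)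
  (trans (cong₂ ℤ._+_ (coeff-scale a q l) (at 0∷pq≈[] l)) (ℤ.+-identityʳ _))
  where
  0∷pq≈[] : + 0 ∷ p *ₚ q ≈ []
  0∷pq≈[] = ∷-≈[] refl (*-cong {p} {[]} {q} (mk≈ λ i → dp (suc i) (ℕ.s≤s ℕ.z≤n)) ≈-refl)
coeff-*-top (suc m) l (a ∷ p) q dp dq =
  trans (coeff-+ (scale a q) _ (suc m ℕ.+ l))
  (trans (cong₂ ℤ._+_ (trans (coeff-scale a q _) (trans (cong (a ℤ.*_) (dq _ (ℕ.s≤s (ℕ.m≤n+m l m)))) (ℤ.*-zeroʳ a)))
                      (coeff-*-top m l p q (λ i m<i → dp (suc i) (ℕ.s≤s m<i)) dq))
         (ℤ.+-identityˡ _))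

length-+ₚ : ∀ p q → length (p +ₚ q) ≡ length p ℕ.⊔ length q
length-+ₚ []      q       = refl
length-+ₚ (a ∷ p) []      = refl
length-+ₚ (a ∷ p) (b ∷ q) = cong suc (length-+ₚ p q)

length-*ₚ : ∀ a p b q → length ((a ∷ p) *ₚ (b ∷ q)) ≡ suc (length p ℕ.+ length q)
length-*ₚ a [] b q = cong suc (trans (length-+ₚ (scale a q) []) (trans (ℕ.⊔-identityʳ _) (List.length-map _ q)))
length-*ₚ a (a′ ∷ p) b q = cong suc
  (trans (length-+ₚ (scale a q) _)
  (trans (cong₂ ℕ._⊔_ (List.length-map _ q) (length-*ₚ a′ p b q))
         (ℕ.m≤n⇒m⊔n≡n (ℕ.m≤n⇒m≤1+n (ℕ.m≤n+m (length q) (length p))))))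

Monic-* : ∀ {m n p q} → Monic m p → Monic n q → Monic (m ℕ.+ n) (p *ₚ q)
Monic-* {m} {n} {a ∷ p} {b ∷ q} mp mq = monic
  (trans (length-*ₚ a p b q) (cong suc (cong₂ ℕ._+_ (ℕ.suc-injective (length≡ mp)) (ℕ.suc-injective (length≡ mq)))))
  (trans (coeff-*-top m n (a ∷ p) (b ∷ q) (Monic⇒Deg< mp) (Monic⇒Deg< mq)) (cong₂ ℤ._*_ (leading mp) (leading mq)))

Monic-1 : Monic 0 1ₚ
Monic-1 = monic refl refl

-- As `b` is monic, the top coefficient of `h` reappears in the product at an index at least `m`,
-- where `r` vanishes. Descending from the length of `h`, its coefficients vanish one after another.
-- This is the uniqueness of division with remainder.
quotient-Deg<⇒≈[] : ∀ {m b r} h → Monic m b → h *ₚ b ≈ r → Deg< m r → h ≈ []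
quotient-Deg<⇒≈[] {m} {b} {r} h mb hb≈r dr = go (length h) (deg<-length h)
  where
  go : ∀ l → Deg< l h → h ≈ []
  go zero    dh = mk≈ λ i → dh i ℕ.z≤n
  go (suc l) dh = go l λ i l≤i → case-≤ (ℕ.m≤n⇒m<n∨m≡n l≤i)
    where
    top : coeff h l ≡ + 0
    top = trans (sym (ℤ.*-identityʳ _))
      (trans (cong (coeff h l ℤ.*_) (sym (leading mb)))
      (trans (sym (coeff-*-top l m h b dh (Monic⇒Deg< mb)))
      (trans (at hb≈r (l ℕ.+ m)) (dr (l ℕ.+ m) (ℕ.m≤n+m m l)))))
    case-≤ : ∀ {i} → _ → coeff h i ≡ + 0
    case-≤ {i} (inj₁ l<i)  = dh i l<i
    case-≤     (inj₂ refl) = top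

p-q≈[]⇒p≈q : ∀ p q → p +ₚ (-ₚ q) ≈ [] → p ≈ q
p-q≈[]⇒p≈q p q e = begin
  p                        ≈⟨ solve 2 (λ p q → p , (p ⊕ ⊝ q) ⊕ q) ≈-refl p q ⟩
  p +ₚ (-ₚ q) +ₚ q         ≈⟨ +-cong e ≈-refl ⟩
  q                        ∎

Monic-cancelʳ : ∀ {m b} p q → Monic m b → p *ₚ b ≈ q *ₚ b → p ≈ q
Monic-cancelʳ {b = b} p q mb e = p-q≈[]⇒p≈q p q (quotient-Deg<⇒≈[] {r = []} _ mb (begin
  (p +ₚ (-ₚ q)) *ₚ b           ≈⟨ solve 3 (λ p q b → (p ⊕ ⊝ q) ⊗ b , p ⊗ b ⊕ ⊝ (q ⊗ b)) ≈-refl p q b ⟩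
  p *ₚ b +ₚ (-ₚ (q *ₚ b))      ≈⟨ +-cong e ≈-refl ⟩
  q *ₚ b +ₚ (-ₚ (q *ₚ b))      ≈⟨ -‿inverseʳ (q *ₚ b) ⟩
  []                           ∎) λ _ _ → refl)

-- Long division

-- A copy, clause for clause, of the private `subFront`. In the same way `longDivide` and `gammas`
-- copy `divHF` and `gammasUpTo`, so that lemmas can be stated about them.
subtractFront : List ℤ → List ℤ → List ℤ
subtractFront xs       []       = xs
subtractFront []       (y ∷ ys) = (- y) ∷ subtractFront [] ys
subtractFront (x ∷ xs) (y ∷ ys) = (x ℤ.- y) ∷ subtractFront xs ys

longDivide : ℕ → List ℤ → List ℤ → List ℤ
longDivide zero    _        _        = []
longDivide (suc f) []       _        = []
longDivide (suc f) (c ∷ ds) []       = []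
longDivide (suc f) (c ∷ ds) (_ ∷ bs) =
  if does (suc (length bs) ℕ.≤? suc (length ds))
  then c ∷ longDivide f (subtractFront ds (map (c ℤ.*_) bs)) (+ 1 ∷ bs)
  else []

-- The helpers of divMonic are private, so the left-hand sides of the next two
-- signatures can only be named by unification: the with-abstractions in
-- divMonic≡ turn the arguments of the private function into variables.
subtractFront≡ : ∀ xs ys → _ ≡ subtractFront xs ys
longDivide≡ : ∀ f xs ys → _ ≡ longDivide f xs ys

divMonic≡ : ∀ a b → divMonic a b ≡ reverse (longDivide (length a) (reverse a) (reverse b))
divMonic≡ a b with length a | reverse a | reverse b
-- `reverse` unfolds to this fold. As a variable `rev` it can be stripped by unification, which then
-- reads off the private function; a stuck defined function could not be stripped.
... | f | xs | ys with foldl {A = List ℤ} {B = ℤ} (λ zs z → z ∷ zs) []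
...   | rev = cong rev (longDivide≡ f xs ys)

longDivide≡ zero    _        _        = refl
longDivide≡ (suc f) []       _        = refl
longDivide≡ (suc f) (c ∷ ds) []       = refl
longDivide≡ (suc f) (c ∷ ds) (_ ∷ bs)
  with does (suc (length bs) ℕ.≤? suc (length ds)) | map (c ℤ.*_) bs
... | true  | ys = cong (c ∷_) (trans (longDivide≡ f _ _) (cong (λ z → longDivide f z (+ 1 ∷ bs)) (subtractFront≡ ds ys)))
... | false | _  = refl

subtractFront≡ xs       []       = refl
subtractFront≡ []       (y ∷ ys) = cong (_ ∷_) (subtractFront≡ [] ys)
subtractFront≡ (x ∷ xs) (y ∷ ys) = cong (_ ∷_) (subtractFront≡ xs ys)

-- Highest degree first, the order in which long division works.
⟦_⟧ : List ℤ → Poly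
⟦ [] ⟧     = []
⟦ c ∷ ds ⟧ = κ c *ₚ X ^ₚ length ds +ₚ ⟦ ds ⟧

∷≈ : ∀ a p → a ∷ p ≈ κ a +ₚ X *ₚ p
∷≈ a p = ≈-trans (∷-cong (sym (ℤ.+-identityʳ a)) ≈-refl) (+-cong (≈-refl {κ a}) (≈-sym (X-* p)))

∷ʳ≈ : ∀ p c → p ∷ʳ c ≈ κ c *ₚ X ^ₚ length p +ₚ p
∷ʳ≈ []      c = ≈-sym (≈-trans (+-identityʳ _) (≈-trans (*-comm (κ c) 1ₚ) (*-identityˡ (κ c))))
∷ʳ≈ (a ∷ p) c = begin
  a ∷ (p ∷ʳ c)                                   ≈⟨ ∷≈ a (p ∷ʳ c) ⟩
  κ a +ₚ X *ₚ (p ∷ʳ c)                           ≈⟨ +-cong (≈-refl {κ a}) (*-congˡ X (∷ʳ≈ p c)) ⟩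
  κ a +ₚ X *ₚ (κ c *ₚ X ^ₚ length p +ₚ p)
    ≈⟨ solve 5 (λ a x c y p → a ⊕ x ⊗ (c ⊗ y ⊕ p) , c ⊗ (x ⊗ y) ⊕ (a ⊕ x ⊗ p)) ≈-refl (κ a) X (κ c) (X ^ₚ length p) p ⟩
  κ c *ₚ X ^ₚ suc (length p) +ₚ (κ a +ₚ X *ₚ p)  ≈⟨ +-cong ≈-refl (≈-sym (∷≈ a p)) ⟩
  κ c *ₚ X ^ₚ suc (length p) +ₚ (a ∷ p)          ∎

reverse≈⟦⟧ : ∀ xs → reverse xs ≈ ⟦ xs ⟧
reverse≈⟦⟧ []       = ≈-refl
reverse≈⟦⟧ (c ∷ ds) rewrite List.unfold-reverse c ds = begin
  reverse ds ∷ʳ c                                 ≈⟨ ∷ʳ≈ (reverse ds) c ⟩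
  κ c *ₚ X ^ₚ length (reverse ds) +ₚ reverse ds
    ≡⟨ cong (λ l → κ c *ₚ X ^ₚ l +ₚ reverse ds) (List.length-reverse ds) ⟩
  κ c *ₚ X ^ₚ length ds +ₚ reverse ds             ≈⟨ +-cong ≈-refl (reverse≈⟦⟧ ds) ⟩
  ⟦ c ∷ ds ⟧                                      ∎

⟦reverse⟧≈ : ∀ p → ⟦ reverse p ⟧ ≈ p
⟦reverse⟧≈ p = ≈-trans (≈-sym (reverse≈⟦⟧ (reverse p))) (CommutativeRing.reflexive polyRing (List.reverse-involutive p))

⟦scale⟧≈ : ∀ c xs → ⟦ map (c ℤ.*_) xs ⟧ ≈ κ c *ₚ ⟦ xs ⟧
⟦scale⟧≈ c []       = ≈-sym (*-zeroʳ (κ c))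
⟦scale⟧≈ c (x ∷ xs) = begin
  κ (c ℤ.* x) *ₚ X ^ₚ length (map (c ℤ.*_) xs) +ₚ ⟦ map (c ℤ.*_) xs ⟧
    ≡⟨ cong (λ l → κ (c ℤ.* x) *ₚ X ^ₚ l +ₚ ⟦ map (c ℤ.*_) xs ⟧) (List.length-map _ xs) ⟩
  κ (c ℤ.* x) *ₚ X ^ₚ length xs +ₚ ⟦ map (c ℤ.*_) xs ⟧
    ≈⟨ +-cong (*-cong (≈-sym (κ-* c (κ x))) ≈-refl) (⟦scale⟧≈ c xs) ⟩
  κ c *ₚ κ x *ₚ X ^ₚ length xs +ₚ κ c *ₚ ⟦ xs ⟧
    ≈⟨ solve 4 (λ c x y v → c ⊗ x ⊗ y ⊕ c ⊗ v , c ⊗ (x ⊗ y ⊕ v)) ≈-refl (κ c) (κ x) (X ^ₚ length xs) ⟦ xs ⟧ ⟩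
  κ c *ₚ ⟦ x ∷ xs ⟧ ∎

length-subtractFront : ∀ k xs ys → length xs ≡ k ℕ.+ length ys → length (subtractFront xs ys) ≡ length xs
length-subtractFront k xs       []       e = refl
length-subtractFront k []       (y ∷ ys) e = contradiction (trans e (ℕ.+-suc k _)) λ ()
length-subtractFront k (x ∷ xs) (y ∷ ys) e =
  cong suc (length-subtractFront k xs ys (ℕ.suc-injective (trans e (ℕ.+-suc k _))))

-- Aligning the leading entries shifts `ys` up by the difference `k` in length, whence the factor
-- `X ^ₚ k`.
subtractFront-spec : ∀ k xs ys → length xs ≡ k ℕ.+ length ys →
                     ⟦ subtractFront xs ys ⟧ +ₚ X ^ₚ k *ₚ ⟦ ys ⟧ ≈ ⟦ xs ⟧
subtractFront-spec k xs       []       e = ≈-trans (+-cong (≈-refl {⟦ xs ⟧}) (*-zeroʳ (X ^ₚ k))) (+-identityʳ _)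
subtractFront-spec k []       (y ∷ ys) e = contradiction (trans e (ℕ.+-suc k _)) λ ()
subtractFront-spec k (x ∷ xs) (y ∷ ys) e = begin
  κ (x ℤ.- y) *ₚ X ^ₚ length zs +ₚ ⟦ zs ⟧ +ₚ X ^ₚ k *ₚ (κ y *ₚ X ^ₚ length ys +ₚ ⟦ ys ⟧)
    ≡⟨ cong (λ l → κ (x ℤ.- y) *ₚ X ^ₚ l +ₚ ⟦ zs ⟧ +ₚ X ^ₚ k *ₚ (κ y *ₚ X ^ₚ length ys +ₚ ⟦ ys ⟧)) (length-subtractFront k xs ys e′) ⟩
  κ (x ℤ.- y) *ₚ X ^ₚ length xs +ₚ ⟦ zs ⟧ +ₚ X ^ₚ k *ₚ (κ y *ₚ X ^ₚ length ys +ₚ ⟦ ys ⟧)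
    ≈⟨ solve 7 (λ d u z w y v t → d ⊗ u ⊕ z ⊕ w ⊗ (y ⊗ v ⊕ t) , d ⊗ u ⊕ y ⊗ (w ⊗ v) ⊕ (z ⊕ w ⊗ t)) ≈-refl
         (κ (x ℤ.- y)) (X ^ₚ length xs) ⟦ zs ⟧ (X ^ₚ k) (κ y) (X ^ₚ length ys) ⟦ ys ⟧ ⟩
  κ (x ℤ.- y) *ₚ X ^ₚ length xs +ₚ κ y *ₚ (X ^ₚ k *ₚ X ^ₚ length ys) +ₚ (⟦ zs ⟧ +ₚ X ^ₚ k *ₚ ⟦ ys ⟧)
    ≈⟨ +-cong (+-cong (≈-refl {κ (x ℤ.- y) *ₚ X ^ₚ length xs}) (*-congˡ (κ y) X^k*X^ys)) (subtractFront-spec k xs ys e′) ⟩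
  κ (x ℤ.- y) *ₚ X ^ₚ length xs +ₚ κ y *ₚ X ^ₚ length xs +ₚ ⟦ xs ⟧
    ≈⟨ +-cong (≈-sym (*-distribʳ (X ^ₚ length xs) (κ (x ℤ.- y)) (κ y))) ≈-refl ⟩
  κ (x ℤ.- y ℤ.+ y) *ₚ X ^ₚ length xs +ₚ ⟦ xs ⟧
    ≡⟨ cong (λ z → κ z *ₚ X ^ₚ length xs +ₚ ⟦ xs ⟧) (x-y+y≡x x y) ⟩
  ⟦ x ∷ xs ⟧ ∎
  where
  zs = subtractFront xs ys
  e′ : length xs ≡ k ℕ.+ length ys
  e′ = ℕ.suc-injective (trans e (ℕ.+-suc k _))
  x-y+y≡x : ∀ x y → x ℤ.- y ℤ.+ y ≡ x
  x-y+y≡x = ℤ-Solver.solve-∀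
  X^k*X^ys : X ^ₚ k *ₚ X ^ₚ length ys ≈ X ^ₚ length xs
  X^k*X^ys = ≈-trans (≈-sym (^-homo-* X k (length ys))) (CommutativeRing.reflexive polyRing (cong (X ^ₚ_) (sym e′)))

longDivide-step : ∀ f c ds b bs → length bs ℕ.≤ length ds →
  longDivide (suc f) (c ∷ ds) (b ∷ bs) ≡ c ∷ longDivide f (subtractFront ds (map (c ℤ.*_) bs)) (+ 1 ∷ bs)
longDivide-step f c ds b bs bs≤ds
  rewrite dec-true (suc (length bs) ℕ.≤? suc (length ds)) (ℕ.s≤s bs≤ds) = refl

longDivide-stop : ∀ f c ds b bs → length ds ℕ.< length bs → longDivide (suc f) (c ∷ ds) (b ∷ bs) ≡ []
longDivide-stop f c ds b bs ds<bs
  rewrite dec-false (suc (length bs) ℕ.≤? suc (length ds)) (ℕ.<⇒≱ (ℕ.s≤s ds<bs)) = refl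

module _ (c : ℤ) {ds bs : List ℤ} (bs≤ds : length bs ℕ.≤ length ds) where
  private
    ds≡ : length ds ≡ (length ds ℕ.∸ length bs) ℕ.+ length (map (c ℤ.*_) bs)
    ds≡ = trans (sym (ℕ.m∸n+n≡m bs≤ds)) (cong (length ds ℕ.∸ length bs ℕ.+_) (sym (List.length-map _ bs)))

  length-next : length (subtractFront ds (map (c ℤ.*_) bs)) ≡ length ds
  length-next = length-subtractFront (length ds ℕ.∸ length bs) ds (map (c ℤ.*_) bs) ds≡

  next-spec : ⟦ subtractFront ds (map (c ℤ.*_) bs) ⟧ +ₚ X ^ₚ (length ds ℕ.∸ length bs) *ₚ (κ c *ₚ ⟦ bs ⟧) ≈ ⟦ ds ⟧
  next-spec = ≈-trans (+-cong ≈-refl (*-congˡ (X ^ₚ (length ds ℕ.∸ length bs)) (≈-sym (⟦scale⟧≈ c bs))))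
    (subtractFront-spec (length ds ℕ.∸ length bs) ds (map (c ℤ.*_) bs) ds≡)

-- Each step shortens the dividend by one entry, so fuel equal to its length lasts until the
-- division stops. The exact length is what `Monic` demands of a quotient.
length-longDivide : ∀ f xs b bs → length xs ℕ.≤ f → length (longDivide f xs (b ∷ bs)) ≡ length xs ℕ.∸ length bs
length-longDivide zero    []       b bs _ = sym (ℕ.0∸n≡0 (length bs))
length-longDivide (suc f) []       b bs _ = sym (ℕ.0∸n≡0 (length bs))
length-longDivide (suc f) (c ∷ ds) b bs (ℕ.s≤s ds≤f) with length bs ℕ.≤? length ds
... | no bs≰ds rewrite longDivide-stop f c ds b bs (ℕ.≰⇒> bs≰ds) =
  sym (ℕ.m≤n⇒m∸n≡0 {suc (length ds)} (ℕ.≰⇒> bs≰ds))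
... | yes bs≤ds rewrite longDivide-step f c ds b bs bs≤ds =
  trans (cong suc (trans (length-longDivide f _ (+ 1) bs (subst (ℕ._≤ f) (sym |next|) ds≤f)) (cong (ℕ._∸ length bs) |next|)))
        (sym (ℕ.+-∸-assoc 1 bs≤ds))
  where |next| = length-next c {ds} {bs} bs≤ds

longDivide-spec : ∀ f xs b bs → length xs ℕ.≤ f → ∃[ r ] (length r ℕ.≤ length bs ×
                  ⟦ xs ⟧ ≈ ⟦ longDivide f xs (b ∷ bs) ⟧ *ₚ ⟦ + 1 ∷ bs ⟧ +ₚ ⟦ r ⟧)
longDivide-spec zero    []       b bs _ = [] , ℕ.z≤n , ≈-refl
longDivide-spec (suc f) []       b bs _ = [] , ℕ.z≤n , ≈-refl
longDivide-spec (suc f) (c ∷ ds) b bs (ℕ.s≤s ds≤f) with length bs ℕ.≤? length ds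
... | no bs≰ds rewrite longDivide-stop f c ds b bs (ℕ.≰⇒> bs≰ds) = c ∷ ds , ℕ.≰⇒> bs≰ds , ≈-refl
... | yes bs≤ds rewrite longDivide-step f c ds b bs bs≤ds =
  let r , r≤ , e = longDivide-spec f next (+ 1) bs (subst (ℕ._≤ f) (sym (length-next c {ds} {bs} bs≤ds)) ds≤f)
  in r , r≤ , (begin
    κ c *ₚ X ^ₚ length ds +ₚ ⟦ ds ⟧
      ≈⟨ +-cong (*-congˡ (κ c) X^ds) (≈-sym (next-spec c {ds} {bs} bs≤ds)) ⟩
    κ c *ₚ (X ^ₚ k *ₚ X ^ₚ length bs) +ₚ (⟦ next ⟧ +ₚ X ^ₚ k *ₚ (κ c *ₚ ⟦ bs ⟧))
      ≈⟨ +-cong (≈-refl {κ c *ₚ (X ^ₚ k *ₚ X ^ₚ length bs)}) (+-cong e ≈-refl) ⟩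
    κ c *ₚ (X ^ₚ k *ₚ X ^ₚ length bs) +ₚ (⟦ q ⟧ *ₚ ⟦ + 1 ∷ bs ⟧ +ₚ ⟦ r ⟧ +ₚ X ^ₚ k *ₚ (κ c *ₚ ⟦ bs ⟧))
      ≈⟨ solve 6 (λ c u v w q r →
           c ⊗ (u ⊗ v) ⊕ (q ⊗ (Κ (κ (+ 1)) ⊗ v ⊕ w) ⊕ r ⊕ u ⊗ (c ⊗ w))
           , (c ⊗ u ⊕ q) ⊗ (Κ (κ (+ 1)) ⊗ v ⊕ w) ⊕ r) ≈-refl
           (κ c) (X ^ₚ k) (X ^ₚ length bs) ⟦ bs ⟧ ⟦ q ⟧ ⟦ r ⟧ ⟩
    (κ c *ₚ X ^ₚ k +ₚ ⟦ q ⟧) *ₚ ⟦ + 1 ∷ bs ⟧ +ₚ ⟦ r ⟧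
      ≡⟨ cong (λ l → (κ c *ₚ X ^ₚ l +ₚ ⟦ q ⟧) *ₚ ⟦ + 1 ∷ bs ⟧ +ₚ ⟦ r ⟧) (sym |q|) ⟩
    ⟦ c ∷ q ⟧ *ₚ ⟦ + 1 ∷ bs ⟧ +ₚ ⟦ r ⟧ ∎)
  where
  next = subtractFront ds (map (c ℤ.*_) bs)
  q = longDivide f next (+ 1 ∷ bs)
  k = length ds ℕ.∸ length bs
  X^ds : X ^ₚ length ds ≈ X ^ₚ k *ₚ X ^ₚ length bs
  X^ds = ≈-trans (CommutativeRing.reflexive polyRing (cong (X ^ₚ_) (sym (ℕ.m∸n+n≡m bs≤ds)))) (^-homo-* X k (length bs))
  |q| : length q ≡ k
  |q| = trans (length-longDivide f next (+ 1) bs (subst (ℕ._≤ f) (sym (length-next c {ds} {bs} bs≤ds)) ds≤f))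
              (cong (ℕ._∸ length bs) (length-next c {ds} {bs} bs≤ds))

reverse-leading : ∀ m p → length p ≡ suc m → ∃[ bs ] (reverse p ≡ coeff p m ∷ bs)
reverse-leading zero    (a ∷ []) e = [] , refl
reverse-leading (suc m) (a ∷ p)  e =
  let bs , e′ = reverse-leading m p (ℕ.suc-injective e)
  in bs ∷ʳ a , trans (List.unfold-reverse a p) (cong (_∷ʳ a) e′)

-- Long division ignores the head of the divisor and assumes that it is 1.
reverse-monic : ∀ {m b} → Monic m b → ∃[ bs ] (reverse b ≡ + 1 ∷ bs × length bs ≡ m)
reverse-monic {m} {b} (monic l≡ lead) =
  let bs , e = reverse-leading m b l≡ ; e′ = trans e (cong (_∷ bs) lead)
  in bs , e′ , ℕ.suc-injective (trans (sym (cong length e′)) (trans (List.length-reverse b) l≡))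

length-divMonic : ∀ {m b} a → Monic m b → length (divMonic a b) ≡ length a ℕ.∸ m
length-divMonic {m} {b} a mb with reverse-monic mb
... | bs , e , refl rewrite divMonic≡ a b | e =
  trans (List.length-reverse (longDivide (length a) (reverse a) (+ 1 ∷ bs)))
  (trans (length-longDivide (length a) (reverse a) (+ 1) bs (ℕ.≤-reflexive (List.length-reverse a)))
         (cong (ℕ._∸ length bs) (List.length-reverse a)))

divMonic-spec : ∀ {m b} a → Monic m b → ∃[ r ] (Deg< m r × a ≈ divMonic a b *ₚ b +ₚ r)
divMonic-spec {m} {b} a mb with reverse-monic mb
... | bs , e , refl rewrite divMonic≡ a b | e =
  let q = longDivide (length a) (reverse a) (+ 1 ∷ bs)
      r , r≤ , spec = longDivide-spec (length a) (reverse a) (+ 1) bs (ℕ.≤-reflexive (List.length-reverse a))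
  in ⟦ r ⟧
  , Deg<-cong (reverse≈⟦⟧ r) (λ i bs≤i → deg<-length (reverse r) i
      (ℕ.≤-trans (ℕ.≤-trans (ℕ.≤-reflexive (List.length-reverse r)) r≤) bs≤i))
  , (begin
    a                                ≈⟨ ≈-sym (⟦reverse⟧≈ a) ⟩
    ⟦ reverse a ⟧                    ≈⟨ spec ⟩
    ⟦ q ⟧ *ₚ ⟦ + 1 ∷ bs ⟧ +ₚ ⟦ r ⟧   ≈⟨ +-cong (*-cong (≈-sym (reverse≈⟦⟧ q)) 1∷bs≈b) (≈-refl {⟦ r ⟧}) ⟩
    reverse q *ₚ b +ₚ ⟦ r ⟧          ∎)
  where
  1∷bs≈b : ⟦ + 1 ∷ bs ⟧ ≈ b
  1∷bs≈b = ≈-trans (CommutativeRing.reflexive polyRing (cong ⟦_⟧ (sym e))) (⟦reverse⟧≈ b)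

-- If `c` is the true cofactor and `q` the computed quotient, then (c - q) b is the remainder, of
-- degree below that of `b`; hence c = q.
divMonic-exact : ∀ {m b} a → Monic m b → b ∣ₚ a → divMonic a b *ₚ b ≈ a
divMonic-exact {m} {b} a mb (c ,∣ cb≈a) =
  let r , dr , spec = divMonic-spec a mb
      q = divMonic a b
      c-q≈[] = quotient-Deg<⇒≈[] {r = r} (c +ₚ (-ₚ q)) mb (begin
        (c +ₚ (-ₚ q)) *ₚ b               ≈⟨ solve 3 (λ c q b → (c ⊕ ⊝ q) ⊗ b , c ⊗ b ⊕ ⊝ (q ⊗ b)) ≈-refl c q b ⟩
        c *ₚ b +ₚ (-ₚ (q *ₚ b))          ≈⟨ +-cong (≈-trans cb≈a spec) ≈-refl ⟩
        q *ₚ b +ₚ r +ₚ (-ₚ (q *ₚ b))     ≈⟨ solve 2 (λ t r → t ⊕ r ⊕ ⊝ t , r) ≈-refl (q *ₚ b) r ⟩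
        r                                ∎) dr
  in ≈-trans (*-cong (≈-sym (p-q≈[]⇒p≈q c q c-q≈[])) ≈-refl) cb≈a

Monic-divMonic : ∀ {m n b a} → Monic (m ℕ.+ n) a → Monic n b → b ∣ₚ a → Monic m (divMonic a b)
Monic-divMonic {m} {n} {b} {a} ma mb b∣a = monic l≡ (trans (sym (trans
    (coeff-*-top m n q b (λ i m<i → deg<-length q i (subst (ℕ._≤ i) (sym l≡) m<i)) (Monic⇒Deg< mb))
    (trans (cong (coeff q m ℤ.*_) (leading mb)) (ℤ.*-identityʳ _))))
  (trans (at (divMonic-exact a mb b∣a) (m ℕ.+ n)) (leading ma)))
  where
  q = divMonic a b
  l≡ : length q ≡ suc m
  l≡ = trans (length-divMonic a mb) (trans (cong (ℕ._∸ n) (length≡ ma)) (ℕ.m+n∸n≡m (suc m) n))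

-- Gauss' lemma for a constant factor, with content replaced by division with remainder.
Monic-∣-κ* : ∀ {m b} c h → Monic m b → c ≢ + 0 → b ∣ₚ κ c *ₚ h → b ∣ₚ h
Monic-∣-κ* {m} {b} c h mb c≢0 (k ,∣ kb≈ch) =
  let r , dr , spec = divMonic-spec h mb
      q = divMonic h b
      dcr : Deg< m (κ c *ₚ r)
      dcr i m≤i = trans (at (κ-* c r) i) (trans (coeff-scale c r i) (trans (cong (c ℤ.*_) (dr i m≤i)) (ℤ.*-zeroʳ c)))
      eq : (k +ₚ (-ₚ (κ c *ₚ q))) *ₚ b ≈ κ c *ₚ r
      eq = begin
        (k +ₚ (-ₚ (κ c *ₚ q))) *ₚ b
          ≈⟨ solve 4 (λ k c q b → (k ⊕ ⊝ (c ⊗ q)) ⊗ b , k ⊗ b ⊕ ⊝ (c ⊗ (q ⊗ b))) ≈-refl k (κ c) q b ⟩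
        k *ₚ b +ₚ (-ₚ (κ c *ₚ (q *ₚ b)))                 ≈⟨ +-cong (≈-trans kb≈ch (*-congˡ (κ c) spec)) ≈-refl ⟩
        κ c *ₚ (q *ₚ b +ₚ r) +ₚ (-ₚ (κ c *ₚ (q *ₚ b)))
          ≈⟨ solve 3 (λ c t r → c ⊗ (t ⊕ r) ⊕ ⊝ (c ⊗ t) , c ⊗ r) ≈-refl (κ c) (q *ₚ b) r ⟩
        κ c *ₚ r                                         ∎
      cr≈[] : κ c *ₚ r ≈ []
      cr≈[] = ≈-trans (≈-sym eq) (*-cong (quotient-Deg<⇒≈[] (k +ₚ (-ₚ (κ c *ₚ q))) mb eq dcr) (≈-refl {b}))
      r≈[] : r ≈ []
      r≈[] = mk≈ λ i → [ (λ c≡0 → contradiction c≡0 c≢0) , id ]′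
        (ℤ.i*j≡0⇒i≡0∨j≡0 c (trans (sym (trans (at (κ-* c r) i) (coeff-scale c r i))) (at cr≈[] i)))
  in q ,∣ ≈-sym (≈-trans spec (≈-trans (+-cong ≈-refl r≈[]) (+-identityʳ _)))

≡⇒≈ : ∀ {p q} → p ≡ q → p ≈ q
≡⇒≈ refl = ≈-refl

Monic-unique : ∀ {m n p q} → p ≈ q → Monic m p → Monic n q → m ≡ n
Monic-unique {m} {n} p≈q mp mq with ℕ.<-cmp m n
... | tri≈ _ m≡n _ = m≡n
... | tri< m<n _ _ = contradiction (trans (sym (Monic⇒Deg< mp n m<n)) (trans (at p≈q n) (leading mq))) λ ()
... | tri> _ _ n<m = contradiction (trans (sym (Monic⇒Deg< mq m n<m)) (trans (sym (at p≈q m)) (leading mp))) λ ()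

∣-+-cancelʳ : ∀ {a} p q → a ∣ₚ p +ₚ q → a ∣ₚ q → a ∣ₚ p
∣-+-cancelʳ {a} p q (c ,∣ ca≈p+q) (d ,∣ da≈q) = c +ₚ (-ₚ d) ,∣ (begin
  (c +ₚ (-ₚ d)) *ₚ a           ≈⟨ solve 3 (λ c d a → (c ⊕ ⊝ d) ⊗ a , c ⊗ a ⊕ ⊝ (d ⊗ a)) ≈-refl c d a ⟩
  c *ₚ a +ₚ (-ₚ (d *ₚ a))      ≈⟨ +-cong ca≈p+q (-‿cong da≈q) ⟩
  p +ₚ q +ₚ (-ₚ q)             ≈⟨ solve 2 (λ p q → p ⊕ q ⊕ ⊝ q , p) ≈-refl p q ⟩
  p                            ∎)

∣-* : ∀ {a b} h → a ∣ₚ b → a ∣ₚ b *ₚ h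
∣-* {a} {b} h a∣b = ∣ʳ-respʳ-≈ (*-comm h b) (x∣ʳy⇒x∣ʳzy h a∣b)

-- The polynomials Xⁿ - 1

Xⁿ-1≈ : ∀ n → Xⁿ-1 n ≈ X ^ₚ n +ₚ (-ₚ 1ₚ)
Xⁿ-1≈ zero    = ≈-sym (∷-≈[] refl ≈-refl)
Xⁿ-1≈ (suc n) = ≈-sym (≈-trans (+-cong (≈-trans (X-* (X ^ₚ n)) (∷-cong refl (≈-sym (monomial n)))) ≈-refl)
                               (∷-cong refl (+-identityʳ _)))
  where
  monomial : ∀ n → replicate n (+ 0) ++ (+ 1 ∷ []) ≈ X ^ₚ n
  monomial zero    = ≈-refl
  monomial (suc n) = ≈-trans (∷-cong refl (monomial n)) (≈-sym (X-* (X ^ₚ n)))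

Monic-Xⁿ-1 : ∀ n → Monic (suc n) (Xⁿ-1 (suc n))
Monic-Xⁿ-1 n = monic (cong suc (length-monomial n)) (coeff-monomial n)
  where
  length-monomial : ∀ n → length (replicate n (+ 0) ++ (+ 1 ∷ [])) ≡ suc n
  length-monomial zero    = refl
  length-monomial (suc n) = cong suc (length-monomial n)
  coeff-monomial : ∀ n → coeff (replicate n (+ 0) ++ (+ 1 ∷ [])) n ≡ + 1
  coeff-monomial zero    = refl
  coeff-monomial (suc n) = coeff-monomial n

-- The subtractive Euclidean step on exponents: modulo `Xⁿ-1 n`, the exponents `m + n` and `m` give
-- the same polynomial.
Xⁿ-1-+ : ∀ m n → Xⁿ-1 (m ℕ.+ n) ≈ Xⁿ-1 m +ₚ X ^ₚ m *ₚ Xⁿ-1 n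
Xⁿ-1-+ m n = begin
  Xⁿ-1 (m ℕ.+ n)                                    ≈⟨ Xⁿ-1≈ (m ℕ.+ n) ⟩
  X ^ₚ (m ℕ.+ n) +ₚ (-ₚ 1ₚ)                         ≈⟨ +-cong (^-homo-* X m n) ≈-refl ⟩
  X ^ₚ m *ₚ X ^ₚ n +ₚ (-ₚ 1ₚ)
    ≈⟨ solve 2 (λ x y → x ⊗ y ⊕ ⊝ Κ 1ₚ , (x ⊕ ⊝ Κ 1ₚ) ⊕ x ⊗ (y ⊕ ⊝ Κ 1ₚ)) ≈-refl (X ^ₚ m) (X ^ₚ n) ⟩
  X ^ₚ m +ₚ (-ₚ 1ₚ) +ₚ X ^ₚ m *ₚ (X ^ₚ n +ₚ (-ₚ 1ₚ)) ≈⟨ +-cong (≈-sym (Xⁿ-1≈ m)) (*-congˡ (X ^ₚ m) (≈-sym (Xⁿ-1≈ n))) ⟩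
  Xⁿ-1 m +ₚ X ^ₚ m *ₚ Xⁿ-1 n                        ∎

geometric : ℕ → Poly → Poly
geometric zero    y = []
geometric (suc r) y = 1ₚ +ₚ y *ₚ geometric r y

geometric-* : ∀ r y → geometric r y *ₚ (y +ₚ (-ₚ 1ₚ)) ≈ y ^ₚ r +ₚ (-ₚ 1ₚ)
geometric-* zero    y = ≈-sym (-‿inverseʳ 1ₚ)
geometric-* (suc r) y = begin
  (1ₚ +ₚ y *ₚ geometric r y) *ₚ (y +ₚ (-ₚ 1ₚ))
    ≈⟨ solve 2 (λ y g → (Κ 1ₚ ⊕ y ⊗ g) ⊗ (y ⊕ ⊝ Κ 1ₚ) , y ⊕ ⊝ Κ 1ₚ ⊕ y ⊗ (g ⊗ (y ⊕ ⊝ Κ 1ₚ))) ≈-refl y (geometric r y) ⟩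
  y +ₚ (-ₚ 1ₚ) +ₚ y *ₚ (geometric r y *ₚ (y +ₚ (-ₚ 1ₚ)))
    ≈⟨ +-cong (≈-refl {y +ₚ (-ₚ 1ₚ)}) (*-congˡ y (geometric-* r y)) ⟩
  y +ₚ (-ₚ 1ₚ) +ₚ y *ₚ (y ^ₚ r +ₚ (-ₚ 1ₚ))
    ≈⟨ solve 2 (λ y z → y ⊕ ⊝ Κ 1ₚ ⊕ y ⊗ (z ⊕ ⊝ Κ 1ₚ) , y ⊗ z ⊕ ⊝ Κ 1ₚ) ≈-refl y (y ^ₚ r) ⟩
  y ^ₚ suc r +ₚ (-ₚ 1ₚ)                                         ∎

-- Modulo y - 1, each of the `r` powers of `y` in the sum is 1.
geometric-mod : ∀ r y → ∃[ w ] (geometric r y ≈ κ (+ r) +ₚ w *ₚ (y +ₚ (-ₚ 1ₚ)))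
geometric-mod zero    y = [] , ≈-sym (∷-≈[] refl ≈-refl)
geometric-mod (suc r) y = let w , e = geometric-mod r y in κ (+ r) +ₚ y *ₚ w , (begin
  1ₚ +ₚ y *ₚ geometric r y                                  ≈⟨ +-cong (≈-refl {1ₚ}) (*-congˡ y e) ⟩
  1ₚ +ₚ y *ₚ (κ (+ r) +ₚ w *ₚ (y +ₚ (-ₚ 1ₚ)))
    ≈⟨ solve 3 (λ y c w → Κ 1ₚ ⊕ y ⊗ (c ⊕ w ⊗ (y ⊕ ⊝ Κ 1ₚ)) , Κ 1ₚ ⊕ c ⊕ (c ⊕ y ⊗ w) ⊗ (y ⊕ ⊝ Κ 1ₚ)) ≈-refl y (κ (+ r)) w ⟩
  κ (+ suc r) +ₚ (κ (+ r) +ₚ y *ₚ w) *ₚ (y +ₚ (-ₚ 1ₚ))      ∎)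

Xⁿ-1-* : ∀ r k → Xⁿ-1 (r ℕ.* k) ≈ geometric r (X ^ₚ k) *ₚ Xⁿ-1 k
Xⁿ-1-* r k = begin
  Xⁿ-1 (r ℕ.* k)                                    ≈⟨ Xⁿ-1≈ (r ℕ.* k) ⟩
  X ^ₚ (r ℕ.* k) +ₚ (-ₚ 1ₚ)                         ≡⟨ cong (λ n → X ^ₚ n +ₚ (-ₚ 1ₚ)) (ℕ.*-comm r k) ⟩
  X ^ₚ (k ℕ.* r) +ₚ (-ₚ 1ₚ)                         ≈⟨ +-cong (≈-sym (^-assocʳ X k r)) ≈-refl ⟩
  (X ^ₚ k) ^ₚ r +ₚ (-ₚ 1ₚ)                          ≈⟨ ≈-sym (geometric-* r (X ^ₚ k)) ⟩
  geometric r (X ^ₚ k) *ₚ (X ^ₚ k +ₚ (-ₚ 1ₚ))       ≈⟨ *-congˡ (geometric r (X ^ₚ k)) (≈-sym (Xⁿ-1≈ k)) ⟩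
  geometric r (X ^ₚ k) *ₚ Xⁿ-1 k                    ∎

Xⁿ-1-∣ : ∀ {m n} → m ℕ.∣ n → Xⁿ-1 m ∣ₚ Xⁿ-1 n
Xⁿ-1-∣ {m} (ℕ.divides r refl) = geometric r (X ^ₚ m) ,∣ ≈-sym (Xⁿ-1-* r m)

-- Bézout in ℕ writes the gcd as a difference of a multiple of `m` and a multiple of `n`, in one
-- order or the other. The cofactor `h` is carried along because the result serves to cancel a
-- coprime factor from a product.
∣-Xⁿ-1-gcd : ∀ {a} m n h → a ∣ₚ Xⁿ-1 m *ₚ h → a ∣ₚ Xⁿ-1 n *ₚ h → a ∣ₚ Xⁿ-1 (gcd m n) *ₚ h
∣-Xⁿ-1-gcd {a} m n h a∣m a∣n = go (Bézout.identity (gcd-GCD m n))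
  where
  multiple : ∀ x k → a ∣ₚ Xⁿ-1 k *ₚ h → a ∣ₚ Xⁿ-1 (x ℕ.* k) *ₚ h
  multiple x k a∣k = ∣ʳ-respʳ-≈
    (≈-trans (≈-sym (*-assoc (geometric x (X ^ₚ k)) (Xⁿ-1 k) h)) (*-cong (≈-sym (Xⁿ-1-* x k)) ≈-refl))
    (x∣ʳy⇒x∣ʳzy (geometric x (X ^ₚ k)) a∣k)
  difference : ∀ d k l → d ℕ.+ k ≡ l → a ∣ₚ Xⁿ-1 k *ₚ h → a ∣ₚ Xⁿ-1 l *ₚ h → a ∣ₚ Xⁿ-1 d *ₚ h
  difference d k _ refl a∣k a∣l = ∣-+-cancelʳ (Xⁿ-1 d *ₚ h) (X ^ₚ d *ₚ (Xⁿ-1 k *ₚ h))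
    (∣ʳ-respʳ-≈ (begin
      Xⁿ-1 (d ℕ.+ k) *ₚ h                       ≈⟨ *-cong (Xⁿ-1-+ d k) ≈-refl ⟩
      (Xⁿ-1 d +ₚ X ^ₚ d *ₚ Xⁿ-1 k) *ₚ h
        ≈⟨ solve 4 (λ u x v h → (u ⊕ x ⊗ v) ⊗ h , u ⊗ h ⊕ x ⊗ (v ⊗ h)) ≈-refl (Xⁿ-1 d) (X ^ₚ d) (Xⁿ-1 k) h ⟩
      Xⁿ-1 d *ₚ h +ₚ X ^ₚ d *ₚ (Xⁿ-1 k *ₚ h)    ∎) a∣l)
    (x∣ʳy⇒x∣ʳzy (X ^ₚ d) a∣k)
  go : Bézout.Identity (gcd m n) m n → a ∣ₚ Xⁿ-1 (gcd m n) *ₚ h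
  go (Bézout.+- x y eq) = difference (gcd m n) (y ℕ.* n) (x ℕ.* m) eq (multiple y n a∣n) (multiple x m a∣m)
  go (Bézout.-+ x y eq) = difference (gcd m n) (x ℕ.* m) (y ℕ.* n) eq (multiple x m a∣m) (multiple y n a∣n)

-- Products over divisors

prodTo : ℕ → (ℕ → Poly) → Poly
prodTo zero    F = 1ₚ
prodTo (suc n) F = prodTo n F *ₚ F (suc n)

_when_ : {A : Set} → Poly → Dec A → Poly
p when a? = if does a? then p else 1ₚ

when-yes : ∀ {A : Set} p (a? : Dec A) → A → p when a? ≡ p
when-yes p a? a rewrite dec-true a? a = refl

when-no : ∀ {A : Set} p (a? : Dec A) → ¬ A → p when a? ≡ 1ₚ
when-no p a? ¬a rewrite dec-false a? ¬a = refl

divisorFactor : ℕ → ℕ → Poly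
divisorFactor n d = Φ d when (d ℕ.∣? n)

prodTo-cong : ∀ n {F G} → (∀ i → 1 ℕ.≤ i → i ℕ.≤ n → F i ≈ G i) → prodTo n F ≈ prodTo n G
prodTo-cong zero    e = ≈-refl
prodTo-cong (suc n) e =
  *-cong (prodTo-cong n λ i 1≤i i≤n → e i 1≤i (ℕ.m≤n⇒m≤1+n i≤n)) (e (suc n) (ℕ.s≤s ℕ.z≤n) ℕ.≤-refl)

prodTo-* : ∀ n F G → prodTo n (λ i → F i *ₚ G i) ≈ prodTo n F *ₚ prodTo n G
prodTo-* zero    F G = ≈-sym (*-identityˡ 1ₚ)
prodTo-* (suc n) F G = ≈-trans (*-cong (prodTo-* n F G) ≈-refl)
  (solve 4 (λ a b c d → (a ⊗ b) ⊗ (c ⊗ d) , (a ⊗ c) ⊗ (b ⊗ d)) ≈-refl (prodTo n F) (prodTo n G) (F (suc n)) (G (suc n)))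

*-identityʳ : ∀ p → p *ₚ 1ₚ ≈ p
*-identityʳ = proj₂ (CommutativeRing.*-identity polyRing)

-- The product may be extended past n because larger numbers do not divide n.
prodTo-extend : ∀ {n N} (F : ℕ → Poly) → 1 ℕ.≤ n → n ℕ.≤ N → prodTo N (λ d → F d when (d ℕ.∣? n)) ≈ prodTo n (λ d → F d when (d ℕ.∣? n))
prodTo-extend {n} {zero}  F 1≤n n≤N = contradiction (ℕ.≤-trans 1≤n n≤N) λ ()
prodTo-extend {n} {suc N} F 1≤n n≤1+N with ℕ.m≤n⇒m<n∨m≡n n≤1+N
... | inj₂ refl = ≈-refl
... | inj₁ (ℕ.s≤s n≤N) = begin
  prodTo N G *ₚ G (suc N)
    ≡⟨ cong (prodTo N G *ₚ_) (when-no (F (suc N)) (suc N ℕ.∣? n) (ℕ.>⇒∤ {{ℕ.>-nonZero 1≤n}} (ℕ.s≤s n≤N))) ⟩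
  prodTo N G *ₚ 1ₚ         ≈⟨ *-identityʳ _ ⟩
  prodTo N G               ≈⟨ prodTo-extend F 1≤n n≤N ⟩
  prodTo n G               ∎
  where G = λ d → F d when (d ℕ.∣? n)

∣-prodTo : ∀ {n i} F → 1 ℕ.≤ i → i ℕ.≤ n → F i ∣ₚ prodTo n F
∣-prodTo {zero}  {suc i} F 1≤i ()
∣-prodTo {suc n} {i}     F 1≤i i≤1+n with ℕ.m≤n⇒m<n∨m≡n i≤1+n
... | inj₁ (ℕ.s≤s i≤n) = ∣-* (F (suc n)) (∣-prodTo F 1≤i i≤n)
... | inj₂ refl = x∣ʳyx (F i) (prodTo n F)

Monic-prodTo : ∀ n F (deg : ℕ → ℕ) → (∀ i → 1 ℕ.≤ i → i ℕ.≤ n → Monic (deg i) (F i)) → Monic (sumTo n deg) (prodTo n F)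
Monic-prodTo zero    F deg m = Monic-1
Monic-prodTo (suc n) F deg m =
  Monic-* (Monic-prodTo n F deg λ i 1≤i i≤n → m i 1≤i (ℕ.m≤n⇒m≤1+n i≤n)) (m (suc n) (ℕ.s≤s ℕ.z≤n) ℕ.≤-refl)

-- When `k` divides `n`, the product of these factors over d ≤ n is the quotient (Xⁿ - 1) / (Xᵏ -
-- 1).
newDivisors : ℕ → ℕ → ℕ → Poly
newDivisors n k d = Φ d when (d ℕ.∣? n ×-dec ¬? (d ℕ.∣? k))

divisorFactor-split : ∀ {n k} → k ℕ.∣ n → ∀ d → divisorFactor n d ≈ newDivisors n k d *ₚ divisorFactor k d
divisorFactor-split {n} {k} k∣n d with d ℕ.∣? n | d ℕ.∣? k
... | yes _   | yes _   = ≈-sym (*-identityˡ (Φ d))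
... | yes _   | no _    = ≈-sym (*-identityʳ (Φ d))
... | no _    | no _    = ≈-sym (*-identityˡ 1ₚ)
... | no  d∤n | yes d∣k = contradiction (ℕ.∣-trans d∣k k∣n) d∤n

-- Cyclotomic polynomials

-- The induction invariant. At smaller indices, both fields together give the coprimality that makes
-- the next division exact, and `monicΦ` makes its divisor monic of known degree.
record Cyclotomic (n : ℕ) : Set where
  field
    monicΦ   : Monic (totient n) (Φ n)
    divisors : prodTo n (divisorFactor n) ≈ Xⁿ-1 n

open Cyclotomic

Monic-Xⁿ-1′ : ∀ {n} → 1 ℕ.≤ n → Monic n (Xⁿ-1 n)
Monic-Xⁿ-1′ {suc n} _ = Monic-Xⁿ-1 n

Φ∣Xⁿ-1 : ∀ {n} → 1 ℕ.≤ n → Cyclotomic n → Φ n ∣ₚ Xⁿ-1 n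
Φ∣Xⁿ-1 {n} 1≤n c = ∣ʳ-respʳ-≈ (divisors c)
  (subst (_∣ₚ prodTo n (divisorFactor n)) (when-yes (Φ n) (n ℕ.∣? n) ℕ.∣-refl) (∣-prodTo (divisorFactor n) 1≤n ℕ.≤-refl))

-- Multiplied by Xᵏ - 1, both sides become Xⁿ - 1: the divisors of `n` split into those of `k` and
-- the new ones. The monic factor Xᵏ - 1 then cancels.
newDivisors≈geometric : ∀ r {k} → 1 ℕ.≤ r → 1 ℕ.≤ k → Cyclotomic (r ℕ.* k) → Cyclotomic k →
                        prodTo (r ℕ.* k) (newDivisors (r ℕ.* k) k) ≈ geometric r (X ^ₚ k)
newDivisors≈geometric r {k} 1≤r 1≤k cn ck = Monic-cancelʳ _ _ (Monic-Xⁿ-1′ 1≤k) (begin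
  prodTo n (newDivisors n k) *ₚ Xⁿ-1 k
    ≈⟨ *-congˡ (prodTo n (newDivisors n k)) (≈-sym (divisors ck)) ⟩
  prodTo n (newDivisors n k) *ₚ prodTo k (divisorFactor k)
    ≈⟨ *-congˡ (prodTo n (newDivisors n k)) (≈-sym (prodTo-extend Φ 1≤k (ℕ.m≤n*m k r {{ℕ.>-nonZero 1≤r}}))) ⟩
  prodTo n (newDivisors n k) *ₚ prodTo n (divisorFactor k)
    ≈⟨ ≈-sym (prodTo-* n (newDivisors n k) (divisorFactor k)) ⟩
  prodTo n (λ d → newDivisors n k d *ₚ divisorFactor k d)
    ≈⟨ prodTo-cong n (λ d _ _ → ≈-sym (divisorFactor-split (ℕ.n∣m*n r) d)) ⟩
  prodTo n (divisorFactor n)                                     ≈⟨ divisors cn ⟩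
  Xⁿ-1 n                                                         ≈⟨ Xⁿ-1-* r k ⟩
  geometric r (X ^ₚ k) *ₚ Xⁿ-1 k                                 ∎)
  where n = r ℕ.* k

Φ∣geometric : ∀ r {k} → 2 ℕ.≤ r → 1 ℕ.≤ k → Cyclotomic (r ℕ.* k) → Cyclotomic k → Φ (r ℕ.* k) ∣ₚ geometric r (X ^ₚ k)
Φ∣geometric r {k} 2≤r 1≤k cn ck = ∣ʳ-respʳ-≈ (newDivisors≈geometric r 1≤r 1≤k cn ck)
  (subst (_∣ₚ prodTo n (newDivisors n k))
    (when-yes (Φ n) (n ℕ.∣? n ×-dec ¬? (n ℕ.∣? k)) (ℕ.∣-refl , ℕ.>⇒∤ (subst (k ℕ.<_) (ℕ.*-comm k r) (ℕ.m<m*n k r 2≤r))))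
    (∣-prodTo {n} (newDivisors n k) (ℕ.*-mono-≤ 1≤r 1≤k) ℕ.≤-refl))
  where
  n = r ℕ.* k
  1≤r = ℕ.<⇒≤ 2≤r
  instance
    k-nonZero : ℕ.NonZero k
    k-nonZero = ℕ.>-nonZero 1≤k

-- Φ m and Φ d are coprime for d < m: with k = gcd m d, Φ m divides the geometric sum
-- (Xᵐ - 1) / (Xᵏ - 1), which is the constant m / k modulo Xᵏ - 1.
Φ-coprime : ∀ {m d} h → 1 ℕ.≤ d → d ℕ.< m → Cyclotomic m → Cyclotomic d → Cyclotomic (gcd m d) →
            Φ m ∣ₚ Φ d *ₚ h → Φ m ∣ₚ h
Φ-coprime {m} {d} h 1≤d d<m cm cd ck Φm∣Φdh = go (gcd[m,n]∣m m d)
  where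
  1≤m : 1 ℕ.≤ m
  1≤m = ℕ.≤-trans 1≤d (ℕ.<⇒≤ d<m)
  k = gcd m d
  instance
    d-nonZero : ℕ.NonZero d
    d-nonZero = ℕ.>-nonZero 1≤d
  1≤k : 1 ℕ.≤ k
  1≤k = ℕ.n≢0⇒n>0 λ k≡0 → ℕ.≢-nonZero⁻¹ d (gcd[m,n]≡0⇒n≡0 m k≡0)
  ∣-Xᵏ-1 : Φ m ∣ₚ Xⁿ-1 k *ₚ h
  ∣-Xᵏ-1 = ∣-Xⁿ-1-gcd m d h (∣-* h (Φ∣Xⁿ-1 1≤m cm)) (∣ʳ-trans Φm∣Φdh (∣-*ʳ h (Φ∣Xⁿ-1 1≤d cd)))
    where
    ∣-*ʳ : ∀ {a b} h → a ∣ₚ b → a *ₚ h ∣ₚ b *ₚ h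
    ∣-*ʳ {a} h (c ,∣ e) = c ,∣ ≈-trans (≈-sym (*-assoc c a h)) (*-cong e ≈-refl)
  go : k ℕ.∣ m → Φ m ∣ₚ h
  go (ℕ.divides r m≡rk) =
    let w , e = geometric-mod r (X ^ₚ k) in
    Monic-∣-κ* (+ r) h (monicΦ cm) (λ { refl → ℕ.≢-nonZero⁻¹ m {{ℕ.>-nonZero 1≤m}} m≡rk })
      (∣-+-cancelʳ (κ (+ r) *ₚ h) (w *ₚ (Xⁿ-1 k *ₚ h))
        (∣ʳ-respʳ-≈ (begin
          geometric r (X ^ₚ k) *ₚ h                            ≈⟨ *-cong e ≈-refl ⟩
          (κ (+ r) +ₚ w *ₚ (X ^ₚ k +ₚ (-ₚ 1ₚ))) *ₚ h
            ≈⟨ *-cong (+-cong (≈-refl {κ (+ r)}) (*-congˡ w (≈-sym (Xⁿ-1≈ k)))) ≈-refl ⟩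
          (κ (+ r) +ₚ w *ₚ Xⁿ-1 k) *ₚ h
            ≈⟨ solve 4 (λ c w g h → (c ⊕ w ⊗ g) ⊗ h , c ⊗ h ⊕ w ⊗ (g ⊗ h)) ≈-refl (κ (+ r)) w (Xⁿ-1 k) h ⟩
          κ (+ r) *ₚ h +ₚ w *ₚ (Xⁿ-1 k *ₚ h)                   ∎)
          (∣-* h Φm∣geometric))
        (x∣ʳy⇒x∣ʳzy w ∣-Xᵏ-1))
    where
    2≤r : 2 ℕ.≤ r
    2≤r = ℕ.*-cancelʳ-< k 1 r (subst₂ ℕ._<_ (sym (ℕ.*-identityˡ k)) m≡rk (ℕ.≤-<-trans (ℕ.∣⇒≤ (gcd[m,n]∣n m d)) d<m))
    Φm∣geometric : Φ m ∣ₚ geometric r (X ^ₚ k)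
    Φm∣geometric = subst (λ n → Φ n ∣ₚ geometric r (X ^ₚ k)) (sym m≡rk)
      (Φ∣geometric r 2≤r 1≤k (subst Cyclotomic m≡rk cm) ck)

module _ (k : ℕ) (cyclotomic≤k : ∀ d → 1 ℕ.≤ d → d ℕ.≤ k → Cyclotomic d) where
  private
    n = suc k

    Monic-divisorFactor : ∀ i → 1 ℕ.≤ i → i ℕ.≤ k → Monic (if does (i ℕ.∣? n) then totient i else 0) (divisorFactor n i)
    Monic-divisorFactor i 1≤i i≤k with does (i ℕ.∣? n)
    ... | true  = monicΦ (cyclotomic≤k i 1≤i i≤k)
    ... | false = Monic-1

    -- Every factor of the product is 1 or some `Φ d` with d ≤ j, hence coprime to `Φ (suc j)`, and
    -- is struck off in turn.
    cancel-prodTo : ∀ j i c → i ℕ.≤ j → suc j ℕ.≤ k → Φ (suc j) ∣ₚ c *ₚ prodTo i (divisorFactor n) → Φ (suc j) ∣ₚ c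
    cancel-prodTo j zero    c i≤j j<k Φ∣ = ∣ʳ-respʳ-≈ (*-identityʳ c) Φ∣
    cancel-prodTo j (suc i) c i<j j<k Φ∣ = cancel-prodTo j i c (ℕ.<⇒≤ i<j) j<k (cancel (suc i ℕ.∣? n) (∣ʳ-respʳ-≈
        (solve 3 (λ c p f → c ⊗ (p ⊗ f) , f ⊗ (c ⊗ p)) ≈-refl c (prodTo i (divisorFactor n)) (divisorFactor n (suc i))) Φ∣))
      where
      cancel : ∀ {h} (d? : Dec (suc i ℕ.∣ n)) → Φ (suc j) ∣ₚ (Φ (suc i) when d?) *ₚ h → Φ (suc j) ∣ₚ h
      cancel {h} (no _)  e = ∣ʳ-respʳ-≈ (*-identityˡ h) e
      cancel {h} (yes _) e = Φ-coprime h (ℕ.s≤s ℕ.z≤n) (ℕ.s≤s i<j)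
        (cyclotomic≤k _ (ℕ.s≤s ℕ.z≤n) j<k)
        (cyclotomic≤k _ (ℕ.s≤s ℕ.z≤n) (ℕ.≤-trans i<j (ℕ.<⇒≤ j<k)))
        (cyclotomic≤k _ (ℕ.n≢0⇒n>0 λ g≡0 → contradiction (gcd[m,n]≡0⇒n≡0 (suc j) {suc i} g≡0) λ ())
          (ℕ.≤-trans (ℕ.∣⇒≤ (gcd[m,n]∣m (suc j) (suc i))) j<k)) e

    -- One divisor is added at a time: if Xⁿ - 1 = c A and `suc j` divides `n`, then `Φ (suc j)`
    -- divides c A and is coprime to every factor of A, so it divides c.
    prodTo∣Xⁿ-1 : ∀ j → j ℕ.≤ k → prodTo j (divisorFactor n) ∣ₚ Xⁿ-1 n
    prodTo∣Xⁿ-1 zero    _   = 1∣ Xⁿ-1 n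
    prodTo∣Xⁿ-1 (suc j) j<k = extend (suc j ℕ.∣? n) (prodTo∣Xⁿ-1 j (ℕ.<⇒≤ j<k))
      where
      A = prodTo j (divisorFactor n)
      extend : (d? : Dec (suc j ℕ.∣ n)) → A ∣ₚ Xⁿ-1 n → A *ₚ (Φ (suc j) when d?) ∣ₚ Xⁿ-1 n
      extend (no _)     A∣         = ∣ʳ-respˡ-≈ (≈-sym (*-identityʳ A)) A∣
      extend (yes 1+j∣n) (c ,∣ cA≈) =
        let c′ ,∣ c′Φ≈c = cancel-prodTo j j c ℕ.≤-refl j<k (∣ʳ-respʳ-≈ (≈-sym cA≈)
              (∣ʳ-trans (Φ∣Xⁿ-1 (ℕ.s≤s ℕ.z≤n) (cyclotomic≤k (suc j) (ℕ.s≤s ℕ.z≤n) j<k)) (Xⁿ-1-∣ 1+j∣n)))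
        in c′ ,∣ (begin
          c′ *ₚ (A *ₚ Φ (suc j))   ≈⟨ solve 3 (λ c a f → c ⊗ (a ⊗ f) , (c ⊗ f) ⊗ a) ≈-refl c′ A (Φ (suc j)) ⟩
          c′ *ₚ Φ (suc j) *ₚ A     ≈⟨ *-cong c′Φ≈c ≈-refl ⟩
          c *ₚ A                   ≈⟨ cA≈ ⟩
          Xⁿ-1 n                   ∎)

    tableProduct : List (ℕ × Poly) → Poly
    tableProduct t = productₚ (map proj₂ (filter (λ e → proj₁ e ℕ.∣? n) t))

    tableProduct-∷ʳ : ∀ t d p → tableProduct (t ++ ((d , p) ∷ [])) ≈ tableProduct t *ₚ (p when (d ℕ.∣? n))
    tableProduct-∷ʳ [] d p with does (d ℕ.∣? n)
    ... | true  = *-comm p 1ₚ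
    ... | false = ≈-sym (*-identityˡ 1ₚ)
    tableProduct-∷ʳ ((e , q) ∷ t) d p with does (e ℕ.∣? n)
    ... | true  = ≈-trans (*-congˡ q (tableProduct-∷ʳ t d p)) (≈-sym (*-assoc q (tableProduct t) _))
    ... | false = tableProduct-∷ʳ t d p

    tableProduct≈ : ∀ j → tableProduct (cycTable j) ≈ prodTo j (divisorFactor n)
    tableProduct≈ zero    = ≈-refl
    tableProduct≈ (suc j) = ≈-trans (tableProduct-∷ʳ (cycTable j) (suc j) (Φ (suc j))) (*-cong (tableProduct≈ j) ≈-refl)

    Monic-tableProduct : ∀ {t} → All (λ e → ∃[ m ] Monic m (proj₂ e)) t → ∃[ m ] Monic m (tableProduct t)
    Monic-tableProduct []                          = 0 , Monic-1
    Monic-tableProduct {(e , p) ∷ t} ((m , mp) ∷ ms) with does (e ℕ.∣? n) | Monic-tableProduct ms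
    ... | true  | m′ , mt = m ℕ.+ m′ , Monic-* mp mt
    ... | false | mt      = mt

    Monic-cycTable : ∀ j → j ℕ.≤ k → All (λ e → ∃[ m ] Monic m (proj₂ e)) (cycTable j)
    Monic-cycTable zero    _   = []
    Monic-cycTable (suc j) j<k =
      All.++⁺ (Monic-cycTable j (ℕ.<⇒≤ j<k)) ((_ , monicΦ (cyclotomic≤k (suc j) (ℕ.s≤s ℕ.z≤n) j<k)) ∷ [])

    B = tableProduct (cycTable k)

    degB = sumTo k (λ i → if does (i ℕ.∣? n) then totient i else 0)

    -- `Monic` fixes the list length and so does not pass along `≈`. Monicity of the list `B` comes
    -- from the table, its degree from comparison with the product over divisors.
    Monic-B : Monic degB B
    Monic-B = let m , mB = Monic-tableProduct (Monic-cycTable k ℕ.≤-refl) in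
      subst (λ m → Monic m B)
        (Monic-unique (tableProduct≈ k) mB (Monic-prodTo k (divisorFactor n) _ Monic-divisorFactor)) mB

    B∣Xⁿ-1 : B ∣ₚ Xⁿ-1 n
    B∣Xⁿ-1 = ∣ʳ-respˡ-≈ (≈-sym (tableProduct≈ k)) (prodTo∣Xⁿ-1 k ℕ.≤-refl)

    totient+degB : totient n ℕ.+ degB ≡ n
    totient+degB = trans (ℕ.+-comm (totient n) degB)
      (trans (cong (λ b → degB ℕ.+ (if b then totient n else 0)) (sym (dec-true (n ℕ.∣? n) ℕ.∣-refl))) (Σ-totient n))

  cyclotomic-step : Cyclotomic n
  cyclotomic-step = record
    { monicΦ   = Monic-divMonic (subst (λ m → Monic m (Xⁿ-1 n)) (sym totient+degB) (Monic-Xⁿ-1 k)) Monic-B B∣Xⁿ-1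
    ; divisors = begin
        prodTo k (divisorFactor n) *ₚ divisorFactor n n
          ≡⟨ cong (prodTo k (divisorFactor n) *ₚ_) (when-yes (Φ n) (n ℕ.∣? n) ℕ.∣-refl) ⟩
        prodTo k (divisorFactor n) *ₚ Φ n                ≈⟨ *-cong (≈-sym (tableProduct≈ k)) ≈-refl ⟩
        B *ₚ Φ n                                         ≈⟨ *-comm B (Φ n) ⟩
        Φ n *ₚ B                                         ≈⟨ divMonic-exact (Xⁿ-1 n) Monic-B B∣Xⁿ-1 ⟩
        Xⁿ-1 n                                           ∎
    }

cyclotomic≤ : ∀ k d → 1 ℕ.≤ d → d ℕ.≤ k → Cyclotomic d
cyclotomic≤ zero    d 1≤d d≤0 = contradiction (ℕ.≤-trans 1≤d d≤0) λ ()
cyclotomic≤ (suc k) d 1≤d d≤1+k with ℕ.m≤n⇒m<n∨m≡n d≤1+k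
... | inj₁ (ℕ.s≤s d≤k) = cyclotomic≤ k d 1≤d d≤k
... | inj₂ refl        = cyclotomic-step k (cyclotomic≤ k)

cyclotomic : ∀ {n} → 1 ℕ.≤ n → Cyclotomic n
cyclotomic {n} 1≤n = cyclotomic≤ n n 1≤n ℕ.≤-refl

-- Palindromic polynomials

-- q = x^m p(1/x)
record Reversal (m : ℕ) (p q : Poly) : Set where
  constructor reversal
  field
    mirror : ∀ i j → i ℕ.+ j ≡ m → coeff p i ≡ coeff q j
    deg<ˡ  : Deg< (suc m) p
    deg<ʳ  : Deg< (suc m) q

open Reversal

Reversal-sym : ∀ {m p q} → Reversal m p q → Reversal m q p
Reversal-sym (reversal m l r) = reversal (λ i j e → sym (m j i (trans (ℕ.+-comm j i) e))) r l

Reversal-cong : ∀ {m p p′ q q′} → p ≈ p′ → q ≈ q′ → Reversal m p q → Reversal m p′ q′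
Reversal-cong p≈p′ q≈q′ (reversal m l r) = reversal
  (λ i j e → trans (sym (at p≈p′ i)) (trans (m i j e) (at q≈q′ j))) (Deg<-cong p≈p′ l) (Deg<-cong q≈q′ r)

Reversal-unique : ∀ {m p q q′} → Reversal m p q → Reversal m p q′ → q ≈ q′
Reversal-unique {m} {p} {q} {q′} ρ ρ′ = mk≈ λ j → go j (ℕ.≤-<-connex j m)
  where
  go : ∀ j → _ → coeff q j ≡ coeff q′ j
  go j (inj₁ j≤m) = let e = ℕ.m∸n+n≡m j≤m in trans (sym (mirror ρ (m ℕ.∸ j) j e)) (mirror ρ′ (m ℕ.∸ j) j e)
  go j (inj₂ m<j) = trans (deg<ʳ ρ j m<j) (sym (deg<ʳ ρ′ j m<j))

Reversal-+ : ∀ {m} p p′ q q′ → Reversal m p p′ → Reversal m q q′ → Reversal m (p +ₚ q) (p′ +ₚ q′)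
Reversal-+ p p′ q q′ ρ σ = reversal
  (λ i j e → trans (coeff-+ p q i) (trans (cong₂ ℤ._+_ (mirror ρ i j e) (mirror σ i j e)) (sym (coeff-+ p′ q′ j))))
  (λ i m<i → trans (coeff-+ p q i) (cong₂ ℤ._+_ (deg<ˡ ρ i m<i) (deg<ˡ σ i m<i)))
  (λ i m<i → trans (coeff-+ p′ q′ i) (cong₂ ℤ._+_ (deg<ʳ ρ i m<i) (deg<ʳ σ i m<i)))

Reversal-scale : ∀ {m} a p q → Reversal m p q → Reversal m (scale a p) (scale a q)
Reversal-scale a p q ρ = reversal
  (λ i j e → trans (coeff-scale a p i) (trans (cong (a ℤ.*_) (mirror ρ i j e)) (sym (coeff-scale a q j))))
  (λ i m<i → trans (coeff-scale a p i) (trans (cong (a ℤ.*_) (deg<ˡ ρ i m<i)) (ℤ.*-zeroʳ a)))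
  (λ i m<i → trans (coeff-scale a q i) (trans (cong (a ℤ.*_) (deg<ʳ ρ i m<i)) (ℤ.*-zeroʳ a)))

-- In x^(m+1) · (1/x) p(1/x) the extra factors cancel, leaving x^m p(1/x).
Reversal-shift : ∀ {m p q} → Reversal m p q → Reversal (suc m) (+ 0 ∷ p) q
Reversal-shift {m} {p} {q} ρ = reversal
  (λ { zero .(suc m) refl → sym (deg<ʳ ρ (suc m) ℕ.≤-refl) ; (suc i) j e → mirror ρ i j (ℕ.suc-injective e) })
  (λ { (suc i) (ℕ.s≤s m<i) → deg<ˡ ρ i m<i })
  (λ i m<i → deg<ʳ ρ i (ℕ.<⇒≤ m<i))

Reversal-X^ : ∀ {m p q} k → Reversal m p q → Reversal (k ℕ.+ m) (X ^ₚ k *ₚ p) q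
Reversal-X^ zero    ρ = Reversal-cong (≈-sym (*-identityˡ _)) ≈-refl ρ
Reversal-X^ {p = p} (suc k) ρ = Reversal-cong
  (≈-trans (≈-sym (X-* (X ^ₚ k *ₚ p))) (≈-sym (*-assoc X (X ^ₚ k) p))) ≈-refl (Reversal-shift (Reversal-X^ k ρ))

-- Multiplicativity of reversal, by recursion on the list of the first factor, whose mirror image is
-- therefore its `reverse`. Uniqueness of mirror images extends this to `Reversal-*`.
Reversal-reverse-* : ∀ a p {n q q′} → Reversal n q q′ →
                     Reversal (length p ℕ.+ n) ((a ∷ p) *ₚ q) (reverse (a ∷ p) *ₚ q′)
Reversal-reverse-* a [] {n} {q} {q′} ρ =
  Reversal-cong (≈-sym (κ-* a q)) (≈-sym (κ-* a q′)) (Reversal-scale a q q′ ρ)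
Reversal-reverse-* a p@(b ∷ p₁) {n} {q} {q′} ρ = Reversal-cong ≈-refl (≈-sym reverse*q′)
  (Reversal-+ (scale a q) (scale a (X ^ₚ length p *ₚ q′)) (+ 0 ∷ p *ₚ q) (reverse p *ₚ q′)
    (Reversal-scale a q (X ^ₚ length p *ₚ q′) (Reversal-sym (Reversal-X^ (length p) (Reversal-sym ρ))))
    (Reversal-shift (Reversal-reverse-* b p₁ ρ)))
  where
  reverse*q′ : reverse (a ∷ p) *ₚ q′ ≈ scale a (X ^ₚ length p *ₚ q′) +ₚ reverse p *ₚ q′
  reverse*q′ = begin
    reverse (a ∷ p) *ₚ q′                                        ≡⟨ cong (_*ₚ q′) (List.unfold-reverse a p) ⟩
    (reverse p ∷ʳ a) *ₚ q′                                       ≈⟨ *-cong (∷ʳ≈ (reverse p) a) ≈-refl ⟩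
    (κ a *ₚ X ^ₚ length (reverse p) +ₚ reverse p) *ₚ q′
      ≡⟨ cong (λ l → (κ a *ₚ X ^ₚ l +ₚ reverse p) *ₚ q′) (List.length-reverse p) ⟩
    (κ a *ₚ X ^ₚ length p +ₚ reverse p) *ₚ q′
      ≈⟨ solve 4 (λ a x r q → (a ⊗ x ⊕ r) ⊗ q , a ⊗ (x ⊗ q) ⊕ r ⊗ q) ≈-refl (κ a) (X ^ₚ length p) (reverse p) q′ ⟩
    κ a *ₚ (X ^ₚ length p *ₚ q′) +ₚ reverse p *ₚ q′
      ≈⟨ +-cong (κ-* a (X ^ₚ length p *ₚ q′)) ≈-refl ⟩
    scale a (X ^ₚ length p *ₚ q′) +ₚ reverse p *ₚ q′             ∎

Reversal-1 : Reversal 0 1ₚ 1ₚ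
Reversal-1 = reversal (λ { zero zero _ → refl }) (λ { (suc i) _ → refl }) (λ { (suc i) _ → refl })

Reversal-reverse : ∀ {m} p → length p ≡ suc m → Reversal m p (reverse p)
Reversal-reverse (a ∷ p) refl = Reversal-cong (*-identityʳ _) (*-identityʳ _)
  (subst (λ m → Reversal m ((a ∷ p) *ₚ 1ₚ) (reverse (a ∷ p) *ₚ 1ₚ)) (ℕ.+-identityʳ (length p)) (Reversal-reverse-* a p Reversal-1))

Reversal-* : ∀ {m n p p′ q q′} → length p ≡ suc m → Reversal m p p′ → Reversal n q q′ →
             Reversal (m ℕ.+ n) (p *ₚ q) (p′ *ₚ q′)
Reversal-* {p = a ∷ p} {q′ = q′} refl ρ σ = Reversal-cong ≈-refl
  (*-cong (Reversal-unique (Reversal-reverse (a ∷ p) refl) ρ) (≈-refl {q′})) (Reversal-reverse-* a p σ)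

Palindromic : ℕ → Poly → Set
Palindromic m p = Reversal m p p

Antipalindromic : ℕ → Poly → Set
Antipalindromic m p = Reversal m p (-ₚ p)

Antipalindromic-Xⁿ-1 : ∀ n → Antipalindromic n (Xⁿ-1 n)
Antipalindromic-Xⁿ-1 n = Reversal-cong
  (≈-sym (≈-trans (Xⁿ-1≈ n) (+-cong (≈-sym (*-identityʳ (X ^ₚ n))) ≈-refl)))
  (≈-trans (solve 1 (λ x → Κ 1ₚ ⊕ ⊝ x , ⊝ (x ⊕ ⊝ Κ 1ₚ)) ≈-refl (X ^ₚ n)) (-‿cong (≈-sym (Xⁿ-1≈ n))))
  (Reversal-+ (X ^ₚ n *ₚ 1ₚ) 1ₚ (-ₚ 1ₚ) (-ₚ (X ^ₚ n)) X^n-reversal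
    (Reversal-cong (≈-refl { -ₚ 1ₚ})
      (≈-trans (≈-sym (κ-* (- + 1) (X ^ₚ n *ₚ 1ₚ))) (solve 1 (λ x → (⊝ Κ 1ₚ) ⊗ (x ⊗ Κ 1ₚ) , ⊝ x) ≈-refl (X ^ₚ n)))
      (Reversal-scale (- + 1) 1ₚ (X ^ₚ n *ₚ 1ₚ) (Reversal-sym X^n-reversal))))
  where
  X^n-reversal : Reversal n (X ^ₚ n *ₚ 1ₚ) 1ₚ
  X^n-reversal = subst (λ m → Reversal m (X ^ₚ n *ₚ 1ₚ) 1ₚ) (ℕ.+-identityʳ n) (Reversal-X^ n Reversal-1)

module _ (j : ℕ) (palindromic≤k : ∀ d → 2 ℕ.≤ d → d ℕ.≤ suc j → Palindromic (totient d) (Φ d)) where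
  private
    k = suc j
    n = suc k
    F = divisorFactor n
    deg : ℕ → ℕ
    deg i = if does (i ℕ.∣? n) then totient i else 0

    Monic-F : ∀ i → 1 ℕ.≤ i → Monic (deg i) (F i)
    Monic-F i 1≤i with does (i ℕ.∣? n)
    ... | true  = monicΦ (cyclotomic 1≤i)
    ... | false = Monic-1

    palindromic-F : ∀ i → 2 ℕ.≤ i → i ℕ.≤ k → Palindromic (deg i) (F i)
    palindromic-F i 2≤i i≤k with does (i ℕ.∣? n)
    ... | true  = palindromic≤k i 2≤i i≤k
    ... | false = Reversal-1

    Monic-A : ∀ j → Monic (sumTo j deg) (prodTo j F)
    Monic-A j = Monic-prodTo j F deg λ i 1≤i _ → Monic-F i 1≤i

    -- The factor `Φ 1` = X - 1 is present for every `n` and is the only one that reversal negates,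
    -- so every partial product starting from it changes sign.
    antipalindromic : ∀ j → suc j ℕ.≤ k → Antipalindromic (sumTo (suc j) deg) (prodTo (suc j) F)
    antipalindromic zero _ rewrite dec-true (1 ℕ.∣? n) (ℕ.1∣ n) =
      Reversal-cong (≈-sym (*-identityˡ (Φ 1))) (-‿cong (≈-sym (*-identityˡ (Φ 1)))) (Antipalindromic-Xⁿ-1 1)
    antipalindromic (suc j) j<k = Reversal-cong ≈-refl
      (solve 2 (λ a f → (⊝ a) ⊗ f , ⊝ (a ⊗ f)) ≈-refl (prodTo (suc j) F) (F (suc (suc j))))
      (Reversal-* (length≡ (Monic-A (suc j))) (antipalindromic j (ℕ.<⇒≤ j<k)) (palindromic-F (suc (suc j)) (ℕ.s≤s (ℕ.s≤s ℕ.z≤n)) j<k))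

    A = prodTo k F

  -- Reversing A Φ = Xⁿ - 1, where A is antipalindromic, gives (-A) Φ′ = -(Xⁿ - 1) with Φ′ the
  -- reverse of Φ. Hence A Φ′ = A Φ, and the monic A cancels.
  palindromic-step : Palindromic (totient n) (Φ n)
  palindromic-step = Reversal-cong ≈-refl Φ′≈Φ Φ-reversal
    where
    c = cyclotomic {n} (ℕ.s≤s ℕ.z≤n)
    Φ-reversal : Reversal (totient n) (Φ n) (reverse (Φ n))
    Φ-reversal = Reversal-reverse (Φ n) (length≡ (monicΦ c))
    AΦ≈Xⁿ-1 : A *ₚ Φ n ≈ Xⁿ-1 n
    AΦ≈Xⁿ-1 = ≈-trans (*-congˡ A (≡⇒≈ (sym (when-yes (Φ n) (n ℕ.∣? n) ℕ.∣-refl)))) (divisors c)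
    A-antipalindromic : Antipalindromic (sumTo k deg) A
    A-antipalindromic = antipalindromic j ℕ.≤-refl
    Φ′≈Φ : reverse (Φ n) ≈ Φ n
    Φ′≈Φ = Monic-cancelʳ (reverse (Φ n)) (Φ n) (Monic-A k) (begin
      reverse (Φ n) *ₚ A               ≈⟨ solve 2 (λ f a → f ⊗ a , ⊝ ((⊝ a) ⊗ f)) ≈-refl (reverse (Φ n)) A ⟩
      -ₚ ((-ₚ A) *ₚ reverse (Φ n))     ≈⟨ -‿cong -AΦ′≈-[Xⁿ-1] ⟩
      -ₚ (-ₚ Xⁿ-1 n)                   ≈⟨ solve 1 (λ x → ⊝ (⊝ x) , x) ≈-refl (Xⁿ-1 n) ⟩
      Xⁿ-1 n                           ≈⟨ ≈-sym AΦ≈Xⁿ-1 ⟩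
      A *ₚ Φ n                         ≈⟨ *-comm A (Φ n) ⟩
      Φ n *ₚ A                         ∎)
      where
      sum≡ : sumTo k deg ℕ.+ totient n ≡ n
      sum≡ = trans (cong (λ b → sumTo k deg ℕ.+ (if b then totient n else 0)) (sym (dec-true (n ℕ.∣? n) ℕ.∣-refl))) (Σ-totient n)
      -AΦ′≈-[Xⁿ-1] : (-ₚ A) *ₚ reverse (Φ n) ≈ -ₚ Xⁿ-1 n
      -AΦ′≈-[Xⁿ-1] = Reversal-unique
        (subst (λ m → Reversal m (Xⁿ-1 n) ((-ₚ A) *ₚ reverse (Φ n))) sum≡
          (Reversal-cong AΦ≈Xⁿ-1 ≈-refl (Reversal-* (length≡ (Monic-A k)) A-antipalindromic Φ-reversal)))
        (Antipalindromic-Xⁿ-1 n)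

palindromic≤ : ∀ k d → 2 ℕ.≤ d → d ℕ.≤ k → Palindromic (totient d) (Φ d)
palindromic≤ zero    d 2≤d d≤0 = contradiction (ℕ.≤-trans 2≤d d≤0) λ ()
palindromic≤ (suc k) d 2≤d d≤1+k with ℕ.m≤n⇒m<n∨m≡n d≤1+k
... | inj₁ (ℕ.s≤s d≤k) = palindromic≤ k d 2≤d d≤k
... | inj₂ refl        = step k 2≤d (palindromic≤ k)
  where
  step : ∀ k → 2 ℕ.≤ suc k → (∀ d → 2 ℕ.≤ d → d ℕ.≤ k → Palindromic (totient d) (Φ d)) →
         Palindromic (totient (suc k)) (Φ (suc k))
  step zero    (ℕ.s≤s ()) _
  step (suc j) _          ih = palindromic-step j ih

palindromic-Φ : ∀ {n} → 2 ℕ.≤ n → Palindromic (totient n) (Φ n)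
palindromic-Φ {n} 2≤n = palindromic≤ n n 2≤n ℕ.≤-refl

-- The γ-expansion

Σ< : ℕ → (ℕ → ℤ) → ℤ
Σ< zero    f = + 0
Σ< (suc n) f = f 0 ℤ.+ Σ< n (f ∘ suc)

Σ<-cong : ∀ n {f g} → (∀ j → j ℕ.< n → f j ≡ g j) → Σ< n f ≡ Σ< n g
Σ<-cong zero    e = refl
Σ<-cong (suc n) e = cong₂ ℤ._+_ (e 0 (ℕ.s≤s ℕ.z≤n)) (Σ<-cong n λ j j<n → e (suc j) (ℕ.s≤s j<n))

Σ<-zero : ∀ n {f} → (∀ j → j ℕ.< n → f j ≡ + 0) → Σ< n f ≡ + 0
Σ<-zero zero    e = refl
Σ<-zero (suc n) e = cong₂ ℤ._+_ (e 0 (ℕ.s≤s ℕ.z≤n)) (Σ<-zero n λ j j<n → e (suc j) (ℕ.s≤s j<n))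

Σ<-last : ∀ n f → Σ< (suc n) f ≡ Σ< n f ℤ.+ f n
Σ<-last zero    f = ℤ.+-comm (f 0) (+ 0)
Σ<-last (suc n) f = trans (cong (ℤ._+_ (f 0)) (Σ<-last n (f ∘ suc))) (sym (ℤ.+-assoc (f 0) (Σ< n (f ∘ suc)) (f (suc n))))

Σ<-truncate : ∀ {k} n {f} → k ℕ.≤ n → (∀ j → k ℕ.≤ j → f j ≡ + 0) → Σ< n f ≡ Σ< k f
Σ<-truncate n       {f} ℕ.z≤n       e = Σ<-zero n λ j _ → e j ℕ.z≤n
Σ<-truncate (suc n) {f} (ℕ.s≤s k≤n) e = cong (ℤ._+_ (f 0)) (Σ<-truncate n k≤n λ j k≤j → e (suc j) (ℕ.s≤s k≤j))

sumℤ-zip : ∀ (f : ℕ × ℤ → ℤ) xs →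
           sumℤ (map f (zip (upTo (length xs)) xs)) ≡ Σ< (length xs) (λ j → f (j , coeff xs j))
sumℤ-zip f = go id
  where
  go : ∀ g xs → sumℤ (map f (zip (applyUpTo g (length xs)) xs)) ≡ Σ< (length xs) (λ j → f (g j , coeff xs j))
  go g []       = refl
  go g (x ∷ xs) = cong (ℤ._+_ (f (g 0 , x))) (go (g ∘ suc) xs)

γ-term : ℕ → ℕ → ℕ × ℤ → ℤ
γ-term D i (j , γ) = γ ℤ.* + ((D ℕ.∸ 2 ℕ.* j) C (i ℕ.∸ j))

gammas : Poly → ℕ → ℕ → List ℤ
gammas c D zero    = coeff c 0 ∷ []
gammas c D (suc i) =
  let gs = gammas c D i in
  gs ++ ((coeff c (suc i) ℤ.- sumℤ (map (γ-term D (suc i)) (zip (upTo (length gs)) gs))) ∷ [])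

-- Same device as for divMonic≡.
gammas≡ : ∀ c D i → _ ≡ gammas c D i
lucasγ≡ : ∀ n → lucasγ n ≡ gammas (Φ n) (totient n) (totient n ℕ./ 2)
lucasγ≡ n with Φ n | totient n | totient n ℕ./ 2
... | c | D | i = gammas≡ c D i
gammas≡ c D zero    = refl
gammas≡ c D (suc i) rewrite gammas≡ c D i = refl

module _ (c : Poly) (D : ℕ) where
  -- Later lists only append entries, so entry `j` can be read off the list in which it comes last.
  γ : ℕ → ℤ
  γ j = coeff (gammas c D j) j

  length-gammas : ∀ i → length (gammas c D i) ≡ suc i
  length-gammas zero    = refl
  length-gammas (suc i) = trans (List.length-++ (gammas c D i)) (trans (ℕ.+-comm _ 1) (cong suc (length-gammas i)))

  coeff-++ˡ : ∀ p q i → i ℕ.< length p → coeff (p ++ q) i ≡ coeff p i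
  coeff-++ˡ (a ∷ p) q zero    _         = refl
  coeff-++ˡ (a ∷ p) q (suc i) (ℕ.s≤s l) = coeff-++ˡ p q i l

  coeff-∷ʳ : ∀ p a → coeff (p ∷ʳ a) (length p) ≡ a
  coeff-∷ʳ []      a = refl
  coeff-∷ʳ (b ∷ p) a = coeff-∷ʳ p a

  coeff-gammas : ∀ i j → j ℕ.≤ i → coeff (gammas c D i) j ≡ γ j
  coeff-gammas zero    zero _ = refl
  coeff-gammas (suc i) j j≤1+i with ℕ.m≤n⇒m<n∨m≡n j≤1+i
  ... | inj₂ refl = refl
  ... | inj₁ (ℕ.s≤s j≤i) = trans
    (coeff-++ˡ (gammas c D i) _ j (subst (j ℕ.<_) (sym (length-gammas i)) (ℕ.s≤s j≤i))) (coeff-gammas i j j≤i)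

  sumℤ-gammas : ∀ i (f : ℕ × ℤ → ℤ) →
    sumℤ (map f (zip (upTo (length (gammas c D i))) (gammas c D i))) ≡ Σ< (suc i) (λ j → f (j , γ j))
  sumℤ-gammas i f = trans (sumℤ-zip f (gammas c D i))
    (trans (cong (λ n → Σ< n (λ j → f (j , coeff (gammas c D i) j))) (length-gammas i))
           (Σ<-cong (suc i) λ { j (ℕ.s≤s j≤i) → cong (λ z → f (j , z)) (coeff-gammas i j j≤i) }))

  -- The diagonal term j = i carries the binomial coefficient `_ C 0`, which is 1, so adding it
  -- restores exactly what the definition of `γ i` subtracts from `coeff c i`.
  γ-recurrence : ∀ i → coeff c i ≡ Σ< (suc i) (λ j → γ-term D i (j , γ j))
  γ-recurrence zero    = sym (trans (ℤ.+-identityʳ _) (ℤ.*-identityʳ (coeff c 0)))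
  γ-recurrence (suc i) = sym (trans (Σ<-last (suc i) T)
    (trans (cong₂ (λ s k → s ℤ.+ γ (suc i) ℤ.* + ((D ℕ.∸ 2 ℕ.* suc i) C k)) (sym (sumℤ-gammas i (γ-term D (suc i)))) (ℕ.n∸n≡0 i))
    (trans (cong (λ g → S ℤ.+ g ℤ.* + 1) γ≡) (s+[a-s]≡a S (coeff c (suc i))))))
    where
    T = λ j → γ-term D (suc i) (j , γ j)
    S = sumℤ (map (γ-term D (suc i)) (zip (upTo (length (gammas c D i))) (gammas c D i)))
    s+[a-s]≡a : ∀ s a → s ℤ.+ (a ℤ.- s) ℤ.* + 1 ≡ a
    s+[a-s]≡a = ℤ-Solver.solve-∀
    γ≡ : γ (suc i) ≡ coeff c (suc i) ℤ.- S
    γ≡ = subst (λ k → coeff (gammas c D (suc i)) k ≡ coeff c (suc i) ℤ.- S) (length-gammas i) (coeff-∷ʳ (gammas c D i) _)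

-- Powers of 1 + X and the palindromic basis of the γ-expansion

1+X : Poly
1+X = + 1 ∷ + 1 ∷ []

coeff-[1+X]^ : ∀ m i → coeff (1+X ^ₚ m) i ≡ + (m C i)
coeff-[1+X]^ zero    zero    = refl
coeff-[1+X]^ zero    (suc i) = sym (cong +_ (k>n⇒nCk≡0 {0} {suc i} (ℕ.s≤s ℕ.z≤n)))
coeff-[1+X]^ (suc m) i       = trans (at [1+X]*p≈p+X*p i) (trans (coeff-+ p (+ 0 ∷ p) i) (pascal i))
  where
  p = 1+X ^ₚ m
  [1+X]*p≈p+X*p : 1+X *ₚ p ≈ p +ₚ (+ 0 ∷ p)
  [1+X]*p≈p+X*p = +-cong (scale-one p) (∷-cong refl (*-identityˡ p))
  pascal : ∀ i → coeff p i ℤ.+ coeff (+ 0 ∷ p) i ≡ + (suc m C i)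
  pascal zero    = trans (ℤ.+-identityʳ _) (coeff-[1+X]^ m 0)
  pascal (suc i) = trans (cong₂ ℤ._+_ (coeff-[1+X]^ m (suc i)) (coeff-[1+X]^ m i))
    (trans (ℤ.+-comm (+ (m C suc i)) (+ (m C i))) (cong +_ (nCk+nC[k+1]≡[n+1]C[k+1] m i)))

coeff-X^* : ∀ j p i → coeff (X ^ₚ j *ₚ p) (j ℕ.+ i) ≡ coeff p i
coeff-X^* zero    p i = at (*-identityˡ p) i
coeff-X^* (suc j) p i = trans (at (≈-trans (*-assoc X (X ^ₚ j) p) (X-* (X ^ₚ j *ₚ p))) (suc j ℕ.+ i)) (coeff-X^* j p i)

coeff-X^*-< : ∀ j p i → i ℕ.< j → coeff (X ^ₚ j *ₚ p) i ≡ + 0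
coeff-X^*-< (suc j) p i i<j = trans (at (≈-trans (*-assoc X (X ^ₚ j) p) (X-* (X ^ₚ j *ₚ p))) i) (below i i<j)
  where
  below : ∀ i → i ℕ.< suc j → coeff (+ 0 ∷ X ^ₚ j *ₚ p) i ≡ + 0
  below zero    _           = refl
  below (suc i) (ℕ.s≤s i<j) = coeff-X^*-< j p i i<j

Σₚ : ℕ → (ℕ → Poly) → Poly
Σₚ zero    F = []
Σₚ (suc n) F = F 0 +ₚ Σₚ n (F ∘ suc)

coeff-Σₚ : ∀ n F i → coeff (Σₚ n F) i ≡ Σ< n (λ j → coeff (F j) i)
coeff-Σₚ zero    F i = refl
coeff-Σₚ (suc n) F i = trans (coeff-+ (F 0) _ i) (cong (ℤ._+_ (coeff (F 0) i)) (coeff-Σₚ n (F ∘ suc) i))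

Palindromic-Σₚ : ∀ {m} n F → (∀ j → j ℕ.< n → Palindromic m (F j)) → Palindromic m (Σₚ n F)
Palindromic-Σₚ zero    F pal = reversal (λ _ _ _ → refl) (λ _ _ → refl) (λ _ _ → refl)
Palindromic-Σₚ (suc n) F pal =
  Reversal-+ (F 0) (F 0) _ _ (pal 0 (ℕ.s≤s ℕ.z≤n)) (Palindromic-Σₚ n (F ∘ suc) λ j j<n → pal (suc j) (ℕ.s≤s j<n))

Palindromic-[1+X]^ : ∀ m → Palindromic m (1+X ^ₚ m)
Palindromic-[1+X]^ zero    = Reversal-1
Palindromic-[1+X]^ (suc m) = Reversal-* refl (Reversal-reverse 1+X refl) (Palindromic-[1+X]^ m)

Palindromic-X^* : ∀ {m p} j → Palindromic m p → Palindromic (j ℕ.+ (j ℕ.+ m)) (X ^ₚ j *ₚ p)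
Palindromic-X^* j pal = Reversal-X^ j (Reversal-sym (Reversal-X^ j pal))

γ-basis : ℕ → ℕ → Poly
γ-basis D j = X ^ₚ j *ₚ 1+X ^ₚ (D ℕ.∸ 2 ℕ.* j)

Palindromic-γ-basis : ∀ {D j} → 2 ℕ.* j ℕ.≤ D → Palindromic D (γ-basis D j)
Palindromic-γ-basis {D} {j} 2j≤D = subst (λ m → Palindromic m (γ-basis D j)) j+[j+m]≡D
  (Palindromic-X^* j (Palindromic-[1+X]^ (D ℕ.∸ 2 ℕ.* j)))
  where
  j+[j+m]≡D : j ℕ.+ (j ℕ.+ (D ℕ.∸ 2 ℕ.* j)) ≡ D
  j+[j+m]≡D = trans (sym (ℕ.+-assoc j j _)) (trans (cong (λ k → j ℕ.+ k ℕ.+ (D ℕ.∸ 2 ℕ.* j)) (sym (ℕ.+-identityʳ j))) (ℕ.m+[n∸m]≡n 2j≤D))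

2*[D/2]≤D : ∀ D → 2 ℕ.* (D ℕ./ 2) ℕ.≤ D
2*[D/2]≤D D = subst (ℕ._≤ D) (ℕ.*-comm (D ℕ./ 2) 2) (ℕ.m/n*n≤m D 2)

D≤1+2*[D/2] : ∀ D → D ℕ.≤ suc (2 ℕ.* (D ℕ./ 2))
D≤1+2*[D/2] D = subst (ℕ._≤ suc (2 ℕ.* (D ℕ./ 2)))
  (trans (cong (D ℕ.% 2 ℕ.+_) (ℕ.*-comm 2 (D ℕ./ 2))) (sym (ℕ.m≡m%n+[m/n]*n D 2)))
  (ℕ.+-monoˡ-≤ (2 ℕ.* (D ℕ./ 2)) (ℕ.≤-pred (ℕ.m%n<n D 2)))

-- Up to index D / 2 this is `γ-recurrence`, as basis element `j` has no coefficient below index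
-- `j`. Beyond that, both sides are palindromic of degree `D`, and the reflected index D - i falls
-- into the lower half.
γ-expansion : ∀ {c D} → Palindromic D c → c ≈ Σₚ (suc (D ℕ./ 2)) (λ j → scale (γ c D j) (γ-basis D j))
γ-expansion {c} {D} pal = mk≈ λ i → go i (ℕ.≤-<-connex i h) (ℕ.≤-<-connex i D)
  where
  h = D ℕ./ 2
  F = λ j → scale (γ c D j) (γ-basis D j)
  Σ-pal : Palindromic D (Σₚ (suc h) F)
  Σ-pal = Palindromic-Σₚ (suc h) F λ { j (ℕ.s≤s j≤h) → Reversal-scale (γ c D j) (γ-basis D j) (γ-basis D j)
    (Palindromic-γ-basis {D} {j} (ℕ.≤-trans (ℕ.*-monoʳ-≤ 2 j≤h) (2*[D/2]≤D D))) }
  coeff-F : ∀ i j → j ℕ.≤ i → coeff (F j) i ≡ γ-term D i (j , γ c D j)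
  coeff-F i j j≤i = trans (coeff-scale (γ c D j) (γ-basis D j) i) (cong (γ c D j ℤ.*_)
    (trans (cong (coeff (γ-basis D j)) (sym (ℕ.m+[n∸m]≡n j≤i)))
    (trans (coeff-X^* j (1+X ^ₚ (D ℕ.∸ 2 ℕ.* j)) (i ℕ.∸ j)) (coeff-[1+X]^ (D ℕ.∸ 2 ℕ.* j) (i ℕ.∸ j)))))
  coeff-F-< : ∀ i j → i ℕ.< j → coeff (F j) i ≡ + 0
  coeff-F-< i j i<j = trans (coeff-scale (γ c D j) (γ-basis D j) i)
    (trans (cong (γ c D j ℤ.*_) (coeff-X^*-< j (1+X ^ₚ (D ℕ.∸ 2 ℕ.* j)) i i<j)) (ℤ.*-zeroʳ (γ c D j)))
  lower : ∀ i → i ℕ.≤ h → coeff c i ≡ coeff (Σₚ (suc h) F) i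
  lower i i≤h = trans (γ-recurrence c D i) (sym (trans (coeff-Σₚ (suc h) F i)
    (trans (Σ<-truncate (suc h) (ℕ.s≤s i≤h) (coeff-F-< i)) (Σ<-cong (suc i) λ { j (ℕ.s≤s j≤i) → coeff-F i j j≤i }))))
  go : ∀ i → _ → _ → coeff c i ≡ coeff (Σₚ (suc h) F) i
  go i (inj₁ i≤h) _          = lower i i≤h
  go i (inj₂ _)   (inj₂ D<i) = trans (deg<ˡ pal i D<i) (sym (deg<ˡ Σ-pal i D<i))
  go i (inj₂ h<i) (inj₁ i≤D) = trans (mirror pal i (D ℕ.∸ i) (ℕ.m+[n∸m]≡n i≤D))
    (trans (lower (D ℕ.∸ i) D∸i≤h) (sym (mirror Σ-pal i (D ℕ.∸ i) (ℕ.m+[n∸m]≡n i≤D))))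
    where
    D∸i≤h : D ℕ.∸ i ℕ.≤ h
    D∸i≤h = ℕ.m≤n+o⇒m∸n≤o D i (ℕ.≤-trans (D≤1+2*[D/2] D)
      (ℕ.+-mono-≤ h<i (ℕ.≤-reflexive (ℕ.+-identityʳ h))))

P≡Σ : ∀ n s t → P n s t ≡ Σ< (suc (totient n ℕ./ 2))
      (λ j → γ (Φ n) (totient n) j ℤ.* (s ℤ.^ (totient n ℕ.∸ 2 ℕ.* j) ℤ.* (- t) ℤ.^ j))
P≡Σ n s t rewrite lucasγ≡ n = sumℤ-gammas (Φ n) (totient n) (totient n ℕ./ 2) _

-- Gaussian integers

-- Without eta, sums and products of variables stay stuck instead of unfolding into their
-- components, so terms remain in the shape that the ring solver expects.
record ℤ[i] : Set where
  no-eta-equality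
  pattern
  constructor _+i_
  field re im : ℤ

open ℤ[i]

infix 6 _+i_

0ᵢ 1ᵢ : ℤ[i]
0ᵢ = + 0 +i + 0
1ᵢ = + 1 +i + 0

infixl 6 _+ᵢ_
infixl 7 _*ᵢ_

_+ᵢ_ _*ᵢ_ : ℤ[i] → ℤ[i] → ℤ[i]
(a +i b) +ᵢ (c +i d) = (a ℤ.+ c) +i (b ℤ.+ d)
(a +i b) *ᵢ (c +i d) = (a ℤ.* c ℤ.- b ℤ.* d) +i (a ℤ.* d ℤ.+ b ℤ.* c)

-ᵢ_ : ℤ[i] → ℤ[i]
-ᵢ (a +i b) = (- a) +i (- b)

*ᵢ-assoc : ∀ x y z → (x *ᵢ y) *ᵢ z ≡ x *ᵢ (y *ᵢ z)
*ᵢ-assoc (a +i b) (c +i d) (e +i f) = cong₂ _+i_ (real a b c d e f) (imaginary a b c d e f)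
  where
  real : ∀ a b c d e f → (a ℤ.* c ℤ.- b ℤ.* d) ℤ.* e ℤ.- (a ℤ.* d ℤ.+ b ℤ.* c) ℤ.* f
                       ≡ a ℤ.* (c ℤ.* e ℤ.- d ℤ.* f) ℤ.- b ℤ.* (c ℤ.* f ℤ.+ d ℤ.* e)
  real = ℤ-Solver.solve-∀
  imaginary : ∀ a b c d e f → (a ℤ.* c ℤ.- b ℤ.* d) ℤ.* f ℤ.+ (a ℤ.* d ℤ.+ b ℤ.* c) ℤ.* e
                            ≡ a ℤ.* (c ℤ.* f ℤ.+ d ℤ.* e) ℤ.+ b ℤ.* (c ℤ.* e ℤ.- d ℤ.* f)
  imaginary = ℤ-Solver.solve-∀

*ᵢ-comm : ∀ x y → x *ᵢ y ≡ y *ᵢ x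
*ᵢ-comm (a +i b) (c +i d) = cong₂ _+i_ (real a b c d) (imaginary a b c d)
  where
  real : ∀ a b c d → a ℤ.* c ℤ.- b ℤ.* d ≡ c ℤ.* a ℤ.- d ℤ.* b
  real = ℤ-Solver.solve-∀
  imaginary : ∀ a b c d → a ℤ.* d ℤ.+ b ℤ.* c ≡ c ℤ.* b ℤ.+ d ℤ.* a
  imaginary = ℤ-Solver.solve-∀

*ᵢ-identityˡ : ∀ x → 1ᵢ *ᵢ x ≡ x
*ᵢ-identityˡ (a +i b) = cong₂ _+i_ (real a b) (imaginary a b)
  where
  real : ∀ a b → + 1 ℤ.* a ℤ.- + 0 ℤ.* b ≡ a
  real = ℤ-Solver.solve-∀
  imaginary : ∀ a b → + 1 ℤ.* b ℤ.+ + 0 ℤ.* a ≡ b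
  imaginary = ℤ-Solver.solve-∀

*ᵢ-distribˡ : ∀ x y z → x *ᵢ (y +ᵢ z) ≡ x *ᵢ y +ᵢ x *ᵢ z
*ᵢ-distribˡ (a +i b) (c +i d) (e +i f) = cong₂ _+i_ (real a b c d e f) (imaginary a b c d e f)
  where
  real : ∀ a b c d e f → a ℤ.* (c ℤ.+ e) ℤ.- b ℤ.* (d ℤ.+ f) ≡ a ℤ.* c ℤ.- b ℤ.* d ℤ.+ (a ℤ.* e ℤ.- b ℤ.* f)
  real = ℤ-Solver.solve-∀
  imaginary : ∀ a b c d e f → a ℤ.* (d ℤ.+ f) ℤ.+ b ℤ.* (c ℤ.+ e) ≡ a ℤ.* d ℤ.+ b ℤ.* c ℤ.+ (a ℤ.* f ℤ.+ b ℤ.* e)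
  imaginary = ℤ-Solver.solve-∀

gaussianRing : CommutativeRing 0ℓ 0ℓ
gaussianRing = record
  { Carrier = ℤ[i] ; _≈_ = _≡_ ; _+_ = _+ᵢ_ ; _*_ = _*ᵢ_ ; -_ = -ᵢ_ ; 0# = 0ᵢ ; 1# = 1ᵢ
  ; isCommutativeRing = record
    { isRing = record
      { +-isAbelianGroup = record
        { isGroup = record
          { isMonoid = record
            { isSemigroup = record
              { isMagma = record { isEquivalence = isEquivalence ; ∙-cong = cong₂ _+ᵢ_ }
              ; assoc = λ { (a +i b) (c +i d) (e +i f) → cong₂ _+i_ (ℤ.+-assoc a c e) (ℤ.+-assoc b d f) } }
            ; identity = (λ { (a +i b) → cong₂ _+i_ (ℤ.+-identityˡ a) (ℤ.+-identityˡ b) })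
                       , (λ { (a +i b) → cong₂ _+i_ (ℤ.+-identityʳ a) (ℤ.+-identityʳ b) }) }
          ; inverse = (λ { (a +i b) → cong₂ _+i_ (ℤ.+-inverseˡ a) (ℤ.+-inverseˡ b) })
                    , (λ { (a +i b) → cong₂ _+i_ (ℤ.+-inverseʳ a) (ℤ.+-inverseʳ b) })
          ; ⁻¹-cong = cong -ᵢ_ }
        ; comm = λ { (a +i b) (c +i d) → cong₂ _+i_ (ℤ.+-comm a c) (ℤ.+-comm b d) } }
      ; *-cong = cong₂ _*ᵢ_
      ; *-assoc = *ᵢ-assoc
      ; *-identity = *ᵢ-identityˡ , (λ x → trans (*ᵢ-comm x 1ᵢ) (*ᵢ-identityˡ x))
      ; distrib = *ᵢ-distribˡ
                , (λ x y z → trans (*ᵢ-comm (y +ᵢ z) x) (trans (*ᵢ-distribˡ x y z) (cong₂ _+ᵢ_ (*ᵢ-comm x y) (*ᵢ-comm x z)))) }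
    ; *-comm = *ᵢ-comm } }

0ᵢ≟ : ∀ z → Maybe (0ᵢ ≡ z)
0ᵢ≟ (+ 0 +i + 0) = just refl
0ᵢ≟ _            = nothing

open CommutativeRing gaussianRing using ()
  renaming (+-identityʳ to +ᵢ-identityʳ; zeroˡ to *ᵢ-zeroˡ; zeroʳ to *ᵢ-zeroʳ; *-identityʳ to *ᵢ-identityʳ)
open Exp (CommutativeRing.commutativeSemiring gaussianRing) using ()
  renaming (_^_ to _^ᵢ_; ^-homo-* to ^ᵢ-homo-*; ^-assocʳ to ^ᵢ-assocʳ; ^-distrib-* to ^ᵢ-distrib-*)
open Divisibility (CommutativeRing.semiring gaussianRing) using ()
  renaming (_∣_ to _∣ᵢ_; _,_ to _,ᵢ_; ∣ʳ-trans to ∣ᵢ-trans; x∣ʳy⇒x∣ʳzy to ∣ᵢ-*ˡ)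
open Solver (ACR.fromCommutativeRing gaussianRing 0ᵢ≟) using () renaming (solve to solveᵢ)

ι : ℤ → ℤ[i]
ι a = a +i + 0

ι-* : ∀ a b → ι (a ℤ.* b) ≡ ι a *ᵢ ι b
ι-* a b = cong₂ _+i_ (real a b) (imaginary a b)
  where
  real : ∀ a b → a ℤ.* b ≡ a ℤ.* b ℤ.- + 0 ℤ.* + 0
  real = ℤ-Solver.solve-∀
  imaginary : ∀ a b → + 0 ≡ a ℤ.* + 0 ℤ.+ + 0 ℤ.* b
  imaginary = ℤ-Solver.solve-∀

ι-^ : ∀ a n → ι (a ℤ.^ n) ≡ ι a ^ᵢ n
ι-^ a zero    = refl
ι-^ a (suc n) = trans (ι-* a (a ℤ.^ n)) (cong (ι a *ᵢ_) (ι-^ a n))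

1^ᵢ : ∀ n → 1ᵢ ^ᵢ n ≡ 1ᵢ
1^ᵢ zero    = refl
1^ᵢ (suc n) = trans (*ᵢ-identityˡ _) (1^ᵢ n)

-- Evaluation of polynomials

module _ (α : ℤ[i]) where
  eval : Poly → ℤ[i]
  eval []      = 0ᵢ
  eval (a ∷ p) = ι a +ᵢ α *ᵢ eval p

  eval-≈[] : ∀ p → p ≈ [] → eval p ≡ 0ᵢ
  eval-≈[] []      _ = refl
  eval-≈[] (a ∷ p) e = trans (cong₂ (λ a z → ι a +ᵢ α *ᵢ z) (at e 0) (eval-≈[] p (mk≈ λ i → at e (suc i))))
    (solveᵢ 1 (λ x → Κ 0ᵢ ⊕ x ⊗ Κ 0ᵢ , Κ 0ᵢ) refl α)

  eval-cong : ∀ {p q} → p ≈ q → eval p ≡ eval q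
  eval-cong {[]}    {q}     e = sym (eval-≈[] q (≈-sym e))
  eval-cong {a ∷ p} {[]}    e = eval-≈[] (a ∷ p) e
  eval-cong {a ∷ p} {b ∷ q} e = cong₂ (λ a z → ι a +ᵢ α *ᵢ z) (at e 0) (eval-cong {p} {q} (mk≈ λ i → at e (suc i)))

  eval-+ : ∀ p q → eval (p +ₚ q) ≡ eval p +ᵢ eval q
  eval-+ []      q       = solveᵢ 1 (λ y → y , Κ 0ᵢ ⊕ y) refl (eval q)
  eval-+ (a ∷ p) []      = sym (+ᵢ-identityʳ _)
  eval-+ (a ∷ p) (b ∷ q) = trans (cong (λ z → ι (a ℤ.+ b) +ᵢ α *ᵢ z) (eval-+ p q))
    (solveᵢ 5 (λ a b x y z → (a ⊕ b) ⊕ x ⊗ (y ⊕ z) , a ⊕ x ⊗ y ⊕ (b ⊕ x ⊗ z)) refl (ι a) (ι b) α (eval p) (eval q))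

  eval-scale : ∀ a p → eval (scale a p) ≡ ι a *ᵢ eval p
  eval-scale a []      = sym (*ᵢ-zeroʳ (ι a))
  eval-scale a (b ∷ p) = trans (cong₂ (λ c z → c +ᵢ α *ᵢ z) (ι-* a b) (eval-scale a p))
    (solveᵢ 4 (λ a b x y → a ⊗ b ⊕ x ⊗ (a ⊗ y) , a ⊗ (b ⊕ x ⊗ y)) refl (ι a) (ι b) α (eval p))

  eval-* : ∀ p q → eval (p *ₚ q) ≡ eval p *ᵢ eval q
  eval-* []      q = sym (*ᵢ-zeroˡ (eval q))
  eval-* (a ∷ p) q = trans (eval-+ (scale a q) (+ 0 ∷ p *ₚ q))
    (trans (cong₂ (λ y z → y +ᵢ (0ᵢ +ᵢ α *ᵢ z)) (eval-scale a q) (eval-* p q))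
    (solveᵢ 4 (λ a x y z → a ⊗ z ⊕ (Κ 0ᵢ ⊕ x ⊗ (y ⊗ z)) , (a ⊕ x ⊗ y) ⊗ z) refl (ι a) α (eval p) (eval q)))

  eval-1 : eval 1ₚ ≡ 1ᵢ
  eval-1 = solveᵢ 1 (λ x → Κ 1ᵢ ⊕ x ⊗ Κ 0ᵢ , Κ 1ᵢ) refl α

  eval-X : eval X ≡ α
  eval-X = solveᵢ 1 (λ x → Κ 0ᵢ ⊕ x ⊗ (Κ 1ᵢ ⊕ x ⊗ Κ 0ᵢ) , x) refl α

  eval-1+X : eval 1+X ≡ 1ᵢ +ᵢ α
  eval-1+X = solveᵢ 1 (λ x → Κ 1ᵢ ⊕ x ⊗ (Κ 1ᵢ ⊕ x ⊗ Κ 0ᵢ) , Κ 1ᵢ ⊕ x) refl α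

  eval-^ : ∀ p n → eval (p ^ₚ n) ≡ eval p ^ᵢ n
  eval-^ p zero    = eval-1
  eval-^ p (suc n) = trans (eval-* p (p ^ₚ n)) (cong (eval p *ᵢ_) (eval-^ p n))

  eval-∣ : ∀ {p q} → p ∣ₚ q → eval p ∣ᵢ eval q
  eval-∣ {p} (c ,∣ e) = eval c ,ᵢ trans (sym (eval-* c p)) (eval-cong e)

  eval-X^ : ∀ n → eval (X ^ₚ n) ≡ α ^ᵢ n
  eval-X^ n = trans (eval-^ X n) (cong (_^ᵢ n) eval-X)

  eval-Xⁿ-1 : ∀ n → eval (Xⁿ-1 n) ≡ α ^ᵢ n +ᵢ (-ᵢ 1ᵢ)
  eval-Xⁿ-1 n = trans (eval-cong (Xⁿ-1≈ n)) (trans (eval-+ (X ^ₚ n) (-ₚ 1ₚ)) (cong₂ _+ᵢ_ (eval-X^ n)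
    (solveᵢ 1 (λ x → Κ (-ᵢ 1ᵢ) ⊕ x ⊗ Κ 0ᵢ , Κ (-ᵢ 1ᵢ)) refl α)))

  eval-geometric : ∀ r y → eval y ≡ 1ᵢ → eval (geometric r y) ≡ ι (+ r)
  eval-geometric zero    y y≡1 = refl
  eval-geometric (suc r) y y≡1 = trans (eval-+ 1ₚ (y *ₚ geometric r y)) (trans
    (cong₂ _+ᵢ_ eval-1 (trans (eval-* y (geometric r y)) (cong₂ _*ᵢ_ y≡1 (eval-geometric r y y≡1))))
    (trans (cong (1ᵢ +ᵢ_) (*ᵢ-identityˡ (ι (+ r)))) refl))

-- Arithmetic modulo 3 in ℤ[i]

3ᵢ : ℤ[i]
3ᵢ = ι (+ 3)

norm : ℤ[i] → ℤ
norm (a +i b) = a ℤ.* a ℤ.+ b ℤ.* b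

norm-* : ∀ x y → norm (x *ᵢ y) ≡ norm x ℤ.* norm y
norm-* (a +i b) (c +i d) = lemma a b c d
  where
  lemma : ∀ a b c d → (a ℤ.* c ℤ.- b ℤ.* d) ℤ.* (a ℤ.* c ℤ.- b ℤ.* d) ℤ.+ (a ℤ.* d ℤ.+ b ℤ.* c) ℤ.* (a ℤ.* d ℤ.+ b ℤ.* c)
                    ≡ (a ℤ.* a ℤ.+ b ℤ.* b) ℤ.* (c ℤ.* c ℤ.+ d ℤ.* d)
  lemma = ℤ-Solver.solve-∀

3∣-components : ∀ {a b} → + 3 ℤ∣.∣ a → + 3 ℤ∣.∣ b → 3ᵢ ∣ᵢ a +i b
3∣-components (ℤ∣.divides q refl) (ℤ∣.divides r refl) = (q +i r) ,ᵢ cong₂ _+i_ (real q r) (imaginary q r)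
  where
  real : ∀ q r → q ℤ.* + 3 ℤ.- r ℤ.* + 0 ≡ q ℤ.* + 3
  real = ℤ-Solver.solve-∀
  imaginary : ∀ q r → q ℤ.* + 0 ℤ.+ r ℤ.* + 3 ≡ r ℤ.* + 3
  imaginary = ℤ-Solver.solve-∀

3∣-re : ∀ {a b} → 3ᵢ ∣ᵢ a +i b → + 3 ℤ∣.∣ a
3∣-re ((q +i r) ,ᵢ refl) = ℤ∣.divides q (real q r)
  where
  real : ∀ q r → q ℤ.* + 3 ℤ.- r ℤ.* + 0 ≡ q ℤ.* + 3
  real = ℤ-Solver.solve-∀

3∣ι⇔ : ∀ a → (3ᵢ ∣ᵢ ι a) ⇔ (+ 3 ℤ.∣ a)
3∣ι⇔ a = mk⇔ (λ e → ℤ∣.∣⇒∣ᵤ (3∣-re e)) (λ e → 3∣-components (ℤ∣.∣ᵤ⇒∣ e) (ℤ∣.divides (+ 0) refl))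

square-mod-3 : ∀ a → + 3 ℤ∣.∣ a ⊎ ∃[ k ] (a ℤ.* a ≡ + 1 ℤ.+ k ℤ.* + 3)
square-mod-3 a with a ℤ.%ℕ 3 | a ℤ./ℕ 3 | ℤ.n%ℕd<d a 3 | ℤ.a≡a%ℕn+[a/ℕn]*n a 3
... | 0 | q | _ | refl = inj₁ (ℤ∣.divides q (ℤ.+-identityˡ _))
... | 1 | q | _ | refl = inj₂ (+ 2 ℤ.* q ℤ.+ q ℤ.* q ℤ.* + 3 , lemma q)
  where
  lemma : ∀ q → (+ 1 ℤ.+ q ℤ.* + 3) ℤ.* (+ 1 ℤ.+ q ℤ.* + 3) ≡ + 1 ℤ.+ (+ 2 ℤ.* q ℤ.+ q ℤ.* q ℤ.* + 3) ℤ.* + 3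
  lemma = ℤ-Solver.solve-∀
... | 2 | q | _ | refl = inj₂ (+ 1 ℤ.+ + 4 ℤ.* q ℤ.+ q ℤ.* q ℤ.* + 3 , lemma q)
  where
  lemma : ∀ q → (+ 2 ℤ.+ q ℤ.* + 3) ℤ.* (+ 2 ℤ.+ q ℤ.* + 3) ≡ + 1 ℤ.+ (+ 1 ℤ.+ + 4 ℤ.* q ℤ.+ q ℤ.* q ℤ.* + 3) ℤ.* + 3
  lemma = ℤ-Solver.solve-∀
... | suc (suc (suc r)) | q | ℕ.s≤s (ℕ.s≤s (ℕ.s≤s ())) | _

-- -1 is not a square modulo 3.
3∣norm⇒3∣ : ∀ z → + 3 ℤ∣.∣ norm z → 3ᵢ ∣ᵢ z
3∣norm⇒3∣ (a +i b) 3∣n with square-mod-3 a | square-mod-3 b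
... | inj₁ 3∣a         | inj₁ 3∣b         = 3∣-components 3∣a 3∣b
... | inj₁ 3∣a         | inj₂ (k , b²≡)   = contradiction
  (ℤ∣.∣m+n∣n⇒∣m (subst (+ 3 ℤ∣.∣_) b²≡ (ℤ∣.∣m+n∣m⇒∣n 3∣n (ℤ∣.∣m⇒∣m*n a 3∣a))) (ℤ∣.divides k refl)) (from-no (+ 3 ℤ∣.∣? + 1))
... | inj₂ (k , a²≡)   | inj₁ 3∣b         = contradiction
  (ℤ∣.∣m+n∣n⇒∣m (subst (+ 3 ℤ∣.∣_) a²≡ (ℤ∣.∣m+n∣n⇒∣m 3∣n (ℤ∣.∣m⇒∣m*n b 3∣b))) (ℤ∣.divides k refl)) (from-no (+ 3 ℤ∣.∣? + 1))
... | inj₂ (k , a²≡)   | inj₂ (l , b²≡)   = contradiction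
  (ℤ∣.∣m+n∣n⇒∣m (subst (+ 3 ℤ∣.∣_) (trans (cong₂ ℤ._+_ a²≡ b²≡) (lemma k l)) 3∣n) (ℤ∣.divides (k ℤ.+ l) refl)) (from-no (+ 3 ℤ∣.∣? + 2))
  where
  lemma : ∀ k l → + 1 ℤ.+ k ℤ.* + 3 ℤ.+ (+ 1 ℤ.+ l ℤ.* + 3) ≡ + 2 ℤ.+ (k ℤ.+ l) ℤ.* + 3
  lemma = ℤ-Solver.solve-∀

-- The norm carries the question to ℤ, where 3 is prime, and `3∣norm⇒3∣` brings the answer back.
3ᵢ-prime : ∀ z w → 3ᵢ ∣ᵢ z *ᵢ w → 3ᵢ ∣ᵢ z ⊎ 3ᵢ ∣ᵢ w
3ᵢ-prime z w (c ,ᵢ c3≡zw) =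
  [ (λ e → inj₁ (3∣norm⇒3∣ z (ℤ∣.∣ᵤ⇒∣ e))) , (λ e → inj₂ (3∣norm⇒3∣ w (ℤ∣.∣ᵤ⇒∣ e))) ]′
  (euclidsLemma ℤ.∣ norm z ∣ ℤ.∣ norm w ∣ (from-yes (prime? 3)) (subst (3 ℕ.∣_) (ℤ.abs-* (norm z) (norm w))
    (ℤ∣.∣⇒∣ᵤ {+ 3} (ℤ∣.divides (norm c ℤ.* + 3) (trans (sym (norm-* z w)) (trans (cong norm (sym c3≡zw))
      (trans (norm-* c 3ᵢ) (sym (ℤ.*-assoc (norm c) (+ 3) (+ 3))))))))))

3∤1 : ¬ 3ᵢ ∣ᵢ 1ᵢ
3∤1 e = from-no (+ 3 ℤ∣.∣? + 1) (3∣-re e)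

3∤-^ : ∀ {z} n → ¬ 3ᵢ ∣ᵢ z → ¬ 3ᵢ ∣ᵢ z ^ᵢ n
3∤-^ zero    3∤z e = 3∤1 e
3∤-^ {z} (suc n) 3∤z e = [ 3∤z , 3∤-^ n 3∤z ]′ (3ᵢ-prime z (z ^ᵢ n) e)

infix 4 _≡₃_

_≡₃_ : ℤ[i] → ℤ[i] → Set
z ≡₃ w = ∃[ c ] (z ≡ w +ᵢ c *ᵢ 3ᵢ)

≡₃-+ : ∀ {z z′ w w′} → z ≡₃ z′ → w ≡₃ w′ → z +ᵢ w ≡₃ z′ +ᵢ w′
≡₃-+ {z′ = z′} {w′ = w′} (c , refl) (d , refl) = c +ᵢ d ,
  solveᵢ 4 (λ z c w d → z ⊕ c ⊗ Κ 3ᵢ ⊕ (w ⊕ d ⊗ Κ 3ᵢ) , z ⊕ w ⊕ (c ⊕ d) ⊗ Κ 3ᵢ) refl z′ c w′ d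

≡₃-* : ∀ {z z′ w w′} → z ≡₃ z′ → w ≡₃ w′ → z *ᵢ w ≡₃ z′ *ᵢ w′
≡₃-* {z′ = z′} {w′ = w′} (c , refl) (d , refl) = z′ *ᵢ d +ᵢ c *ᵢ w′ +ᵢ c *ᵢ d *ᵢ 3ᵢ ,
  solveᵢ 4 (λ z c w d → (z ⊕ c ⊗ Κ 3ᵢ) ⊗ (w ⊕ d ⊗ Κ 3ᵢ) , z ⊗ w ⊕ (z ⊗ d ⊕ c ⊗ w ⊕ c ⊗ d ⊗ Κ 3ᵢ) ⊗ Κ 3ᵢ) refl z′ c w′ d

≡₃-refl : ∀ {z} → z ≡₃ z
≡₃-refl {z} = 0ᵢ , solveᵢ 1 (λ z → z , z ⊕ Κ 0ᵢ ⊗ Κ 3ᵢ) refl z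

≡₃-^ : ∀ {z w} n → z ≡₃ w → z ^ᵢ n ≡₃ w ^ᵢ n
≡₃-^ zero    e = ≡₃-refl
≡₃-^ (suc n) e = ≡₃-* e (≡₃-^ n e)

≡₃-∣ : ∀ {z w} → z ≡₃ w → 3ᵢ ∣ᵢ w → 3ᵢ ∣ᵢ z
≡₃-∣ (c , refl) (d ,ᵢ refl) = (d +ᵢ c) ,ᵢ solveᵢ 2 (λ c d → (d ⊕ c) ⊗ Κ 3ᵢ , d ⊗ Κ 3ᵢ ⊕ c ⊗ Κ 3ᵢ) refl c d

≡₃-sym : ∀ {z w} → z ≡₃ w → w ≡₃ z
≡₃-sym {w = w} (c , refl) = -ᵢ c , solveᵢ 2 (λ w c → w , w ⊕ c ⊗ Κ 3ᵢ ⊕ (⊝ c) ⊗ Κ 3ᵢ) refl w c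

-- When 3 divides Φ n at a root of unity

-- The order is required to survive reduction: no smaller positive power is 1 even modulo 3. Only in
-- this form does `minimal` contradict a divisibility by 3.
record Order (α : ℤ[i]) (e : ℕ) : Set where
  field
    positive : 1 ℕ.≤ e
    power    : α ^ᵢ e ≡ 1ᵢ
    minimal  : ∀ r → 1 ℕ.≤ r → r ℕ.< e → ¬ 3ᵢ ∣ᵢ α ^ᵢ r +ᵢ (-ᵢ 1ᵢ)

3∣-prodTo : ∀ α n F → 3ᵢ ∣ᵢ eval α (prodTo n F) → ∃[ i ] (1 ℕ.≤ i × i ℕ.≤ n × 3ᵢ ∣ᵢ eval α (F i))
3∣-prodTo α zero    F e = contradiction (subst (3ᵢ ∣ᵢ_) (eval-1 α) e) 3∤1
3∣-prodTo α (suc n) F e with 3ᵢ-prime _ _ (subst (3ᵢ ∣ᵢ_) (eval-* α (prodTo n F) (F (suc n))) e)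
... | inj₁ e₁ = let i , 1≤i , i≤n , eᵢ = 3∣-prodTo α n F e₁ in i , 1≤i , ℕ.m≤n⇒m≤1+n i≤n , eᵢ
... | inj₂ e₂ = suc n , ℕ.s≤s ℕ.z≤n , ℕ.≤-refl , e₂

3∣-when : ∀ α {A : Set} p (a? : Dec A) → 3ᵢ ∣ᵢ eval α (p when a?) → A × 3ᵢ ∣ᵢ eval α p
3∣-when α p (yes a) e = a , e
3∣-when α p (no _)  e = contradiction (subst (3ᵢ ∣ᵢ_) (eval-1 α) e) 3∤1

3-free-part : ∀ N q → 1 ℕ.≤ q → q ℕ.≤ N → ∃[ m ] ∃[ a ] (q ≡ m ℕ.* 3 ℕ.^ a × ¬ 3 ℕ.∣ m)
3-free-part zero    q 1≤q q≤0 = contradiction (ℕ.≤-trans 1≤q q≤0) λ ()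
3-free-part (suc N) q 1≤q q≤1+N with 3 ℕ.∣? q
... | no 3∤q = q , 0 , sym (ℕ.*-identityʳ q) , 3∤q
... | yes (ℕ.divides k refl) =
  let 1≤k = ℕ.n≢0⇒n>0 {k} λ { refl → contradiction 1≤q λ () }
      m , a , k≡ , 3∤m = 3-free-part N k 1≤k
        (ℕ.≤-pred (ℕ.≤-trans (ℕ.m<m*n k 3 {{ℕ.>-nonZero 1≤k}} (ℕ.s≤s (ℕ.s≤s ℕ.z≤n))) q≤1+N))
  in m , suc a , trans (cong (ℕ._* 3) k≡) (trans (ℕ.*-assoc m _ 3) (cong (m ℕ.*_) (ℕ.*-comm (3 ℕ.^ a) 3))) , 3∤m

module _ {α : ℤ[i]} {e : ℕ} (ord : Order α e) where
  open Order ord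
  private instance
    e-nonZero : ℕ.NonZero e
    e-nonZero = ℕ.>-nonZero positive

  power-multiple : ∀ k → α ^ᵢ (e ℕ.* k) ≡ 1ᵢ
  power-multiple k = trans (sym (^ᵢ-assocʳ α e k)) (trans (cong (_^ᵢ k) power) (1^ᵢ k))

  -- αⁿ depends only on the remainder `n % e`, to which `minimal` applies unless it is 0.
  3∣Φ⇒e∣n : ∀ n → 1 ℕ.≤ n → 3ᵢ ∣ᵢ eval α (Φ n) → e ℕ.∣ n
  3∣Φ⇒e∣n n 1≤n 3∣Φ with n ℕ.% e ℕ.≟ 0
  ... | yes n%e≡0 = ℕ.m%n≡0⇒n∣m n e n%e≡0
  ... | no  n%e≢0 = contradiction
    (subst (3ᵢ ∣ᵢ_) (trans (eval-Xⁿ-1 α n) (cong (_+ᵢ (-ᵢ 1ᵢ)) α^n≡α^[n%e]))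
      (∣ᵢ-trans 3∣Φ (eval-∣ α (Φ∣Xⁿ-1 1≤n (cyclotomic 1≤n)))))
    (minimal (n ℕ.% e) (ℕ.n≢0⇒n>0 n%e≢0) (ℕ.m%n<n n e))
    where
    α^n≡α^[n%e] : α ^ᵢ n ≡ α ^ᵢ (n ℕ.% e)
    α^n≡α^[n%e] = trans
      (cong (α ^ᵢ_) (trans (ℕ.m≡m%n+[m/n]*n n e) (cong (n ℕ.% e ℕ.+_) (ℕ.*-comm (n ℕ./ e) e))))
      (trans (^ᵢ-homo-* α (n ℕ.% e) (e ℕ.* (n ℕ./ e)))
      (trans (cong (α ^ᵢ (n ℕ.% e) *ᵢ_) (power-multiple (n ℕ./ e))) (*ᵢ-identityʳ _)))

  eval-geometric-X^ : ∀ r k → e ℕ.∣ k → eval α (geometric r (X ^ₚ k)) ≡ ι (+ r)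
  eval-geometric-X^ r k (ℕ.divides q refl) = eval-geometric α r (X ^ₚ (q ℕ.* e))
    (trans (eval-X^ α (q ℕ.* e)) (trans (cong (α ^ᵢ_) (ℕ.*-comm q e)) (power-multiple q)))

  3∣Φ⇒n≡e*3^a : ∀ n → 1 ℕ.≤ n → 3ᵢ ∣ᵢ eval α (Φ n) → ∃[ a ] (n ≡ e ℕ.* 3 ℕ.^ a)
  3∣Φ⇒n≡e*3^a n 1≤n 3∣Φ with 3∣Φ⇒e∣n n 1≤n 3∣Φ
  ... | ℕ.divides q n≡q*e with 3-free-part q q (ℕ.n≢0⇒n>0 {q} λ { refl → ℕ.≢-nonZero⁻¹ n {{ℕ.>-nonZero 1≤n}} n≡q*e }) ℕ.≤-refl
  ...   | m , a , q≡m*3^a , 3∤m = go m refl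
    where
    n≡m*[e*3^a] : n ≡ m ℕ.* (e ℕ.* 3 ℕ.^ a)
    n≡m*[e*3^a] = trans n≡q*e (trans (cong (ℕ._* e) q≡m*3^a) (trans (ℕ.*-assoc m (3 ℕ.^ a) e) (cong (m ℕ.*_) (ℕ.*-comm (3 ℕ.^ a) e))))
    go : ∀ m′ → m ≡ m′ → ∃[ a ] (n ≡ e ℕ.* 3 ℕ.^ a)
    go 0 refl = contradiction (3 ℕ.∣0) 3∤m
    go 1 refl = a , trans n≡m*[e*3^a] (ℕ.*-identityˡ _)
    go (suc (suc m′)) refl = contradiction
      (Equivalence.to (3∣ι⇔ (+ m)) (subst (3ᵢ ∣ᵢ_) (eval-geometric-X^ m k (ℕ.m∣m*n (3 ℕ.^ a)))
        (∣ᵢ-trans (subst (λ n → 3ᵢ ∣ᵢ eval α (Φ n)) n≡m*[e*3^a] 3∣Φ)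
          (eval-∣ α (Φ∣geometric m (ℕ.s≤s (ℕ.s≤s ℕ.z≤n)) 1≤k (cyclotomic (subst (1 ℕ.≤_) n≡m*[e*3^a] 1≤n)) (cyclotomic 1≤k)))))) 3∤m
      where
      k = e ℕ.* 3 ℕ.^ a
      1≤k : 1 ℕ.≤ k
      1≤k = ℕ.*-mono-≤ positive (ℕ.m^n>0 3 a)

  -- 3 is the value of the product of the Φ d over the new divisors d of e·3ᵃ,
  -- and only d = e·3ᵃ itself can account for the prime 3.
  3∣Φ[e*3^a] : ∀ a → 3ᵢ ∣ᵢ eval α (Φ (e ℕ.* 3 ℕ.^ a))
  3∣Φ[e*3^a] zero rewrite ℕ.*-identityʳ e =
    -- Here the value αᵉ - 1 = 0 of the product over all divisors of `e` takes the place of 3. A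
    -- factor divisible by 3 has an index that both divides `e` and is divisible by it.
    let d , 1≤d , d≤e , 3∣ = 3∣-prodTo α e (divisorFactor e) (subst (3ᵢ ∣ᵢ_) (sym eval≡0) (0ᵢ ,ᵢ *ᵢ-zeroˡ 3ᵢ))
        d∣e , 3∣Φd = 3∣-when α (Φ d) (d ℕ.∣? e) 3∣
    in subst (λ d → 3ᵢ ∣ᵢ eval α (Φ d)) (ℕ.∣-antisym d∣e (3∣Φ⇒e∣n d 1≤d 3∣Φd)) 3∣Φd
    where
    eval≡0 : eval α (prodTo e (divisorFactor e)) ≡ 0ᵢ
    eval≡0 = trans (eval-cong α (divisors (cyclotomic positive))) (trans (eval-Xⁿ-1 α e) (cong (_+ᵢ (-ᵢ 1ᵢ)) power))
  3∣Φ[e*3^a] (suc a) =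
    let d , 1≤d , _ , 3∣ = 3∣-prodTo α n (newDivisors n k) (subst (3ᵢ ∣ᵢ_) (sym eval≡3) (1ᵢ ,ᵢ *ᵢ-identityˡ 3ᵢ))
        (d∣n , d∤k) , 3∣Φd = 3∣-when α (Φ d) (d ℕ.∣? n ×-dec ¬? (d ℕ.∣? k)) 3∣
        b , d≡ = 3∣Φ⇒n≡e*3^a d 1≤d 3∣Φd
    in subst (λ d → 3ᵢ ∣ᵢ eval α (Φ d)) (trans (d≡n b d≡ d∣n d∤k) (sym e*3^[1+a])) 3∣Φd
    where
    k = e ℕ.* 3 ℕ.^ a
    n = 3 ℕ.* k
    e*3^[1+a] : e ℕ.* 3 ℕ.^ suc a ≡ 3 ℕ.* k
    e*3^[1+a] = trans (sym (ℕ.*-assoc e 3 _)) (trans (cong (ℕ._* 3 ℕ.^ a) (ℕ.*-comm e 3)) (ℕ.*-assoc 3 e _))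
    1≤k : 1 ℕ.≤ k
    1≤k = ℕ.*-mono-≤ positive (ℕ.m^n>0 3 a)
    eval≡3 : eval α (prodTo n (newDivisors n k)) ≡ 3ᵢ
    eval≡3 = trans (eval-cong α (newDivisors≈geometric 3 (ℕ.s≤s ℕ.z≤n) 1≤k (cyclotomic (ℕ.*-mono-≤ {1} {3} (ℕ.s≤s ℕ.z≤n) 1≤k)) (cyclotomic 1≤k)))
      (eval-geometric-X^ 3 k (ℕ.m∣m*n (3 ℕ.^ a)))
    -- For b ≤ a the number `d` would divide `k`, and for b > a + 1 it would exceed `n`.
    d≡n : ∀ {d} b → d ≡ e ℕ.* 3 ℕ.^ b → d ℕ.∣ n → ¬ d ℕ.∣ k → d ≡ n
    d≡n b refl d∣n d∤k with ℕ.<-cmp b (suc a)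
    ... | tri< (ℕ.s≤s b≤a) _ _ = contradiction (ℕ.*-monoʳ-∣ e (ℕ.divides (3 ℕ.^ (a ℕ.∸ b))
            (trans (cong (3 ℕ.^_) (sym (ℕ.m∸n+n≡m b≤a))) (ℕ.^-distribˡ-+-* 3 (a ℕ.∸ b) b)))) d∤k
    ... | tri≈ _ refl _ = e*3^[1+a]
    ... | tri> _ _ a<b = contradiction
            (ℕ.∣⇒≤ {{ℕ.>-nonZero (ℕ.*-mono-≤ {1} {3} (ℕ.s≤s ℕ.z≤n) 1≤k)}} d∣n)
            (ℕ.<⇒≱ (subst (ℕ._< e ℕ.* 3 ℕ.^ b) e*3^[1+a] (ℕ.*-monoʳ-< e (ℕ.^-monoʳ-< 3 (ℕ.s≤s (ℕ.s≤s ℕ.z≤n)) a<b))))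

-- Lucas atoms as values of cyclotomic polynomials

Σᵢ : ℕ → (ℕ → ℤ[i]) → ℤ[i]
Σᵢ zero    f = 0ᵢ
Σᵢ (suc n) f = f 0 +ᵢ Σᵢ n (f ∘ suc)

Σᵢ-cong : ∀ n {f g} → (∀ j → j ℕ.< n → f j ≡ g j) → Σᵢ n f ≡ Σᵢ n g
Σᵢ-cong zero    e = refl
Σᵢ-cong (suc n) e = cong₂ _+ᵢ_ (e 0 (ℕ.s≤s ℕ.z≤n)) (Σᵢ-cong n λ j j<n → e (suc j) (ℕ.s≤s j<n))

Σᵢ-zero : ∀ n {f} → (∀ j → j ℕ.< n → f j ≡ 0ᵢ) → Σᵢ n f ≡ 0ᵢ
Σᵢ-zero zero    e = refl
Σᵢ-zero (suc n) e = cong₂ _+ᵢ_ (e 0 (ℕ.s≤s ℕ.z≤n)) (Σᵢ-zero n λ j j<n → e (suc j) (ℕ.s≤s j<n))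

Σᵢ-≡₃ : ∀ n {f g} → (∀ j → f j ≡₃ g j) → Σᵢ n f ≡₃ Σᵢ n g
Σᵢ-≡₃ zero    e = ≡₃-refl
Σᵢ-≡₃ (suc n) e = ≡₃-+ (e 0) (Σᵢ-≡₃ n (e ∘ suc))

Σᵢ-distribˡ : ∀ n z f → z *ᵢ Σᵢ n f ≡ Σᵢ n (λ j → z *ᵢ f j)
Σᵢ-distribˡ zero    z f = *ᵢ-zeroʳ z
Σᵢ-distribˡ (suc n) z f = trans (*ᵢ-distribˡ z (f 0) _) (cong (z *ᵢ f 0 +ᵢ_) (Σᵢ-distribˡ n z (f ∘ suc)))

ι-Σ : ∀ n f → ι (Σ< n f) ≡ Σᵢ n (ι ∘ f)
ι-Σ zero    f = refl
ι-Σ (suc n) f = cong (ι (f 0) +ᵢ_) (ι-Σ n (f ∘ suc))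

eval-Σₚ : ∀ α n F → eval α (Σₚ n F) ≡ Σᵢ n (eval α ∘ F)
eval-Σₚ α zero    F = refl
eval-Σₚ α (suc n) F = trans (eval-+ α (F 0) _) (cong (eval α (F 0) +ᵢ_) (eval-Σₚ α n (F ∘ suc)))

module _ (n : ℕ) where
  private
    D = totient n
    h = D ℕ./ 2

    2j≤D : ∀ {j} → j ℕ.< suc h → 2 ℕ.* j ℕ.≤ D
    2j≤D (ℕ.s≤s j≤h) = ℕ.≤-trans (ℕ.*-monoʳ-≤ 2 j≤h) (2*[D/2]≤D D)

  Pᵢ-term : ℤ[i] → ℤ[i] → ℕ → ℤ[i]
  Pᵢ-term s u j = ι (γ (Φ n) D j) *ᵢ (s ^ᵢ (D ℕ.∸ 2 ℕ.* j) *ᵢ u ^ᵢ j)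

  -- The Gaussian extension of the Lucas atom, with u for -t.
  Pᵢ : ℤ[i] → ℤ[i] → ℤ[i]
  Pᵢ s u = Σᵢ (suc h) (Pᵢ-term s u)

  ι-P : ∀ s t → ι (P n s t) ≡ Pᵢ (ι s) (ι (- t))
  ι-P s t = trans (cong ι (P≡Σ n s t)) (trans (ι-Σ (suc h) summand)
    (Σᵢ-cong (suc h) {ι ∘ summand} {Pᵢ-term (ι s) (ι (- t))} λ j _ → term j))
    where
    summand : ℕ → ℤ
    summand j = γ (Φ n) D j ℤ.* (s ℤ.^ (D ℕ.∸ 2 ℕ.* j) ℤ.* (- t) ℤ.^ j)
    term : ∀ j → ι (summand j) ≡ Pᵢ-term (ι s) (ι (- t)) j
    term j = trans (ι-* (γ (Φ n) D j) (s ℤ.^ (D ℕ.∸ 2 ℕ.* j) ℤ.* (- t) ℤ.^ j)) (cong (ι (γ (Φ n) D j) *ᵢ_)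
      (trans (ι-* (s ℤ.^ (D ℕ.∸ 2 ℕ.* j)) ((- t) ℤ.^ j)) (cong₂ _*ᵢ_ (ι-^ s (D ℕ.∸ 2 ℕ.* j)) (ι-^ (- t) j))))

  evalΦ≡Pᵢ : ∀ α → 2 ℕ.≤ n → eval α (Φ n) ≡ Pᵢ (1ᵢ +ᵢ α) α
  evalΦ≡Pᵢ α 2≤n = trans (eval-cong α (γ-expansion (palindromic-Φ 2≤n)))
    (trans (eval-Σₚ α (suc h) summand)
    (Σᵢ-cong (suc h) {eval α ∘ summand} {Pᵢ-term (1ᵢ +ᵢ α) α} λ j _ → term j))
    where
    summand : ℕ → Poly
    summand j = scale (γ (Φ n) D j) (γ-basis D j)
    term : ∀ j → eval α (summand j) ≡ Pᵢ-term (1ᵢ +ᵢ α) α j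
    term j = trans (eval-scale α (γ (Φ n) D j) (γ-basis D j)) (cong (ι (γ (Φ n) D j) *ᵢ_)
      (trans (eval-* α (X ^ₚ j) (1+X ^ₚ (D ℕ.∸ 2 ℕ.* j)))
      (trans (cong₂ _*ᵢ_ (eval-X^ α j) (trans (eval-^ α 1+X (D ℕ.∸ 2 ℕ.* j)) (cong (_^ᵢ (D ℕ.∸ 2 ℕ.* j)) (eval-1+X α))))
             (*ᵢ-comm (α ^ᵢ j) _))))

  -- Termwise, l^D splits as l^(D - 2j) (l²)^j. The bound on `j` ensures 2j ≤ D, so that the
  -- truncated subtraction is a true one.
  Pᵢ-homogeneous : ∀ l s u → l ^ᵢ D *ᵢ Pᵢ s u ≡ Pᵢ (l *ᵢ s) (l ^ᵢ 2 *ᵢ u)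
  Pᵢ-homogeneous l s u = trans (Σᵢ-distribˡ (suc h) (l ^ᵢ D) (Pᵢ-term s u))
    (Σᵢ-cong (suc h) {λ j → l ^ᵢ D *ᵢ Pᵢ-term s u j} {Pᵢ-term (l *ᵢ s) (l ^ᵢ 2 *ᵢ u)} term)
    where
    term : ∀ j → j ℕ.< suc h → l ^ᵢ D *ᵢ Pᵢ-term s u j ≡ Pᵢ-term (l *ᵢ s) (l ^ᵢ 2 *ᵢ u) j
    term j j<1+h = trans
      (cong (_*ᵢ (g *ᵢ (s ^ᵢ k *ᵢ u ^ᵢ j))) (trans (cong (l ^ᵢ_) (sym (ℕ.m∸n+n≡m (2j≤D j<1+h))))
        (trans (^ᵢ-homo-* l k (2 ℕ.* j)) (cong (l ^ᵢ k *ᵢ_) (sym (^ᵢ-assocʳ l 2 j))))))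
      (trans (solveᵢ 5 (λ a b g c d → a ⊗ b ⊗ (g ⊗ (c ⊗ d)) , g ⊗ ((a ⊗ c) ⊗ (b ⊗ d))) refl
        (l ^ᵢ k) ((l ^ᵢ 2) ^ᵢ j) g (s ^ᵢ k) (u ^ᵢ j))
      (cong (g *ᵢ_) (cong₂ _*ᵢ_ (sym (^ᵢ-distrib-* l s k)) (sym (^ᵢ-distrib-* (l ^ᵢ 2) u j)))))
      where
      g = ι (γ (Φ n) D j)
      k = D ℕ.∸ 2 ℕ.* j

  Pᵢ-≡₃ : ∀ {s s′ u u′} → s ≡₃ s′ → u ≡₃ u′ → Pᵢ s u ≡₃ Pᵢ s′ u′
  Pᵢ-≡₃ {s} {s′} {u} {u′} s≡ u≡ = Σᵢ-≡₃ (suc h) {Pᵢ-term s u} {Pᵢ-term s′ u′} λ j →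
    ≡₃-* (≡₃-refl {ι (γ (Φ n) D j)}) (≡₃-* (≡₃-^ (D ℕ.∸ 2 ℕ.* j) s≡) (≡₃-^ j u≡))

  -- Φ n (α) = Pᵢ (1 + α) α, so by homogeneity it suffices to find a unit l modulo 3
  -- carrying (s , -t) to (1 + α , α).
  3∣P⇔3∣Φ : ∀ {α} s t l → 2 ℕ.≤ n → ¬ 3ᵢ ∣ᵢ l → l *ᵢ ι s ≡₃ 1ᵢ +ᵢ α → l ^ᵢ 2 *ᵢ ι (- t) ≡₃ α →
            (+ 3 ℤ.∣ P n s t) ⇔ (3ᵢ ∣ᵢ eval α (Φ n))
  3∣P⇔3∣Φ {α} s t l 2≤n 3∤l s≡ u≡ = mk⇔ to from
    where
    l^D*P≡₃Φ : l ^ᵢ D *ᵢ ι (P n s t) ≡₃ eval α (Φ n)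
    l^D*P≡₃Φ = subst₂ _≡₃_
      (trans (sym (Pᵢ-homogeneous l (ι s) (ι (- t)))) (cong (l ^ᵢ D *ᵢ_) (sym (ι-P s t))))
      (sym (evalΦ≡Pᵢ α 2≤n)) (Pᵢ-≡₃ s≡ u≡)
    to : + 3 ℤ.∣ P n s t → 3ᵢ ∣ᵢ eval α (Φ n)
    to 3∣P = ≡₃-∣ (≡₃-sym l^D*P≡₃Φ) (∣ᵢ-*ˡ (l ^ᵢ D) (Equivalence.from (3∣ι⇔ (P n s t)) 3∣P))
    from : 3ᵢ ∣ᵢ eval α (Φ n) → + 3 ℤ.∣ P n s t
    from 3∣Φ = [ (λ 3∣l^D → contradiction 3∣l^D (3∤-^ D 3∤l)) , Equivalence.to (3∣ι⇔ (P n s t)) ]′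
      (3ᵢ-prime (l ^ᵢ D) (ι (P n s t)) (≡₃-∣ l^D*P≡₃Φ 3∣Φ))

  3∣P⇔n≡e*3^a : ∀ {α e} s t l → Order α e → 2 ℕ.≤ n → ¬ 3ᵢ ∣ᵢ l → l *ᵢ ι s ≡₃ 1ᵢ +ᵢ α → l ^ᵢ 2 *ᵢ ι (- t) ≡₃ α →
                (+ 3 ℤ.∣ P n s t) ⇔ (∃[ a ] (n ≡ e ℕ.* 3 ℕ.^ a))
  3∣P⇔n≡e*3^a {α} s t l ord 2≤n 3∤l s≡ u≡ = ⇔.trans (3∣P⇔3∣Φ s t l 2≤n 3∤l s≡ u≡)
    (mk⇔ (3∣Φ⇒n≡e*3^a ord n (ℕ.<⇒≤ 2≤n)) λ (a , n≡) → subst (λ n → 3ᵢ ∣ᵢ eval α (Φ n)) (sym n≡) (3∣Φ[e*3^a] ord a))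

-- The roots of unity 1, -1 and i and their orders modulo 3

-1ᵢ iᵢ : ℤ[i]
-1ᵢ = ι (- + 1)
iᵢ  = + 0 +i + 1

3∤re : ∀ {a b} → ¬ (+ 3 ℤ∣.∣ a) → ¬ 3ᵢ ∣ᵢ a +i b
3∤re 3∤a e = 3∤a (3∣-re e)

order-1 : Order 1ᵢ 1
order-1 = record { positive = ℕ.s≤s ℕ.z≤n ; power = refl ; minimal = λ { (suc r) _ (ℕ.s≤s ()) } }

order--1 : Order -1ᵢ 2
order--1 = record
  { positive = ℕ.s≤s ℕ.z≤n
  ; power    = refl
  ; minimal  = λ { 1 _ _ → 3∤re (from-no (+ 3 ℤ∣.∣? - + 2)) ; (suc (suc r)) _ (ℕ.s≤s (ℕ.s≤s ())) } }

order-i : Order iᵢ 4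
order-i = record
  { positive = ℕ.s≤s ℕ.z≤n
  ; power    = refl
  -- The real parts of i - 1, i² - 1 and i³ - 1 are -1, -2 and -1, all prime to 3.
  ; minimal  = λ
    { 1 _ _ → 3∤re (from-no (+ 3 ℤ∣.∣? - + 1))
    ; 2 _ _ → 3∤re (from-no (+ 3 ℤ∣.∣? - + 2))
    ; 3 _ _ → 3∤re (from-no (+ 3 ℤ∣.∣? - + 1))
    ; (suc (suc (suc (suc r)))) _ (ℕ.s≤s (ℕ.s≤s (ℕ.s≤s (ℕ.s≤s ())))) } }

-- φ(n) is even and positive

-- For n = 2r the value divides that of (Xⁿ - 1) / (X² - 1) at -1, which is r; here r ≥ 2, as n = 2
-- would give the root -1. For odd `n` it divides (-1)ⁿ - 1 = -2. Zero divides neither.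
Φ[-1]≢0 : ∀ {n} → 3 ℕ.≤ n → eval -1ᵢ (Φ n) ≢ 0ᵢ
Φ[-1]≢0 {n} 3≤n Φ≡0 with n ℕ.% 2 | ℕ.m≡m%n+[m/n]*n n 2 | ℕ.m%n<n n 2
... | 0 | n≡ | _ = contradiction (trans (cong re r≡0) refl) r≢0
  where
  r = n ℕ./ 2
  2≤r : 2 ℕ.≤ r
  2≤r = ℕ.*-cancelʳ-< 2 1 r (subst (2 ℕ.<_) n≡ 3≤n)
  r≢0 : + r ≢ + 0
  r≢0 e = contradiction (subst (2 ℕ.≤_) (ℤ.+-injective e) 2≤r) λ ()
  Φ∣r : 0ᵢ ∣ᵢ ι (+ r)
  Φ∣r = subst₂ _∣ᵢ_ (trans (cong (eval -1ᵢ ∘ Φ) (sym n≡)) Φ≡0) (eval-geometric-X^ order--1 r 2 ℕ.∣-refl)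
    (eval-∣ -1ᵢ (Φ∣geometric r 2≤r (ℕ.s≤s ℕ.z≤n) (cyclotomic (ℕ.*-mono-≤ (ℕ.<⇒≤ 2≤r) (ℕ.s≤s ℕ.z≤n))) (cyclotomic (ℕ.s≤s ℕ.z≤n))))
  r≡0 : ι (+ r) ≡ 0ᵢ
  r≡0 = let c ,ᵢ e = Φ∣r in trans (sym e) (*ᵢ-zeroʳ c)
... | 1 | n≡ | _ = contradiction -2≡0 λ ()
  where
  1≤n = ℕ.≤-trans (ℕ.s≤s ℕ.z≤n) 3≤n
  [-1]^n : -1ᵢ ^ᵢ n ≡ -1ᵢ
  [-1]^n = trans (cong (-1ᵢ ^ᵢ_) (trans n≡ (cong suc (ℕ.*-comm (n ℕ./ 2) 2)))) (cong (-1ᵢ *ᵢ_) (power-multiple order--1 (n ℕ./ 2)))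
  -2≡0 : -1ᵢ +ᵢ (-ᵢ 1ᵢ) ≡ 0ᵢ
  -2≡0 = let c ,ᵢ e = eval-∣ -1ᵢ (Φ∣Xⁿ-1 1≤n (cyclotomic 1≤n)) in
    trans (cong (_+ᵢ (-ᵢ 1ᵢ)) (sym [-1]^n)) (trans (sym (eval-Xⁿ-1 -1ᵢ n)) (trans (sym e) (trans (cong (c *ᵢ_) Φ≡0) (*ᵢ-zeroʳ c))))
... | suc (suc _) | _ | ℕ.s≤s (ℕ.s≤s ())

-- For odd φ(n) every term of Pᵢ 0 (-1) = Φ n (-1) vanishes.
totient-even : ∀ {n} → 3 ℕ.≤ n → totient n ≡ 2 ℕ.* (totient n ℕ./ 2)
totient-even {n} 3≤n with totient n ℕ.% 2 | ℕ.m≡m%n+[m/n]*n (totient n) 2 | ℕ.m%n<n (totient n) 2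
... | 0 | D≡ | _ = trans D≡ (ℕ.*-comm (totient n ℕ./ 2) 2)
... | 1 | D≡ | _ = contradiction (trans (evalΦ≡Pᵢ n -1ᵢ (ℕ.<⇒≤ 3≤n)) (Σᵢ-zero (suc h) {Pᵢ-term n 0ᵢ -1ᵢ} λ { j (ℕ.s≤s j≤h) → term j j≤h })) (Φ[-1]≢0 3≤n)
  where
  h = totient n ℕ./ 2
  0^ : ∀ k → 1 ℕ.≤ k → 0ᵢ ^ᵢ k ≡ 0ᵢ
  0^ (suc k) _ = *ᵢ-zeroˡ (0ᵢ ^ᵢ k)
  term : ∀ j → j ℕ.≤ h → Pᵢ-term n 0ᵢ -1ᵢ j ≡ 0ᵢ
  term j j≤h = trans (cong (ι (γ (Φ n) (totient n) j) *ᵢ_)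
    (trans (cong (_*ᵢ -1ᵢ ^ᵢ j) (0^ (totient n ℕ.∸ 2 ℕ.* j) (ℕ.m<n⇒0<n∸m 2j<D))) (*ᵢ-zeroˡ (-1ᵢ ^ᵢ j))))
    (*ᵢ-zeroʳ (ι (γ (Φ n) (totient n) j)))
    where
    2j<D : 2 ℕ.* j ℕ.< totient n
    2j<D = ℕ.≤-<-trans (ℕ.*-monoʳ-≤ 2 j≤h) (ℕ.≤-reflexive (trans (cong suc (ℕ.*-comm 2 h)) (sym D≡)))
... | suc (suc _) | _ | ℕ.s≤s (ℕ.s≤s ())

totient-positive : ∀ {n} → 1 ℕ.≤ n → 1 ℕ.≤ totient n
totient-positive {n} 1≤n = subst (1 ℕ.≤_) (sym (totient≡sumTo n))
  (subst (ℕ._≤ sumTo n f) (𝟙-yes (gcd 1 n ℕ.≟ 1) (ℕ.∣1⇒≡1 (gcd[m,n]∣m 1 n))) (first≤sumTo n 1≤n))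
  where
  f = λ k → 𝟙 (gcd k n ℕ.≟ 1)
  first≤sumTo : ∀ m → 1 ℕ.≤ m → f 1 ℕ.≤ sumTo m f
  first≤sumTo 1             _ = ℕ.≤-refl
  first≤sumTo (suc (suc m)) _ = ℕ.≤-trans (first≤sumTo (suc m) (ℕ.s≤s ℕ.z≤n)) (ℕ.m≤m+n _ _)

-- Only the term j = 0 survives, through 0^0 = 1. Its coefficient is the constant term of `Φ n`,
-- which by palindromicity equals the leading coefficient 1.
P[s,0]≡s^φ : ∀ n s → 2 ℕ.≤ n → P n s (+ 0) ≡ s ℤ.^ totient n
P[s,0]≡s^φ n s 2≤n = trans (P≡Σ n s (+ 0)) (trans
  (Σ<-truncate {1} (suc (totient n ℕ./ 2)) {summand} (ℕ.s≤s ℕ.z≤n) λ { (suc j) _ → vanish j })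
  (trans (ℤ.+-identityʳ (summand 0)) (trans (cong₂ ℤ._*_ Φ₀≡1 (ℤ.*-identityʳ (s ℤ.^ totient n))) (ℤ.*-identityˡ (s ℤ.^ totient n)))))
  where
  summand : ℕ → ℤ
  summand j = γ (Φ n) (totient n) j ℤ.* (s ℤ.^ (totient n ℕ.∸ 2 ℕ.* j) ℤ.* (+ 0) ℤ.^ j)
  vanish : ∀ j → summand (suc j) ≡ + 0
  vanish j = trans (cong (γ (Φ n) (totient n) (suc j) ℤ.*_)
    (trans (cong (s ℤ.^ (totient n ℕ.∸ 2 ℕ.* suc j) ℤ.*_) (ℤ.*-zeroˡ ((+ 0) ℤ.^ j))) (ℤ.*-zeroʳ (s ℤ.^ (totient n ℕ.∸ 2 ℕ.* suc j)))))
    (ℤ.*-zeroʳ (γ (Φ n) (totient n) (suc j)))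
  Φ₀≡1 : coeff (Φ n) 0 ≡ + 1
  Φ₀≡1 = trans (mirror (palindromic-Φ 2≤n) 0 (totient n) refl) (leading (monicΦ (cyclotomic (ℕ.<⇒≤ 2≤n))))

open import Data.Nat using (_≤_; _^_; _*_)
open import Data.Integer.Divisibility using (_∣_)

theorem6p5 : (n : ℕ) → 3 ≤ n →
    (P n (+ 0) (+ 0) ≡ + 0)
    × (P n (+ 1) (+ 0) ≡ + 1 × P n (- (+ 1)) (+ 0) ≡ + 1)
    × ((+ 3 ∣ P n (+ 0) (+ 1) ⇔ (∃[ m ] (1 ≤ m × n ≡ 2 * 3 ^ m)))
    × (+ 3 ∣ P n (+ 0) (- (+ 1)) ⇔ (∃[ m ] (1 ≤ m × n ≡ 2 * 3 ^ m))))
    × ((+ 3 ∣ P n (+ 1) (+ 1) ⇔ (∃[ m ] (n ≡ 4 * 3 ^ m)))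
    × (+ 3 ∣ P n (- (+ 1)) (+ 1) ⇔ (∃[ m ] (n ≡ 4 * 3 ^ m))))
    × ((+ 3 ∣ P n (+ 1) (- (+ 1)) ⇔ (∃[ m ] (n ≡ 3 * 3 ^ m)))
    × (+ 3 ∣ P n (- (+ 1)) (- (+ 1)) ⇔ (∃[ m ] (n ≡ 3 * 3 ^ m))))
theorem6p5 n 3≤n =
    trans (P[s,0]≡s^φ n (+ 0) 2≤n) (0^ (totient n) (totient-positive (ℕ.<⇒≤ 2≤n)))
  , (trans (P[s,0]≡s^φ n (+ 1) 2≤n) (ℤ.^-zeroˡ (totient n)) , trans (P[s,0]≡s^φ n (- + 1) 2≤n) [-1]^φ≡1)
  -- With s = 0 and α = -1 only l² (-t) = -1 constrains l: l = 1 for t = 1 and l = i for t = -1. The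
  -- latter is prime to 3 because (-i) i = 1.
  , ( ⇔.trans (3∣P⇔n≡e*3^a n (+ 0) (+ 1) 1ᵢ order--1 2≤n 3∤1 (0ᵢ , refl) (0ᵢ , refl)) 2*3^a
    , ⇔.trans (3∣P⇔n≡e*3^a n (+ 0) (- + 1) iᵢ order--1 2≤n (3∤1 ∘ ∣ᵢ-*ˡ (-ᵢ iᵢ)) (0ᵢ , refl) (0ᵢ , refl)) 2*3^a)
  -- Here l = ±(1 + i) makes l s = 1 + i exact, and -l² = -2i = i + (-i) · 3.
  , ( 3∣P⇔n≡e*3^a n (+ 1) (+ 1) (+ 1 +i + 1) order-i 2≤n (3∤re 3∤+1) (0ᵢ , refl) (-ᵢ iᵢ , refl)
    , 3∣P⇔n≡e*3^a n (- + 1) (+ 1) (- + 1 +i - + 1) order-i 2≤n (3∤re (from-no (+ 3 ℤ∣.∣? - + 1))) (0ᵢ , refl) (-ᵢ iᵢ , refl))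
  -- With α = 1 the target is (2 , 1). For s = 1, l = 2 has l² = 4 = 1 + 3; for s = -1, l = 1 has l
  -- s = -1 = 2 - 3.
  , ( ⇔.trans (3∣P⇔n≡e*3^a n (+ 1) (- + 1) (ι (+ 2)) order-1 2≤n (3∤re (from-no (+ 3 ℤ∣.∣? + 2))) (0ᵢ , refl) (1ᵢ , refl)) 3^a
    , ⇔.trans (3∣P⇔n≡e*3^a n (- + 1) (- + 1) 1ᵢ order-1 2≤n 3∤1 (-1ᵢ , refl) (0ᵢ , refl)) 3^a)
  where
  2≤n : 2 ≤ n
  2≤n = ℕ.<⇒≤ 3≤n
  3∤+1 = from-no (+ 3 ℤ∣.∣? + 1)
  0^ : ∀ k → 1 ≤ k → (+ 0) ℤ.^ k ≡ + 0
  0^ (suc k) _ = ℤ.*-zeroˡ ((+ 0) ℤ.^ k)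
  [-1]^φ≡1 : (- + 1) ℤ.^ totient n ≡ + 1
  [-1]^φ≡1 = trans (cong ((- + 1) ℤ.^_) (totient-even 3≤n))
    (trans (sym (ℤ.^-*-assoc (- + 1) 2 (totient n ℕ./ 2))) (ℤ.^-zeroˡ (totient n ℕ./ 2)))
  2*3^a : (∃[ a ] (n ≡ 2 * 3 ^ a)) ⇔ (∃[ m ] (1 ≤ m × n ≡ 2 * 3 ^ m))
  2*3^a = mk⇔ to λ (m , _ , n≡) → m , n≡
    where
    to : (∃[ a ] (n ≡ 2 * 3 ^ a)) → ∃[ m ] (1 ≤ m × n ≡ 2 * 3 ^ m)
    to (zero  , n≡) = contradiction (subst (3 ≤_) n≡ 3≤n) λ { (ℕ.s≤s (ℕ.s≤s ())) }
    to (suc a , n≡) = suc a , ℕ.s≤s ℕ.z≤n , n≡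
  3^a : (∃[ a ] (n ≡ 1 * 3 ^ a)) ⇔ (∃[ m ] (n ≡ 3 * 3 ^ m))
  3^a = mk⇔ to λ (m , n≡) → suc m , trans n≡ (sym (ℕ.*-identityˡ _))
    where
    to : (∃[ a ] (n ≡ 1 * 3 ^ a)) → ∃[ m ] (n ≡ 3 * 3 ^ m)
    to (zero  , n≡) = contradiction (subst (3 ≤_) n≡ 3≤n) λ { (ℕ.s≤s ()) }
    to (suc a , n≡) = a , trans n≡ (ℕ.*-identityˡ _)
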